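{- Let $\chi$ be a character of the hyperoctahedral group $B_n$ and let $\mathcal{B}$ be a finite set endowed with a map $\mathrm{sDes}:\mathcal{B}\to\Sigma^B(n)$. Then $\mathcal{B}$ is a fine set for $\chi$ if and only if $$\mathrm{ch}(\chi)=\sum_{b\in\mathcal{B}}F_{\mathrm{sDes}(b)}(x,y).$$ In particular, the distribution of the signed descent set over $\mathcal{B}$ (i.e. the numbers $|\{b\in\mathcal{B}:\mathrm{sDes}(b)=\sigma\}|$, $\sigma\in\Sigma^B(n)$) is uniquely determined by $\chi$.
   Context: $[n]=\{1,\dots,n\}$. $B_n$ is the group of signed permutations. A signed set is a pair $\sigma=(S,\varepsilon)$ with $n\in S\subseteq[n]$ and $\varepsilon:S\to\{ -,+\}$; $\Sigma^B(n)$ denotes the set of signed sets. Writing $S=\{s_1<\dots<s_k=n\}$ and $s_0=0$, the sign vector $\tilde\varepsilon:[n]\to\{ -,+\}$ is $\tilde\varepsilon(j)=\varepsilon(s_i)$ for $s_{i-1}<j\le s_i$. Signed sets correspond bijectively to signed compositions of $n$ (compositions $(\gamma_1,\dots,\gamma_k)$ of $n$ some of whose parts are barred): $S(\gamma)$ is the set of partial sums $r_i=\gamma_1+\dots+\gamma_i$ and the sign of $r_i$ is $-$ iff the $i$-th part is barred. Let ${\rm wDes}(\sigma)$ be the set of $s_i\in S$, $i<k$, such that either $\varepsilon(s_i)=\varepsilon(s_{i+1})$, or $\varepsilon(s_i)=+$ and $\varepsilon(s_{i+1})=-$. With commuting variables $x=(x_1,x_2,\dots)$, $y=(y_1,y_2,\dots)$,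 define $$F_\sigma(x,y)=\sum_{\substack{i_1\le\dots\le i_n\\ j\in{\rm wDes}(\sigma)\Rightarrow i_j<i_{j+1}}} z_{i_1}\cdots z_{i_n},$$ where the $j$-th factor $z_{i_j}$ is $x_{i_j}$ if $\tilde\varepsilon(j)=+$ and $y_{i_j}$ if $\tilde\varepsilon(j)=-$. Weights: let $\gamma$ be a signed composition with partial sums $r_0=0<r_1<\dots<r_k=n$ and blocks $I_i=\{r_{i-1}+1,\dots,r_i\}$. Then $\sigma=(S,\varepsilon)$ is $\gamma$-unimodal if for each $i$, $S\cap\{r_{i-1}+1,\dots,r_i-1\}$ is an initial segment (possibly empty) of $\{r_{i-1}+1,\dots,r_i-1\}$. Set $\mathrm{wt}_\gamma(\sigma)=0$ if $\sigma$ is not $\gamma$-unimodal or if $\tilde\varepsilon$ is not constant on some block $I_i$; otherwise $\mathrm{wt}_\gamma(\sigma)=(-1)^{|S\setminus S(\gamma)|+n_\gamma(\sigma)}$, where $n_\gamma(\sigma)$ is the number of $i$ such that $\tilde\varepsilon$ is $-$ on $I_i$ and the $i$-th part of $\gamma$ is barred. Signed cycle type: viewing $w\in B_n$ as a permutation of $\Omega_n=\{1,\dots,n,\bar1,\dots,\bar n\}$, its cycles come either in pairs $c\ne\bar c$ (a positive cycle of length $|c|$) or as single cycles $c=\bar c$ (a negative cycle of length $|c|/2$); the signed cycle type is the bipartition $(\alpha,\beta)$ of lengths of positive and negative cycles. For a class function $\chi$ on $B_n$ and signed composition $\gamma$, $\chi(\gamma)$ is the value of $\chi$ at elements of signed cycle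 type $(\alpha,\beta)$ where $\alpha$ (resp. $\beta$) is the decreasing rearrangement of the unbarred (resp. barred) parts of $\gamma$. A set $\mathcal{B}$ with a map $\mathrm{sDes}:\mathcal{B}\to\Sigma^B(n)$ is a fine set for $\chi$ if $\chi(\gamma)=\sum_{b\in\mathcal{B}}\mathrm{wt}_\gamma(\mathrm{sDes}(b))$ for every signed composition $\gamma$ of $n$. Frobenius characteristic: $p^{\pm}_k=\sum_i(x_i^k\pm y_i^k)$, $p^\pm_\lambda=\prod_j p^\pm_{\lambda_j}$, and $\mathrm{ch}(\chi)=\frac{1}{2^nn!}\sum_{w\in B_n}\chi(w)\,p^+_\alpha(x,y)p^-_\beta(x,y)$, where $(\alpha,\beta)$ is the signed cycle type of $w$. A character means a non-virtual character. -}

module Defs where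

open import Level using (0ℓ)
open import Data.Bool using (Bool; true; false; T; not; _∧_; _∨_; if_then_else_)
open import Data.Nat as ℕ using (ℕ; zero; suc; _^_; _≤ᵇ_; _<ᵇ_; _≤_)
open import Data.Integer as ℤ using (ℤ; +_; -[1+_])
open import Data.Fin as Fin using (Fin; toℕ)
open import Data.List as List using (List; []; _∷_; map; concatMap; allFin; upTo; mapMaybe; length; filter; foldr; take; drop; zip; cartesianProductWith)
open import Data.List.Relation.Unary.All using (All)
open import Data.Nat.ListAction using (sum)
open import Data.Bool.ListAction using (and)
open import Data.List.Relation.Binary.Permutation.Propositional using (_↭_)
open import Data.Vec as Vec using (Vec; tabulate; toList)
import Data.Vec.Properties as VecP
import Data.Maybe.Properties as MaybeP
open import Data.Maybe using (Maybe; just; nothing)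
open import Data.Product using (Σ; ∃; _×_; _,_; proj₁; proj₂)
open import Relation.Nullary using (¬_; Dec; yes; no)
open import Relation.Nullary.Decidable using (⌊_⌋)
open import Relation.Binary.PropositionalEquality using (_≡_)
open import Relation.Binary.Definitions using (DecidableEquality)
open import Algebra.Bundles using (CommutativeRing)

data Sign : Set where
  ⊕ ⊖ : Sign

_≟ˢ_ : DecidableEquality Sign
⊕ ≟ˢ ⊕ = yes _≡_.refl
⊕ ≟ˢ ⊖ = no (λ ())
⊖ ≟ˢ ⊕ = no (λ ())
⊖ ≟ˢ ⊖ = yes _≡_.refl

_==ˢ_ : Sign → Sign → Bool
a ==ˢ b = ⌊ a ≟ˢ b ⌋

_·ˢ_ : Sign → Sign → Sign
⊕ ·ˢ s = s
⊖ ·ˢ ⊕ = ⊖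
⊖ ·ˢ ⊖ = ⊕

sgnℤ : Sign → ℤ
sgnℤ ⊕ = + 1
sgnℤ ⊖ = -[1+ 0 ]

negOnePow : ℕ → ℤ
negOnePow zero = + 1
negOnePow (suc zero) = -[1+ 0 ]
negOnePow (suc (suc k)) = negOnePow k

allFunsTo : {A : Set} → List A → (n : ℕ) → List (Fin n → A)
allFunsTo xs zero = (λ ()) ∷ []
allFunsTo xs (suc n) =
  concatMap (λ f → map (λ a → cons a f) xs) (allFunsTo xs n)
  where
  cons : _ → (Fin n → _) → Fin (suc n) → _
  cons a f Fin.zero = a
  cons a f (Fin.suc i) = f i

allB : {A : Set} → (A → Bool) → List A → Bool
allB p xs = and (map p xs)

sumFinℤ : (N : ℕ) → (Fin N → ℤ) → ℤ
sumFinℤ N f = foldr ℤ._+_ (+ 0) (map f (allFin N))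

sumListℤ : List ℤ → ℤ
sumListℤ = foldr ℤ._+_ (+ 0)

countTrue : List Bool → ℕ
countTrue bs = length (filter (λ b → b ≡? true) bs)
  where
  _≡?_ : (a b : Bool) → Dec (a ≡ b)
  _≡?_ = Data.Bool._≟_
    where import Data.Bool

-- The hyperoctahedral group B_n: signed permutations.
-- w ∈ B_n is (π, ε): w(i) = π(i) if ε(i) = ⊕ and w(i) = bar(π(i)) if ε(i) = ⊖,
-- and w(bar i) = bar(w(i)).

isInjective : {n : ℕ} → (Fin n → Fin n) → Bool
isInjective {n} π =
  allB (λ i → allB (λ j → not ⌊ π i Fin.≟ π j ⌋ ∨ ⌊ i Fin.≟ j ⌋) (allFin n)) (allFin n)

record SPerm (n : ℕ) : Set where
  constructor sperm
  field
    perm : Fin n → Fin n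
    sign : Fin n → Sign
    inj  : T (isInjective perm)
open SPerm public

allSPerm : (n : ℕ) → List (SPerm n)
allSPerm n = concatMap build (allFunsTo (allFin n) n)
  where
  build : (Fin n → Fin n) → List (SPerm n)
  build π with T? (isInjective π)
    where open import Relation.Nullary.Decidable using (T?)
  ... | yes p = map (λ ε → sperm π ε p) (allFunsTo (⊕ ∷ ⊖ ∷ []) n)
  ... | no _  = []

IsProduct : {n : ℕ} → SPerm n → SPerm n → SPerm n → Set
IsProduct u v w = ∀ i → (perm u i ≡ perm v (perm w i))
                      × (sign u i ≡ (sign w i ·ˢ sign v (perm w i)))

IsIdentity : {n : ℕ} → SPerm n → Set
IsIdentity e = ∀ i → (perm e i ≡ i) × (sign e i ≡ ⊕)

-- Signed cycle type.
-- The cycles of w on Ω_n correspond to the cycles of |w| = perm w on [n]: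
-- a |w|-cycle of length ℓ whose product of signs is ⊕ gives a pair of
-- cycles c ≠ bar c (a positive cycle of length ℓ); if the product is ⊖ it
-- gives one cycle c = bar c of size 2ℓ (a negative cycle of length ℓ).

iter : {n : ℕ} → ℕ → (Fin n → Fin n) → Fin n → Fin n
iter zero f i = i
iter (suc k) f i = f (iter k f i)

orbitLen : {n : ℕ} → (Fin n → Fin n) → Fin n → ℕ
orbitLen {n} f i = go 1 n
  where
  go : ℕ → ℕ → ℕ
  go k zero = k
  go k (suc fuel) = if ⌊ iter k f i Fin.≟ i ⌋ then k else go (suc k) fuel

orbitSign : {n : ℕ} → SPerm n → Fin n → Sign
orbitSign w i =
  foldr _·ˢ_ ⊕ (map (λ t → sign w (iter t (perm w) i)) (upTo (orbitLen (perm w) i)))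

isCycleRep : {n : ℕ} → SPerm n → Fin n → Bool
isCycleRep w i =
  allB (λ t → toℕ i ≤ᵇ toℕ (iter t (perm w) i)) (upTo (orbitLen (perm w) i))

signedCycles : {n : ℕ} → SPerm n → List (ℕ × Sign)
signedCycles {n} w =
  mapMaybe (λ i → if isCycleRep w i then just (orbitLen (perm w) i , orbitSign w i) else nothing)
           (allFin n)

partsWith : Sign → List (ℕ × Sign) → List ℕ
partsWith s xs = map proj₁ (filter (λ p → proj₂ p ≟ˢ s) xs)

-- Signed compositions: list of parts (k , s), s = ⊖ meaning the part is barred.

IsSignedComp : ℕ → List (ℕ × Sign) → Set
IsSignedComp n γ = All (λ p → 1 ≤ proj₁ p) γ × (sum (map proj₁ γ) ≡ n)

HasSignedCycleType : {n : ℕ} → SPerm n → List (ℕ × Sign) → Set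
HasSignedCycleType w γ =
  (partsWith ⊕ (signedCycles w) ↭ partsWith ⊕ γ) × (partsWith ⊖ (signedCycles w) ↭ partsWith ⊖ γ)

-- Signed sets. A signed set σ = (S, ε) ∈ Σ^B(n) is encoded as a vector
-- v : Vec (Maybe Sign) n with v[j-1] = just (ε j) if j ∈ S, nothing otherwise.

lastIsJust : List (Maybe Sign) → Bool
lastIsJust [] = false
lastIsJust (just _ ∷ []) = true
lastIsJust (nothing ∷ []) = false
lastIsJust (_ ∷ y ∷ ys) = lastIsJust (y ∷ ys)

IsSignedSet : {n : ℕ} → Vec (Maybe Sign) n → Set
IsSignedSet v = T (lastIsJust (toList v))

firstJust : List (Maybe Sign) → Maybe Sign
firstJust [] = nothing
firstJust (just s ∷ _) = just s
firstJust (nothing ∷ xs) = firstJust xs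

fromMaybeS : Maybe Sign → Sign
fromMaybeS (just s) = s
fromMaybeS nothing = ⊕

tildeList : List (Maybe Sign) → List Sign
tildeList [] = []
tildeList (x ∷ xs) = fromMaybeS (firstJust (x ∷ xs)) ∷ tildeList xs

wDesList : List (Maybe Sign) → List Bool
wDesList [] = []
wDesList (nothing ∷ xs) = false ∷ wDesList xs
wDesList (just e ∷ xs) = flag (firstJust xs) ∷ wDesList xs
  where
  flag : Maybe Sign → Bool
  flag nothing = false
  flag (just e′) = not ((e ==ˢ ⊖) ∧ (e′ ==ˢ ⊕))

-- Polynomials in finitely many variables x_1..x_M, y_1..y_M, as unnormalised
-- lists of terms (coefficient, (x-exponents, y-exponents)).

Monomial : ℕ → Set
Monomial M = Vec ℕ M × Vec ℕ M

Poly : ℕ → Set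
Poly M = List (ℤ × Monomial M)

_≟ᵐ_ : {M : ℕ} → DecidableEquality (Monomial M)
(a , b) ≟ᵐ (c , d) with VecP.≡-dec ℕ._≟_ a c | VecP.≡-dec ℕ._≟_ b d
... | yes _≡_.refl | yes _≡_.refl = yes _≡_.refl
... | no p | _ = no (λ { _≡_.refl → p _≡_.refl })
... | yes _ | no q = no (λ { _≡_.refl → q _≡_.refl })

coeff : {M : ℕ} → Monomial M → Poly M → ℤ
coeff m P = sumListℤ (map proj₁ (filter (λ t → proj₂ t ≟ᵐ m) P))

zeroExp : (M : ℕ) → Vec ℕ M
zeroExp M = tabulate (λ _ → 0)

kAt : {M : ℕ} → ℕ → Fin M → Vec ℕ M
kAt k a = tabulate (λ b → if ⌊ a Fin.≟ b ⌋ then k else 0)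

polyOne : (M : ℕ) → Poly M
polyOne M = (+ 1 , (zeroExp M , zeroExp M)) ∷ []

polyMul : {M : ℕ} → Poly M → Poly M → Poly M
polyMul = cartesianProductWith
  (λ { (c , (a , b)) (d , (a′ , b′)) → (c ℤ.* d , (Vec.zipWith ℕ._+_ a a′ , Vec.zipWith ℕ._+_ b b′)) })

powerSum : (M : ℕ) → ℕ → Sign → Poly M
powerSum M k s =
  concatMap (λ a → (+ 1 , (kAt k a , zeroExp M)) ∷ (sgnℤ s , (zeroExp M , kAt k a)) ∷ []) (allFin M)

powerSumOfType : (M : ℕ) → {n : ℕ} → SPerm n → Poly M
powerSumOfType M w = foldr (λ c P → polyMul (powerSum M (proj₁ c) (proj₂ c)) P) (polyOne M) (signedCycles w)

-- Coefficient of a monomial in F_σ(x_1..x_M, y_1..y_M) (all other variables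
-- set to 0): number of sequences i_1 ≤ … ≤ i_n in {1..M}, strict at j ∈ wDes(σ),
-- whose monomial z_{i_1}⋯z_{i_n} equals the given one.

chainOK : List ℕ → List Bool → Bool
chainOK (a ∷ b ∷ rest) (d ∷ ds) = (if d then a <ᵇ b else a ≤ᵇ b) ∧ chainOK (b ∷ rest) ds
chainOK _ _ = true

seqMonomial : {n M : ℕ} → List Sign → (Fin n → Fin M) → Monomial M
seqMonomial {n} {M} ε̃ f =
  ( tabulate (λ a → countTrue (map (λ p → ⌊ f (proj₁ p) Fin.≟ a ⌋ ∧ (proj₂ p ==ˢ ⊕)) (zip (allFin n) ε̃)))
  , tabulate (λ a → countTrue (map (λ p → ⌊ f (proj₁ p) Fin.≟ a ⌋ ∧ (proj₂ p ==ˢ ⊖)) (zip (allFin n) ε̃))) )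

coeffF : {n M : ℕ} → Monomial M → Vec (Maybe Sign) n → ℤ
coeffF {n} {M} m σ =
  + length (filter (λ f → ( T? (chainOK (map toℕ (toList (tabulate f))) (wDesList (toList σ)))
                             ×-dec (seqMonomial (tildeList (toList σ)) f ≟ᵐ m)))
                   (allFunsTo (allFin M) n))
  where
  open import Relation.Nullary.Decidable using (T?; _×-dec_)

chunks : {A : Set} → List (ℕ × Sign) → List A → List (List A × Sign)
chunks [] xs = []
chunks ((k , s) ∷ γ) xs = (take k xs , s) ∷ chunks γ (drop k xs)

isInitialSeg : List Bool → Bool
isInitialSeg [] = true
isInitialSeg (true ∷ bs) = isInitialSeg bs
isInitialSeg (false ∷ bs) = allB not bs

isJust : Maybe Sign → Bool
isJust (just _) = true
isJust nothing = false

initL : {A : Set} → List A → List A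
initL xs = take (length xs ℕ.∸ 1) xs

-- for one block I_i (membership/ε̃ pairs, barred flag):
-- nothing if the weight vanishes, otherwise the contribution to the exponent
blockExp : List (Maybe Sign × Sign) × Sign → Maybe ℕ
blockExp ([] , s) = nothing
blockExp (((m , e) ∷ rest) , s) =
  if isInitialSeg (map (λ p → isJust (proj₁ p)) (initL ((m , e) ∷ rest)))
     ∧ allB (λ p → proj₂ p ==ˢ e) rest
  then just (countTrue (map (λ p → isJust (proj₁ p)) (initL ((m , e) ∷ rest)))
             ℕ.+ (if (s ==ˢ ⊖) ∧ (e ==ˢ ⊖) then 1 else 0))
  else nothing

combine : List (Maybe ℕ) → Maybe ℕ
combine [] = just 0
combine (nothing ∷ _) = nothing
combine (just k ∷ xs) with combine xs
... | nothing = nothing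
... | just l = just (k ℕ.+ l)

wt : {n : ℕ} → List (ℕ × Sign) → Vec (Maybe Sign) n → ℤ
wt γ σ with combine (map blockExp (chunks γ (zip (toList σ) (tildeList (toList σ)))))
... | nothing = + 0
... | just k = negOnePow k

-- Fine sets. A finite set 𝓑 is taken to be Fin N; sDes : Fin N → Σ^B(n).

IsFineSet : (n : ℕ) → (SPerm n → ℤ) → (N : ℕ) → (Fin N → Vec (Maybe Sign) n) → Set
IsFineSet n χ N sDes =
  ∀ (γ : List (ℕ × Sign)) → IsSignedComp n γ →
  ∀ (w : SPerm n) → HasSignedCycleType w γ →
  χ w ≡ sumFinℤ N (λ b → wt γ (sDes b))

-- ch(χ) = Σ_b F_{sDes b}, written coefficientwise after multiplying by 2^n n!
-- (every monomial involves finitely many variables, so it suffices to compare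
-- coefficients in x_1..x_M, y_1..y_M for every M)
ChEquation : (n : ℕ) → (SPerm n → ℤ) → (N : ℕ) → (Fin N → Vec (Maybe Sign) n) → Set
ChEquation n χ N sDes =
  ∀ (M : ℕ) (m : Monomial M) →
  sumListℤ (map (λ w → χ w ℤ.* coeff m (powerSumOfType M w)) (allSPerm n))
    ≡ (+ (2 ^ n ℕ.* (n ℕ.!))) ℤ.* sumFinℤ N (λ b → coeffF m (sDes b))

countFibre : {n N : ℕ} → (Fin N → Vec (Maybe Sign) n) → Vec (Maybe Sign) n → ℕ
countFibre {n} {N} sDes σ =
  length (filter (λ b → VecP.≡-dec (MaybeP.≡-dec _≟ˢ_) (sDes b) σ) (allFin N))

module RingCasts (R : CommutativeRing 0ℓ 0ℓ) where
  open CommutativeRing R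
  ℕ→K : ℕ → Carrier
  ℕ→K zero = 0#
  ℕ→K (suc k) = 1# + ℕ→K k
  ℤ→K : ℤ → Carrier
  ℤ→K (+ k) = ℕ→K k
  ℤ→K -[1+ k ] = - ℕ→K (suc k)

record CharZeroField : Set₁ where
  field
    cring : CommutativeRing 0ℓ 0ℓ
  open CommutativeRing cring public
  open RingCasts cring public
  field
    one≉zero : ¬ (1# ≈ 0#)
    inverse  : ∀ x → ¬ (x ≈ 0#) → ∃ λ y → (x * y) ≈ 1#
    charZero : ∀ k → ¬ (ℕ→K (suc k) ≈ 0#)

module MatrixOps (F : CharZeroField) where
  open CharZeroField F

  Mat : ℕ → Set
  Mat d = Fin d → Fin d → Carrier

  sumK : (d : ℕ) → (Fin d → Carrier) → Carrier
  sumK d f = foldr _+_ 0# (map f (allFin d))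

  _·ᴹ_ : {d : ℕ} → Mat d → Mat d → Mat d
  _·ᴹ_ {d} A B i k = sumK d (λ j → A i j * B j k)

  idᴹ : {d : ℕ} → Mat d
  idᴹ i j = if ⌊ i Fin.≟ j ⌋ then 1# else 0#

  _≈ᴹ_ : {d : ℕ} → Mat d → Mat d → Set
  A ≈ᴹ B = ∀ i j → A i j ≈ B i j

  trace : {d : ℕ} → Mat d → Carrier
  trace {d} A = sumK d (λ i → A i i)

IsCharacter : (n : ℕ) → (SPerm n → ℤ) → Set₁
IsCharacter n χ =
  Σ CharZeroField λ F → let open CharZeroField F; open MatrixOps F in
  Σ ℕ λ d → Σ (SPerm n → Mat d) λ ρ →
    (∀ u v w → IsProduct u v w → ρ u ≈ᴹ (ρ v ·ᴹ ρ w))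
  × (∀ e → IsIdentity e → ρ e ≈ᴹ idᴹ)
  × (∀ w → trace (ρ w) ≈ ℤ→K (χ w))

{-# OPTIONS --safe #-}
module Submission where

-- For a signed composition γ let L_γ be the functional on type B quasisymmetric functions given by the product
-- of the noncommutative power sums Ψ^+_k ± Ψ^-_k over the parts of γ (minus for a barred part k); here Ψ_k is the
-- sum of (-1)^(ℓ(α)-1) (last part of α) M_α^* over the compositions α of k, where M^* is the basis dual to the
-- monomial one.
-- Expanding F_σ in monomial functions gives L_γ(F_σ) = wt_γ(σ). Each Ψ_k is primitive, so multiplication by a
-- power sum acts on the L_γ as a derivation; hence L_γ(p_w) = 0 unless w has cycle type γ. As χ is constant on
-- cycle types, L_γ(Σ_w χ(w) p_w) = χ(γ) Σ_w L_γ(p_w), and the last sum is 2^n n! by Pólya enumeration for the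
-- trivial character, Σ_w p_w = 2^n n! h_n(x), since L_γ(h_n) = 1. So the fine set identities say that L_γ takes
-- the same values on ch(χ) and on Σ_b F_{sDes b} for all γ, and the L_γ separate quasisymmetric functions by
-- triangularity. Uniqueness of the distribution follows by applying the ribbon functionals, dual to the F_σ.

-- A quasisymmetric function is handled through its coefficients, as a map `Comp → ℤ` invariant
-- under deletion of zero parts. The variables of one index are read in the order y, x because a
-- minus block followed by a plus block is the only change of block without a strict inequality, so
-- that y_i precedes x_i in an admissible word. With this order the coefficients of F_σ become the
-- indicator of a refinement, and no count of words is left.
--
-- All identities stay over the integers: 2^n n! is kept as a factor, and division occurs only as
-- cancellation of a positive integer. Centralizer orders are never computed. Orthogonality leaves a
-- single conjugacy class, and the Pólya count evaluates its whole contribution at once.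
--
-- The fine set condition is a statement about elements of cycle type γ, so the passage to ch(χ)
-- needs such an element for every γ. It is not constructed: the Pólya count is nonzero, hence some
-- term of it is, and orthogonality forces its type to be γ. This gives existence up to double
-- negation, which is enough for an equation of integers.

open import Defs
open import Level using (0ℓ)
open import Algebra.Bundles using (CommutativeMonoid)
import Algebra.Properties.Ring as RingProperties
open import Data.Bool using (Bool; true; false; T; not; _∧_; _∨_; if_then_else_)
import Data.Bool.Properties as BoolP
open import Data.Empty using (⊥; ⊥-elim)
open import Data.Fin as Fin using (Fin; toℕ)
import Data.Fin.Properties as FinP
open import Data.Integer as ℤ using (ℤ; +_; -[1+_]; _+_; _*_; -_; _-_)
import Data.Integer.Properties as ℤP
open import Data.Integer.Tactic.RingSolver using (solve-∀)
open import Data.List as List using (List; []; _∷_; _++_; map; concatMap; allFin; upTo; length; filter; foldr; zip; take; drop)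
open import Data.List.Membership.Propositional using (_∈_)
import Data.List.Membership.Propositional.Properties as ∈P
open import Data.List.Membership.Propositional.Properties.WithK using (unique∧set⇒bag)
import Data.List.Properties as ListP
open import Data.List.Relation.Binary.BagAndSetEquality using (∼bag⇒↭)
open import Data.List.Relation.Binary.Permutation.Propositional as Perm using (_↭_)
import Data.List.Relation.Binary.Permutation.Propositional.Properties as PermP
import Data.List.Relation.Binary.Permutation.Setoid.Properties as PermSP
open import Data.List.Relation.Unary.All as All using (All; []; _∷_)
import Data.List.Relation.Unary.All.Properties as AllP
open import Data.List.Relation.Unary.AllPairs using ([]; _∷_)
open import Data.List.Relation.Unary.Any as Any using (Any; here; there)
import Data.List.Relation.Unary.Any.Properties as AnyP
open import Data.List.Relation.Unary.Unique.Propositional using (Unique)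
import Data.List.Relation.Unary.Unique.Propositional.Properties as UniqueP
open import Data.Maybe using (Maybe; just; nothing)
import Data.Maybe.Properties as MaybeP
open import Data.Nat as ℕ using (ℕ; zero; suc; z≤n; s≤s; _≤_; _<_; _≤ᵇ_; _<ᵇ_; _≡ᵇ_; _∸_)
open import Data.Nat.ListAction using (sum)
import Data.Nat.Properties as ℕP
open import Data.Product using (∃; _×_; _,_; proj₁; proj₂)
open import Data.Sum as Sum using (_⊎_; inj₁; inj₂; [_,_]′)
open import Data.Unit using (⊤; tt)
open import Data.Vec as Vec using (Vec; toList; tabulate; []; _∷_)
import Data.Vec.Properties as VecP
open import Function using (_∘_; id)
open import Function.Bundles using (_⇔_; mk⇔)
open import Relation.Binary.Definitions using (tri<; tri≈; tri>)
open import Relation.Binary.PropositionalEquality using (_≡_; _≢_; _≗_; refl; sym; trans; cong; cong₂; subst; subst₂; module ≡-Reasoning) renaming (setoid to ≡-setoid)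
import Relation.Binary.Reasoning.Setoid as SetoidReasoning
open import Relation.Nullary using (¬_; Dec; yes; no; does)
open import Relation.Nullary.Decidable using (_×-dec_; _→-dec_; dec-true; dec-false; ⌊_⌋; T?; decidable-stable)

-- Finite sums

module FiniteSum (M : CommutativeMonoid 0ℓ 0ℓ) where
  open CommutativeMonoid M renaming (refl to ≈-refl; sym to ≈-sym; trans to ≈-trans)
  open import Relation.Binary.Reasoning.Setoid setoid

  ∑ : {A : Set} → List A → (A → Carrier) → Carrier
  ∑ xs f = foldr _∙_ ε (map f xs)

  ∑-cong : {A : Set} (xs : List A) {f g : A → Carrier} → (∀ x → f x ≈ g x) → ∑ xs f ≈ ∑ xs g
  ∑-cong []       h = ≈-refl
  ∑-cong (x ∷ xs) h = ∙-cong (h x) (∑-cong xs h)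

  ∑-ε : {A : Set} (xs : List A) {f : A → Carrier} → (∀ x → f x ≈ ε) → ∑ xs f ≈ ε
  ∑-ε []       h = ≈-refl
  ∑-ε (x ∷ xs) h = ≈-trans (∙-cong (h x) (∑-ε xs h)) (identityˡ ε)

  ∑-++ : {A : Set} (xs ys : List A) (f : A → Carrier) → ∑ (xs ++ ys) f ≈ ∑ xs f ∙ ∑ ys f
  ∑-++ []       ys f = ≈-sym (identityˡ _)
  ∑-++ (x ∷ xs) ys f = ≈-trans (∙-congˡ (∑-++ xs ys f)) (≈-sym (assoc _ _ _))

  ∑-map : {A B : Set} (h : A → B) (xs : List A) (f : B → Carrier) → ∑ (map h xs) f ≈ ∑ xs (f ∘ h)
  ∑-map h []       f = ≈-refl
  ∑-map h (x ∷ xs) f = ∙-congˡ (∑-map h xs f)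

  ∑-concatMap : {A B : Set} (h : A → List B) (xs : List A) (f : B → Carrier) →
                ∑ (concatMap h xs) f ≈ ∑ xs (λ x → ∑ (h x) f)
  ∑-concatMap h []       f = ≈-refl
  ∑-concatMap h (x ∷ xs) f = ≈-trans (∑-++ (h x) (concatMap h xs) f) (∙-congˡ (∑-concatMap h xs f))

  ∑-∙ : {A : Set} (xs : List A) (f g : A → Carrier) → ∑ xs (λ x → f x ∙ g x) ≈ ∑ xs f ∙ ∑ xs g
  ∑-∙ []       f g = ≈-sym (identityˡ ε)
  ∑-∙ (x ∷ xs) f g = begin
    (f x ∙ g x) ∙ ∑ xs (λ y → f y ∙ g y)  ≈⟨ ∙-congˡ (∑-∙ xs f g) ⟩
    (f x ∙ g x) ∙ (∑ xs f ∙ ∑ xs g)       ≈⟨ assoc _ _ _ ⟩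
    f x ∙ (g x ∙ (∑ xs f ∙ ∑ xs g))       ≈⟨ ∙-congˡ (≈-sym (assoc _ _ _)) ⟩
    f x ∙ ((g x ∙ ∑ xs f) ∙ ∑ xs g)       ≈⟨ ∙-congˡ (∙-congʳ (comm _ _)) ⟩
    f x ∙ ((∑ xs f ∙ g x) ∙ ∑ xs g)       ≈⟨ ∙-congˡ (assoc _ _ _) ⟩
    f x ∙ (∑ xs f ∙ (g x ∙ ∑ xs g))       ≈⟨ ≈-sym (assoc _ _ _) ⟩
    (f x ∙ ∑ xs f) ∙ (g x ∙ ∑ xs g)       ∎

  ∑-swap : {A B : Set} (xs : List A) (ys : List B) (f : A → B → Carrier) →
           ∑ xs (λ x → ∑ ys (f x)) ≈ ∑ ys (λ y → ∑ xs (λ x → f x y))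
  ∑-swap []       ys f = ≈-sym (∑-ε ys (λ _ → ≈-refl))
  ∑-swap (x ∷ xs) ys f =
    ≈-trans (∙-congˡ (∑-swap xs ys f)) (≈-sym (∑-∙ ys (f x) (λ y → ∑ xs (λ x′ → f x′ y))))

  ∑-↭ : {A : Set} {xs ys : List A} (f : A → Carrier) → xs ↭ ys → ∑ xs f ≈ ∑ ys f
  ∑-↭ f Perm.refl          = ≈-refl
  ∑-↭ f (Perm.prep x p)    = ∙-congˡ (∑-↭ f p)
  ∑-↭ f (Perm.swap x y p)  = ≈-trans (≈-sym (assoc _ _ _))
    (≈-trans (∙-cong (comm _ _) (∑-↭ f p)) (assoc _ _ _))
  ∑-↭ f (Perm.trans p q)   = ≈-trans (∑-↭ f p) (∑-↭ f q)

  ∑-cong-∈ : {A : Set} (xs : List A) {f g : A → Carrier} → (∀ {x} → x ∈ xs → f x ≈ g x) → ∑ xs f ≈ ∑ xs g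
  ∑-cong-∈ []       h = ≈-refl
  ∑-cong-∈ (x ∷ xs) h = ∙-cong (h (here refl)) (∑-cong-∈ xs (λ m → h (there m)))

  ∑-allFin-suc : (n : ℕ) (f : Fin (suc n) → Carrier) →
                 ∑ (allFin (suc n)) f ≈ f Fin.zero ∙ ∑ (allFin n) (f ∘ Fin.suc)
  ∑-allFin-suc n f = ∙-congˡ (≈-trans (reflexive (cong (λ l → ∑ l f) (sym (ListP.map-tabulate id Fin.suc))))
                                      (∑-map Fin.suc (allFin n) f))

open FiniteSum ℤP.+-0-commutativeMonoid public
open FiniteSum ℤP.*-1-commutativeMonoid public using () renaming
  (∑ to ∏; ∑-cong to ∏-cong; ∑-cong-∈ to ∏-cong-∈; ∑-concatMap to ∏-concatMap; ∑-map to ∏-map; ∑-↭ to ∏-↭; ∑-allFin-suc to ∏-allFin-suc)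
open FiniteSum ℕP.+-0-commutativeMonoid public using () renaming
  (∑ to ∑ℕ; ∑-cong to ∑ℕ-cong; ∑-cong-∈ to ∑ℕ-cong-∈; ∑-concatMap to ∑ℕ-concatMap; ∑-map to ∑ℕ-map; ∑-↭ to ∑ℕ-↭; ∑-allFin-suc to ∑ℕ-allFin-suc; ∑-ε to ∑ℕ-0)

∑-*ˡ : {A : Set} (c : ℤ) (xs : List A) (f : A → ℤ) → ∑ xs (λ x → c * f x) ≡ c * ∑ xs f
∑-*ˡ c []       f = sym (ℤP.*-zeroʳ c)
∑-*ˡ c (x ∷ xs) f = trans (cong (_+_ (c * f x)) (∑-*ˡ c xs f)) (sym (ℤP.*-distribˡ-+ c (f x) (∑ xs f)))

∑-*ʳ : {A : Set} (c : ℤ) (xs : List A) (f : A → ℤ) → ∑ xs (λ x → f x * c) ≡ ∑ xs f * c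
∑-*ʳ c xs f = trans (∑-cong xs (λ x → ℤP.*-comm (f x) c)) (trans (∑-*ˡ c xs f) (ℤP.*-comm c _))

∑-pos : {A : Set} (xs : List A) (f : A → ℕ) → ∑ xs (λ x → + f x) ≡ + ∑ℕ xs f
∑-pos []       f = refl
∑-pos (x ∷ xs) f = trans (cong (_+_ (+ f x)) (∑-pos xs f)) (sym (ℤP.pos-+ (f x) (∑ℕ xs f)))

⟦_⟧ : Bool → ℤ
⟦ true ⟧  = + 1
⟦ false ⟧ = + 0

⟦∧⟧ : ∀ a b → ⟦ a ∧ b ⟧ ≡ ⟦ a ⟧ * ⟦ b ⟧
⟦∧⟧ true  b = sym (ℤP.*-identityˡ ⟦ b ⟧)
⟦∧⟧ false b = refl

𝟙 : {P : Set} → Dec P → ℤ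
𝟙 d = ⟦ does d ⟧

⟦⌊⌋⟧ : {P : Set} (d : Dec P) → ⟦ ⌊ d ⌋ ⟧ ≡ 𝟙 d
⟦⌊⌋⟧ (yes _) = refl
⟦⌊⌋⟧ (no _)  = refl

𝟙-yes : {P : Set} (d : Dec P) → P → 𝟙 d ≡ + 1
𝟙-yes d p = cong ⟦_⟧ (dec-true d p)

𝟙-no : {P : Set} (d : Dec P) → ¬ P → 𝟙 d ≡ + 0
𝟙-no d ¬p = cong ⟦_⟧ (dec-false d ¬p)

𝟙-cong : {P Q : Set} (d : Dec P) (d′ : Dec Q) → (P → Q) → (Q → P) → 𝟙 d ≡ 𝟙 d′
𝟙-cong (yes p) d′ f g = sym (𝟙-yes d′ (f p))
𝟙-cong (no ¬p) d′ f g = sym (𝟙-no d′ (¬p ∘ g))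

𝟙-× : {P Q : Set} (d : Dec P) (d′ : Dec Q) → 𝟙 (d ×-dec d′) ≡ 𝟙 d * 𝟙 d′
𝟙-× d d′ = ⟦∧⟧ (does d) (does d′)

𝟙-*-cong : {P : Set} (d : Dec P) {x y : ℤ} → (P → x ≡ y) → 𝟙 d * x ≡ 𝟙 d * y
𝟙-*-cong (yes p) h = cong (_*_ (+ 1)) (h p)
𝟙-*-cong (no _)  h = refl

sum-filter : {A : Set} {P : A → Set} (P? : ∀ x → Dec (P x)) (f : A → ℤ) (xs : List A) →
             ∑ (filter P? xs) f ≡ ∑ xs (λ x → 𝟙 (P? x) * f x)
sum-filter P? f [] = refl
sum-filter P? f (x ∷ xs) with P? x
... | yes _ = cong₂ _+_ (sym (ℤP.*-identityˡ (f x))) (sum-filter P? f xs)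
... | no _  = trans (sum-filter P? f xs) (sym (ℤP.+-identityˡ _))

length-filter : {A : Set} {P : A → Set} (P? : ∀ x → Dec (P x)) (xs : List A) →
                + length (filter P? xs) ≡ ∑ xs (λ x → 𝟙 (P? x))
length-filter P? [] = refl
length-filter P? (x ∷ xs) with P? x
... | yes _ = trans (ℤP.pos-+ 1 (length (filter P? xs))) (cong (_+_ (+ 1)) (length-filter P? xs))
... | no _  = trans (length-filter P? xs) (sym (ℤP.+-identityˡ _))

∑-allFin-𝟙 : (n : ℕ) (i : Fin n) (f : Fin n → ℤ) → ∑ (allFin n) (λ j → 𝟙 (i Fin.≟ j) * f j) ≡ f i
∑-allFin-𝟙 (suc n) Fin.zero f = begin
  ∑ (allFin (suc n)) (λ j → 𝟙 (Fin.zero Fin.≟ j) * f j)      ≡⟨ ∑-allFin-suc n (λ j → 𝟙 (Fin.zero Fin.≟ j) * f j) ⟩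
  + 1 * f Fin.zero + ∑ (allFin n) (λ j → + 0 * f (Fin.suc j))  ≡⟨ cong₂ _+_ (ℤP.*-identityˡ (f Fin.zero)) (∑-ε (allFin n) (λ _ → refl)) ⟩
  f Fin.zero + + 0                                           ≡⟨ ℤP.+-identityʳ _ ⟩
  f Fin.zero                                                 ∎
  where open ≡-Reasoning
∑-allFin-𝟙 (suc n) (Fin.suc i) f = begin
  ∑ (allFin (suc n)) (λ j → 𝟙 (Fin.suc i Fin.≟ j) * f j)     ≡⟨ ∑-allFin-suc n (λ j → 𝟙 (Fin.suc i Fin.≟ j) * f j) ⟩
  + 0 + ∑ (allFin n) (λ j → 𝟙 (Fin.suc i Fin.≟ Fin.suc j) * f (Fin.suc j))  ≡⟨ ℤP.+-identityˡ _ ⟩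
  ∑ (allFin n) (λ j → 𝟙 (Fin.suc i Fin.≟ Fin.suc j) * f (Fin.suc j))
    ≡⟨ ∑-cong (allFin n) (λ j → cong (_* f (Fin.suc j)) (𝟙-cong (Fin.suc i Fin.≟ Fin.suc j) (i Fin.≟ j) FinP.suc-injective (cong Fin.suc))) ⟩
  ∑ (allFin n) (λ j → 𝟙 (i Fin.≟ j) * f (Fin.suc j))         ≡⟨ ∑-allFin-𝟙 n i (f ∘ Fin.suc) ⟩
  f (Fin.suc i)                                              ∎
  where open ≡-Reasoning

cons : {A : Set} {n : ℕ} → A → (Fin n → A) → Fin (suc n) → A
cons a f Fin.zero    = a
cons a f (Fin.suc i) = f i

Words : (ℓ n : ℕ) → List (Fin n → Fin ℓ)
Words ℓ n = allFunsTo (allFin ℓ) n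

-- `cons` repeats the local function of `allFunsTo`; the two agree only pointwise, so the summand
-- has to respect `≗`.
∑-allFuns-suc : {A : Set} (xs : List A) (n : ℕ) (Φ : (Fin (suc n) → A) → ℤ) →
  (∀ {f g} → f ≗ g → Φ f ≡ Φ g) →
  ∑ (allFunsTo xs (suc n)) Φ ≡ ∑ (allFunsTo xs n) (λ f → ∑ xs (λ a → Φ (cons a f)))
∑-allFuns-suc xs n Φ Φ-cong = trans (∑-concatMap _ (allFunsTo xs n) Φ)
  (∑-cong (allFunsTo xs n) (λ f → trans (∑-map _ xs Φ)
    (∑-cong xs (λ a → Φ-cong (λ { Fin.zero → refl ; (Fin.suc i) → refl })))))

-- Linear functionals on coefficient functions

-- Zero parts are allowed: a monomial is read as the composition of its exponents, in the order y₁, x₁, y₂, x₂, ….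
Comp : Set
Comp = List (ℕ × Sign)

size : Comp → ℕ
size δ = sum (map proj₁ δ)

Pos : Comp → Set
Pos = All (λ p → 1 ≤ proj₁ p)

size-++ : ∀ α β → size (α ++ β) ≡ size α ℕ.+ size β
size-++ []            β = refl
size-++ ((k , _) ∷ α) β = trans (cong (k ℕ.+_) (size-++ α β)) (sym (ℕP.+-assoc k (size α) (size β)))

Pos-++ : ∀ {α β} → Pos α → Pos β → Pos (α ++ β)
Pos-++ []       q = q
Pos-++ (p ∷ ps) q = p ∷ Pos-++ ps q

record Linear (Φ : (Comp → ℤ) → ℤ) : Set where
  field
    lin-cong : ∀ {g h} → g ≗ h → Φ g ≡ Φ h
    lin-+    : ∀ g h → Φ (λ α → g α + h α) ≡ Φ g + Φ h
    lin-*    : ∀ c g → Φ (λ α → c * g α) ≡ c * Φ g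

  lin-0 : Φ (λ _ → + 0) ≡ + 0
  lin-0 = lin-* (+ 0) (λ _ → + 0)

  lin-∑ : {A : Set} (xs : List A) (G : A → Comp → ℤ) →
          Φ (λ α → ∑ xs (λ x → G x α)) ≡ ∑ xs (λ x → Φ (G x))
  lin-∑ []       G = lin-0
  lin-∑ (x ∷ xs) G = trans (lin-+ (G x) (λ α → ∑ xs (λ y → G y α))) (cong (_+_ (Φ (G x))) (lin-∑ xs G))

open Linear

-- ⟨Ψ_m , g⟩ for the noncommutative power sum Ψ_m = Σ_α (-1)^(ℓ(α)-1) (last part of α) M_α^*
-- of sign e, with j added to the first part of every α.
Ψ : ℕ → ℕ → Sign → (Comp → ℤ) → ℤ
Ψ j zero    e g = + 0
Ψ j (suc m) e g = g ((j ℕ.+ suc m , e) ∷ []) - Ψ 0 m e (λ α → g ((suc j , e) ∷ α)) + Ψ (suc j) m e g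

-- The coefficient of `z^k` in `p_k^s` for a variable `z` of sign `e`: it is -1 only for a y
-- variable in `p_k^-`.
sg : Sign → Sign → ℤ
sg ⊕ e = + 1
sg ⊖ e = sgnℤ e

sg-⊕ : ∀ s → sg s ⊕ ≡ + 1
sg-⊕ ⊕ = refl
sg-⊕ ⊖ = refl

sgnℤ≡sg-⊖ : ∀ s → sgnℤ s ≡ sg s ⊖
sgnℤ≡sg-⊖ ⊕ = refl
sgnℤ≡sg-⊖ ⊖ = refl

-- The dual basis multiplies by concatenation, so a product of functionals is evaluated by applying
-- the first factor to `α` and the remaining ones to `β` in `g (α ++ β)`.
L : Comp → (Comp → ℤ) → ℤ
L []            g = g []
L ((m , s) ∷ γ) g = Ψ 0 m ⊕ (λ α → L γ (λ β → g (α ++ β))) + sg s ⊖ * Ψ 0 m ⊖ (λ α → L γ (λ β → g (α ++ β)))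

Ψ-support : ∀ j m e {g h : Comp → ℤ} →
  (∀ α → Pos α → size α ≡ j ℕ.+ m → g α ≡ h α) → Ψ j m e g ≡ Ψ j m e h
Ψ-support j zero    e eq = refl
Ψ-support j (suc m) e eq = cong₂ _+_
  (cong₂ _-_ (eq _ (subst (1 ≤_) (sym (ℕP.+-suc j m)) (s≤s z≤n) ∷ []) (ℕP.+-identityʳ _))
             (Ψ-support 0 m e (λ α p s → eq _ (s≤s z≤n ∷ p) (trans (cong (suc j ℕ.+_) s) (sym (ℕP.+-suc j m))))))
  (Ψ-support (suc j) m e (λ α p s → eq α p (trans s (sym (ℕP.+-suc j m)))))

Ψ-linear : ∀ j m e → Linear (Ψ j m e)
Ψ-linear j m e .lin-cong eq = Ψ-support j m e (λ α _ _ → eq α)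
Ψ-linear j zero    e .lin-+ g h = refl
Ψ-linear j (suc m) e .lin-+ g h = begin
  g x + h x - Ψ 0 m e (λ α → g (y α) + h (y α)) + Ψ (suc j) m e (λ α → g α + h α)
    ≡⟨ cong₂ (λ a b → g x + h x - a + b) (Ψ-linear 0 m e .lin-+ (g ∘ y) (h ∘ y)) (Ψ-linear (suc j) m e .lin-+ g h) ⟩
  g x + h x - (Ψ 0 m e (g ∘ y) + Ψ 0 m e (h ∘ y)) + (Ψ (suc j) m e g + Ψ (suc j) m e h)
    ≡⟨ regroup (g x) (h x) _ _ _ _ ⟩
  (g x - Ψ 0 m e (g ∘ y) + Ψ (suc j) m e g) + (h x - Ψ 0 m e (h ∘ y) + Ψ (suc j) m e h) ∎
  where
  open ≡-Reasoning
  x : Comp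
  x = (j ℕ.+ suc m , e) ∷ []
  y : Comp → Comp
  y α = (suc j , e) ∷ α
  regroup : ∀ a b c d p q → a + b - (c + d) + (p + q) ≡ (a - c + p) + (b - d + q)
  regroup = solve-∀
Ψ-linear j zero    e .lin-* c g = sym (ℤP.*-zeroʳ c)
Ψ-linear j (suc m) e .lin-* c g = begin
  c * g x - Ψ 0 m e (λ α → c * g (y α)) + Ψ (suc j) m e (λ α → c * g α)
    ≡⟨ cong₂ (λ a b → c * g x - a + b) (Ψ-linear 0 m e .lin-* c (g ∘ y)) (Ψ-linear (suc j) m e .lin-* c g) ⟩
  c * g x - c * Ψ 0 m e (g ∘ y) + c * Ψ (suc j) m e g
    ≡⟨ regroup c (g x) _ _ ⟩
  c * (g x - Ψ 0 m e (g ∘ y) + Ψ (suc j) m e g) ∎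
  where
  open ≡-Reasoning
  x : Comp
  x = (j ℕ.+ suc m , e) ∷ []
  y : Comp → Comp
  y α = (suc j , e) ∷ α
  regroup : ∀ c a b d → c * a - c * b + c * d ≡ c * (a - b + d)
  regroup = solve-∀

-- Only compositions with positive parts and with the degree of `γ` occur in `L γ`. An identity
-- known in that degree alone, such as the Pólya count, can therefore be used under the functional.
L-support : ∀ γ {g h : Comp → ℤ} → (∀ δ → Pos δ → size δ ≡ size γ → g δ ≡ h δ) → L γ g ≡ L γ h
L-support []            eq = eq [] [] refl
L-support ((m , s) ∷ γ) eq = cong₂ (λ a b → a + sg s ⊖ * b) (half ⊕) (half ⊖)
  where
  half : ∀ e → _
  half e = Ψ-support 0 m e (λ α p q → L-support γ (λ β p′ q′ →
    eq (α ++ β) (Pos-++ p p′) (trans (size-++ α β) (cong₂ ℕ._+_ q q′))))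

L-linear : ∀ γ → Linear (L γ)
L-linear γ .lin-cong eq = L-support γ (λ δ _ _ → eq δ)
L-linear [] .lin-+ g h = refl
L-linear ((m , s) ∷ γ) .lin-+ g h =
  trans (cong₂ (λ a b → a + sg s ⊖ * b) (half ⊕) (half ⊖)) (regroup (sg s ⊖) (part g ⊕) (part h ⊕) (part g ⊖) (part h ⊖))
  where
  part : (Comp → ℤ) → Sign → ℤ
  part f e = Ψ 0 m e (λ α → L γ (λ β → f (α ++ β)))
  half : ∀ e → _
  half e = trans (Ψ-linear 0 m e .lin-cong (λ α → L-linear γ .lin-+ (λ β → g (α ++ β)) (λ β → h (α ++ β))))
                 (Ψ-linear 0 m e .lin-+ (λ α → L γ (λ β → g (α ++ β))) (λ α → L γ (λ β → h (α ++ β))))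
  regroup : ∀ c a b d f → (a + b) + c * (d + f) ≡ (a + c * d) + (b + c * f)
  regroup = solve-∀
L-linear [] .lin-* c g = refl
L-linear ((m , s) ∷ γ) .lin-* c g =
  trans (cong₂ (λ a b → a + sg s ⊖ * b) (half ⊕) (half ⊖)) (regroup (sg s ⊖) c (part ⊕) (part ⊖))
  where
  part : Sign → ℤ
  part e = Ψ 0 m e (λ α → L γ (λ β → g (α ++ β)))
  half : ∀ e → _
  half e = trans (Ψ-linear 0 m e .lin-cong (λ α → L-linear γ .lin-* c (λ β → g (α ++ β))))
                 (Ψ-linear 0 m e .lin-* c (λ α → L γ (λ β → g (α ++ β))))
  regroup : ∀ c d a b → d * a + c * (d * b) ≡ d * (a + c * b)
  regroup = solve-∀

-- Zero parts, quasisymmetry and multiplication by power sums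

norm : Comp → Comp
norm []                = []
norm ((zero , e) ∷ δ)  = norm δ
norm ((suc k , e) ∷ δ) = (suc k , e) ∷ norm δ

norm-++ : ∀ α β → norm (α ++ β) ≡ norm α ++ norm β
norm-++ []                β = refl
norm-++ ((zero , e) ∷ α)  β = norm-++ α β
norm-++ ((suc k , e) ∷ α) β = cong (_ ∷_) (norm-++ α β)

norm-idem : ∀ δ → norm (norm δ) ≡ norm δ
norm-idem []                = refl
norm-idem ((zero , e) ∷ δ)  = norm-idem δ
norm-idem ((suc k , e) ∷ δ) = cong (_ ∷_) (norm-idem δ)

norm-Pos : ∀ δ → Pos (norm δ)
norm-Pos []                = []
norm-Pos ((zero , e) ∷ δ)  = norm-Pos δ
norm-Pos ((suc k , e) ∷ δ) = s≤s z≤n ∷ norm-Pos δ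

norm-size : ∀ δ → size (norm δ) ≡ size δ
norm-size []                = refl
norm-size ((zero , e) ∷ δ)  = norm-size δ
norm-size ((suc k , e) ∷ δ) = cong (suc k ℕ.+_) (norm-size δ)

norm-id : ∀ {δ} → Pos δ → norm δ ≡ δ
norm-id []                    = refl
norm-id {(suc k , e) ∷ δ} (p ∷ ps) = cong (_ ∷_) (norm-id ps)

-- Quasisymmetry of a function with coefficients g: zero parts may be deleted.
QuasiSym : (Comp → ℤ) → Set
QuasiSym g = ∀ δ → g (norm δ) ≡ g δ

QuasiSym-++ʳ : ∀ {g} → QuasiSym g → ∀ β → QuasiSym (λ α → g (α ++ β))
QuasiSym-++ʳ {g} q β α = begin
  g (norm α ++ β)             ≡⟨ q (norm α ++ β) ⟨
  g (norm (norm α ++ β))      ≡⟨ cong g (norm-++ (norm α) β) ⟩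
  g (norm (norm α) ++ norm β) ≡⟨ cong (λ x → g (x ++ norm β)) (norm-idem α) ⟩
  g (norm α ++ norm β)        ≡⟨ cong g (norm-++ α β) ⟨
  g (norm (α ++ β))           ≡⟨ q (α ++ β) ⟩
  g (α ++ β)                  ∎
  where open ≡-Reasoning

QuasiSym-++ˡ : ∀ {g} → QuasiSym g → ∀ α → QuasiSym (λ β → g (α ++ β))
QuasiSym-++ˡ {g} q α β = begin
  g (α ++ norm β)             ≡⟨ q (α ++ norm β) ⟨
  g (norm (α ++ norm β))      ≡⟨ cong g (norm-++ α (norm β)) ⟩
  g (norm α ++ norm (norm β)) ≡⟨ cong (λ x → g (norm α ++ x)) (norm-idem β) ⟩
  g (norm α ++ norm β)        ≡⟨ cong g (norm-++ α β) ⟨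
  g (norm (α ++ β))           ≡⟨ q (α ++ β) ⟩
  g (α ++ β)                  ∎
  where open ≡-Reasoning

QuasiSym-0∷ : ∀ {g} → QuasiSym g → ∀ e δ → g ((0 , e) ∷ δ) ≡ g δ
QuasiSym-0∷ q e δ = trans (sym (q ((0 , e) ∷ δ))) (q δ)

-- The coefficient of δ in p_k^t · g, when g(δ) is the coefficient of δ in g.
D : ℕ → Sign → (Comp → ℤ) → Comp → ℤ
D k t g []            = + 0
D k t g ((d , e) ∷ δ) = ⟦ k ≤ᵇ d ⟧ * sg t e * g ((d ∸ k , e) ∷ δ) + D k t (λ β → g ((d , e) ∷ β)) δ

D-cong : ∀ k t {g h} → g ≗ h → D k t g ≗ D k t h
D-cong k t eq []            = refl
D-cong k t eq ((d , e) ∷ δ) = cong₂ (λ a b → ⟦ k ≤ᵇ d ⟧ * sg t e * a + b) (eq _) (D-cong k t (λ β → eq _) δ)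

-- The exponent must be positive: for `p_0` every zero part would contribute a term.
D-QuasiSym : ∀ k t {g} → QuasiSym g → QuasiSym (D (suc k) t g)
D-QuasiSym k t q [] = refl
D-QuasiSym k t {g} q ((zero , e) ∷ δ) =
  trans (D-QuasiSym k t q δ)
  (trans (sym (D-cong (suc k) t (QuasiSym-0∷ q e) δ)) (sym (ℤP.+-identityˡ _)))
D-QuasiSym k t {g} q ((suc d , e) ∷ δ) = cong₂ (λ a b → ⟦ suc k ≤ᵇ suc d ⟧ * sg t e * a + b)
  (QuasiSym-++ˡ q ((d ∸ k , e) ∷ []) δ) (D-QuasiSym k t (QuasiSym-++ˡ q ((suc d , e) ∷ [])) δ)

-- A power sum is a sum over single variables, and each variable belongs to `α` or to `β`: power
-- sums are primitive.
D-++ : ∀ k t g α β → D k t g (α ++ β) ≡ D k t (λ α′ → g (α′ ++ β)) α + D k t (λ β′ → g (α ++ β′)) β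
D-++ k t g [] β = sym (ℤP.+-identityˡ _)
D-++ k t g ((d , e) ∷ α) β = trans (cong (_+_ x) (D-++ k t (λ δ → g ((d , e) ∷ δ)) α β)) (sym (ℤP.+-assoc x _ _))
  where x = ⟦ k ≤ᵇ d ⟧ * sg t e * g ((d ∸ k , e) ∷ α ++ β)

D-linear : ∀ k t {Φ} → Linear Φ → (G : Comp → Comp → ℤ) → ∀ α →
           Φ (λ β → D k t (λ α′ → G α′ β) α) ≡ D k t (λ α′ → Φ (G α′)) α
D-linear k t lin G [] = lin-0 lin
D-linear k t lin G ((d , e) ∷ α) = trans (lin-+ lin _ _)
  (cong₂ _+_ (lin-* lin (⟦ k ≤ᵇ d ⟧ * sg t e) (G ((d ∸ k , e) ∷ α))) (D-linear k t lin (λ α′ → G ((d , e) ∷ α′)) α))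

-- Power sums act on the functionals as derivations

<ᵇ-suc : ∀ k m → ⟦ k <ᵇ suc m ⟧ ≡ ⟦ k <ᵇ m ⟧ + ⟦ k ≡ᵇ m ⟧
<ᵇ-suc zero    zero    = refl
<ᵇ-suc zero    (suc m) = refl
<ᵇ-suc (suc k) zero    = refl
<ᵇ-suc (suc k) (suc m) = <ᵇ-suc k m

≡ᵇ-*-cong : ∀ k m {x y : ℤ} → (k ≡ m → x ≡ y) → ⟦ k ≡ᵇ m ⟧ * x ≡ ⟦ k ≡ᵇ m ⟧ * y
≡ᵇ-*-cong k m h with k ≡ᵇ m in eq
... | true  = cong (_*_ (+ 1)) (h (ℕP.≡ᵇ⇒≡ k m (subst T (sym eq) tt)))
... | false = refl

≤ᵇ-true : ∀ {k m} → k ≤ m → (k ≤ᵇ m) ≡ true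
≤ᵇ-true {k} {m} k≤m with k ≤ᵇ m in eq
... | true  = refl
... | false = ⊥-elim (subst T eq (ℕP.≤⇒≤ᵇ k≤m))

≤ᵇ-false : ∀ {k m} → m < k → (k ≤ᵇ m) ≡ false
≤ᵇ-false {k} {m} m<k with k ≤ᵇ m in eq
... | false = refl
... | true  = ⊥-elim (ℕP.<⇒≱ m<k (ℕP.≤ᵇ⇒≤ k m (subst T (sym eq) tt)))

suc≤ᵇ+ : ∀ j k m → (suc (j ℕ.+ k) ≤ᵇ j ℕ.+ m) ≡ (suc k ≤ᵇ m)
suc≤ᵇ+ zero    k m = refl
suc≤ᵇ+ (suc j) k m = suc≤ᵇ+ j k m

module _ (e t : Sign) where

  private
    s = sg t e

    [_]ᵉ : ℕ → Comp
    [ d ]ᵉ = (d , e) ∷ []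

  -- Primitivity of Ψ_m in dual form: on a product with a power sum only the constant term of `g` is
  -- seen, and only in matching degree. The factor `suc k` is the coefficient of the one-part
  -- composition in Ψ. Since the recursion of `Ψ` enlarges the first part, arbitrary `j` have to be
  -- treated along with it, all by induction on `m`.
  Ψ-D-here : ∀ k m {g} → QuasiSym g → Ψ 0 m e (D (suc k) t g) ≡ s * (+ suc k * ⟦ suc k ≡ᵇ m ⟧) * g []

  Ψ-D-suc : ∀ j k m {g} → QuasiSym g →
    Ψ j (suc m) e (D (suc k) t g) ≡
      ⟦ suc k ≤ᵇ j ℕ.+ suc m ⟧ * s * g [ j ℕ.+ suc m ∸ suc k ]ᵉ
      - (⟦ suc k ≤ᵇ suc j ⟧ * s * Ψ 0 m e (λ α → g ((j ∸ k , e) ∷ α)) + s * (+ suc k * ⟦ suc k ≡ᵇ m ⟧) * g [ suc j ]ᵉ)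
      + Ψ (suc j) m e (D (suc k) t g)

  -- The first part is always large enough to lose `suc k`; this removal lowers the offset from `J`
  -- to `d` and gives `Ψ d m e g`. By `Ψ-D-here` a removal from the later parts counts only if these
  -- have total size `suc k`, and then it leaves the single part `d + m`.
  Ψ-D-≤ : ∀ J k d m {g} → QuasiSym g → J ≡ suc k ℕ.+ d →
    Ψ J m e (D (suc k) t g) ≡ s * (Ψ d m e g - + suc k * ⟦ suc k <ᵇ m ⟧ * g [ d ℕ.+ m ]ᵉ)

  -- Here the first part starts `suc k′` short of `suc k`. After `k′` enlargements it falls short by
  -- one, and the next one leads to `Ψ-D-≤` with `d = 0`. Only terms with a single remaining part
  -- survive.
  Ψ-D-> : ∀ j k k′ m {g} → QuasiSym g → k ≡ j ℕ.+ k′ →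
    Ψ j m e (D (suc k) t g) ≡ s * (+ suc k′ * ⟦ k′ <ᵇ m ⟧ - + suc k * ⟦ suc k <ᵇ m ⟧) * g [ m ∸ suc k′ ]ᵉ

  Ψ-D-here k m {g} q = begin
    Ψ 0 m e (D (suc k) t g)
      ≡⟨ Ψ-D-> 0 k k m q refl ⟩
    s * (+ suc k * ⟦ suc k <ᵇ suc m ⟧ - + suc k * ⟦ suc k <ᵇ m ⟧) * g [ m ∸ suc k ]ᵉ
      ≡⟨ cong (λ z → s * (+ suc k * z - + suc k * ⟦ suc k <ᵇ m ⟧) * g [ m ∸ suc k ]ᵉ) (<ᵇ-suc (suc k) m) ⟩
    s * (+ suc k * (⟦ suc k <ᵇ m ⟧ + ⟦ suc k ≡ᵇ m ⟧) - + suc k * ⟦ suc k <ᵇ m ⟧) * g [ m ∸ suc k ]ᵉ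
      ≡⟨ alg s (+ suc k) ⟦ suc k <ᵇ m ⟧ ⟦ suc k ≡ᵇ m ⟧ (g [ m ∸ suc k ]ᵉ) ⟩
    s * + suc k * (⟦ suc k ≡ᵇ m ⟧ * g [ m ∸ suc k ]ᵉ)
      ≡⟨ cong (_*_ (s * + suc k)) (≡ᵇ-*-cong (suc k) m (λ { refl →
           trans (cong (λ z → g [ z ]ᵉ) (ℕP.n∸n≡0 k)) (QuasiSym-0∷ q e []) })) ⟩
    s * + suc k * (⟦ suc k ≡ᵇ m ⟧ * g [])
      ≡⟨ alg′ s (+ suc k) ⟦ suc k ≡ᵇ m ⟧ (g []) ⟩
    s * (+ suc k * ⟦ suc k ≡ᵇ m ⟧) * g [] ∎
    where
    open ≡-Reasoning
    alg : ∀ s k a b x → s * (k * (a + b) - k * a) * x ≡ s * k * (b * x)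
    alg = solve-∀
    alg′ : ∀ s k b x → s * k * (b * x) ≡ s * (k * b) * x
    alg′ = solve-∀

  Ψ-D-suc j k m {g} q = cong₂ (λ a b → a - b + Ψ (suc j) m e (D (suc k) t g))
    (ℤP.+-identityʳ (⟦ suc k ≤ᵇ j ℕ.+ suc m ⟧ * s * g [ j ℕ.+ suc m ∸ suc k ]ᵉ))
    (trans (Ψ-linear 0 m e .lin-+ (λ α → c * g ((j ∸ k , e) ∷ α)) (D (suc k) t (λ β → g ((suc j , e) ∷ β))))
      (cong₂ _+_ (Ψ-linear 0 m e .lin-* c (λ α → g ((j ∸ k , e) ∷ α)))
                 (Ψ-D-here k m (QuasiSym-++ˡ q [ suc j ]ᵉ))))
    where c = ⟦ suc k ≤ᵇ suc j ⟧ * s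

  Ψ-D-≤ J k d zero {g} q eq = alg s (+ suc k) (g [ d ℕ.+ 0 ]ᵉ)
    where
    alg : ∀ s k x → + 0 ≡ s * (+ 0 - k * + 0 * x)
    alg = solve-∀
  Ψ-D-≤ J k d (suc m) {g} q refl = begin
    Ψ J (suc m) e (D (suc k) t g)
      ≡⟨ Ψ-D-suc J k m q ⟩
    ⟦ suc k ≤ᵇ J ℕ.+ suc m ⟧ * s * g [ J ℕ.+ suc m ∸ suc k ]ᵉ
      - (⟦ suc k ≤ᵇ suc J ⟧ * s * Ψ 0 m e (λ α → g ((J ∸ k , e) ∷ α)) + s * (+ suc k * ⟦ suc k ≡ᵇ m ⟧) * g [ suc J ]ᵉ)
      + Ψ (suc J) m e (D (suc k) t g)
      ≡⟨ cong₂ (λ u v → u - (v + s * (+ suc k * ⟦ suc k ≡ᵇ m ⟧) * g [ suc J ]ᵉ) + Ψ (suc J) m e (D (suc k) t g))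
           (cong₂ (λ a b → ⟦ a ⟧ * s * g [ b ]ᵉ) (≤ᵇ-true (ℕP.≤-trans (ℕP.m≤m+n (suc k) d) (ℕP.m≤m+n J (suc m))))
                  (trans (cong (_∸ suc k) (ℕP.+-assoc (suc k) d (suc m))) (ℕP.m+n∸m≡n (suc k) (d ℕ.+ suc m))))
           (cong₂ (λ a b → ⟦ a ⟧ * s * Ψ 0 m e (λ α → g ((b , e) ∷ α))) (≤ᵇ-true (ℕP.m≤n⇒m≤1+n (ℕP.m≤m+n (suc k) d)))
                  (trans (cong (_∸ k) (sym (ℕP.+-suc k d))) (ℕP.m+n∸m≡n k (suc d)))) ⟩
    + 1 * s * G
      - (+ 1 * s * Ψ 0 m e (λ α → g ((suc d , e) ∷ α)) + s * (+ suc k * ⟦ suc k ≡ᵇ m ⟧) * g [ suc J ]ᵉ)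
      + Ψ (suc J) m e (D (suc k) t g)
      ≡⟨ cong₂ (λ u v → + 1 * s * G - (+ 1 * s * X + u) + v)
           (trans (alg₁ s (+ suc k) ⟦ suc k ≡ᵇ m ⟧ (g [ suc J ]ᵉ)) (cong (_*_ (s * + suc k))
             (≡ᵇ-*-cong (suc k) m (λ { refl → cong (λ z → g [ z ]ᵉ) (trans (ℕP.+-comm (suc (suc k)) d) refl) }))))
           (Ψ-D-≤ (suc J) k (suc d) m q (sym (ℕP.+-suc (suc k) d))) ⟩
    + 1 * s * G - (+ 1 * s * X + s * + suc k * (⟦ suc k ≡ᵇ m ⟧ * G))
      + s * (Ψ (suc d) m e g - + suc k * ⟦ suc k <ᵇ m ⟧ * g [ suc d ℕ.+ m ]ᵉ)
      ≡⟨ cong (λ z → + 1 * s * G - (+ 1 * s * X + s * + suc k * (⟦ suc k ≡ᵇ m ⟧ * G))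
                     + s * (Ψ (suc d) m e g - + suc k * ⟦ suc k <ᵇ m ⟧ * g [ z ]ᵉ)) (sym (ℕP.+-suc d m)) ⟩
    + 1 * s * G - (+ 1 * s * X + s * + suc k * (⟦ suc k ≡ᵇ m ⟧ * G))
      + s * (Ψ (suc d) m e g - + suc k * ⟦ suc k <ᵇ m ⟧ * G)
      ≡⟨ alg₂ s (+ suc k) G X ⟦ suc k ≡ᵇ m ⟧ ⟦ suc k <ᵇ m ⟧ (Ψ (suc d) m e g) ⟩
    s * (G - X + Ψ (suc d) m e g - + suc k * (⟦ suc k <ᵇ m ⟧ + ⟦ suc k ≡ᵇ m ⟧) * G)
      ≡⟨ cong (λ z → s * (G - X + Ψ (suc d) m e g - + suc k * z * G)) (sym (<ᵇ-suc (suc k) m)) ⟩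
    s * (Ψ d (suc m) e g - + suc k * ⟦ suc k <ᵇ suc m ⟧ * G) ∎
    where
    open ≡-Reasoning
    G = g [ d ℕ.+ suc m ]ᵉ
    X = Ψ 0 m e (λ α → g ((suc d , e) ∷ α))
    alg₁ : ∀ s k b x → s * (k * b) * x ≡ s * k * (b * x)
    alg₁ = solve-∀
    alg₂ : ∀ s k G X b c Y → + 1 * s * G - (+ 1 * s * X + s * k * (b * G)) + s * (Y - k * c * G)
                             ≡ s * (G - X + Y - k * (c + b) * G)
    alg₂ = solve-∀

  Ψ-D-> j k k′ zero {g} q eq = alg s (+ suc k) (+ suc k′) (g [ 0 ]ᵉ)
    where
    alg : ∀ s k k′ x → + 0 ≡ s * (k′ * + 0 - k * + 0) * x
    alg = solve-∀
  -- The part split off has size exactly `suc k` and is erased; the resulting `Ψ 0 m e g` cancels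
  -- the leading term of `Ψ-D-≤` at `d = 0`.
  Ψ-D-> j k zero (suc m) {g} q eq with refl ← trans eq (ℕP.+-identityʳ j) = begin
    Ψ j (suc m) e (D (suc j) t g)
      ≡⟨ Ψ-D-suc j j m q ⟩
    ⟦ suc j ≤ᵇ j ℕ.+ suc m ⟧ * s * g [ j ℕ.+ suc m ∸ suc j ]ᵉ
      - (⟦ suc j ≤ᵇ suc j ⟧ * s * Ψ 0 m e (λ α → g ((j ∸ j , e) ∷ α)) + s * (+ suc j * ⟦ suc j ≡ᵇ m ⟧) * g [ suc j ]ᵉ)
      + Ψ (suc j) m e (D (suc j) t g)
      ≡⟨ cong₂ (λ u v → u - (v + s * (+ suc j * ⟦ suc j ≡ᵇ m ⟧) * g [ suc j ]ᵉ) + Ψ (suc j) m e (D (suc j) t g))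
           (cong₂ (λ a b → ⟦ a ⟧ * s * g [ b ]ᵉ)
             (≤ᵇ-true (subst (suc j ≤_) (sym (ℕP.+-suc j m)) (s≤s (ℕP.m≤m+n j m))))
             (trans (cong (_∸ suc j) (ℕP.+-suc j m)) (ℕP.m+n∸m≡n j m)))
           (cong₂ (λ a b → ⟦ a ⟧ * s * b) (≤ᵇ-true (ℕP.≤-refl {suc j}))
             (trans (cong (λ z → Ψ 0 m e (λ α → g ((z , e) ∷ α))) (ℕP.n∸n≡0 j))
                    (Ψ-linear 0 m e .lin-cong (QuasiSym-0∷ q e)))) ⟩
    + 1 * s * g [ m ]ᵉ - (+ 1 * s * Ψ 0 m e g + s * (+ suc j * ⟦ suc j ≡ᵇ m ⟧) * g [ suc j ]ᵉ)
      + Ψ (suc j) m e (D (suc j) t g)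
      ≡⟨ cong₂ (λ u v → + 1 * s * g [ m ]ᵉ - (+ 1 * s * Ψ 0 m e g + u) + v)
           (trans (alg₁ s (+ suc j) ⟦ suc j ≡ᵇ m ⟧ (g [ suc j ]ᵉ)) (cong (_*_ (s * + suc j))
             (≡ᵇ-*-cong (suc j) m (λ { refl → refl }))))
           (Ψ-D-≤ (suc j) j 0 m q (sym (ℕP.+-identityʳ (suc j)))) ⟩
    + 1 * s * g [ m ]ᵉ - (+ 1 * s * Ψ 0 m e g + s * + suc j * (⟦ suc j ≡ᵇ m ⟧ * g [ m ]ᵉ))
      + s * (Ψ 0 m e g - + suc j * ⟦ suc j <ᵇ m ⟧ * g [ m ]ᵉ)
      ≡⟨ alg₂ s (+ suc j) (g [ m ]ᵉ) (Ψ 0 m e g) ⟦ suc j ≡ᵇ m ⟧ ⟦ suc j <ᵇ m ⟧ ⟩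
    s * (+ 1 * + 1 - + suc j * (⟦ suc j <ᵇ m ⟧ + ⟦ suc j ≡ᵇ m ⟧)) * g [ m ]ᵉ
      ≡⟨ cong (λ z → s * (+ 1 * + 1 - + suc j * z) * g [ m ]ᵉ) (sym (<ᵇ-suc (suc j) m)) ⟩
    s * (+ 1 * + 1 - + suc j * ⟦ suc j <ᵇ suc m ⟧) * g [ m ]ᵉ ∎
    where
    open ≡-Reasoning
    alg₁ : ∀ s k b x → s * (k * b) * x ≡ s * k * (b * x)
    alg₁ = solve-∀
    alg₂ : ∀ s k G X b c → + 1 * s * G - (+ 1 * s * X + s * k * (b * G)) + s * (X - k * c * G)
                             ≡ s * (+ 1 * + 1 - k * (c + b)) * G
    alg₂ = solve-∀
  Ψ-D-> j k (suc k′) (suc m) {g} q refl = begin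
    Ψ j (suc m) e (D (suc k) t g)
      ≡⟨ Ψ-D-suc j k m q ⟩
    ⟦ suc k ≤ᵇ j ℕ.+ suc m ⟧ * s * g [ j ℕ.+ suc m ∸ suc k ]ᵉ
      - (⟦ suc k ≤ᵇ suc j ⟧ * s * Ψ 0 m e (λ α → g ((j ∸ k , e) ∷ α)) + s * (+ suc k * ⟦ suc k ≡ᵇ m ⟧) * g [ suc j ]ᵉ)
      + Ψ (suc j) m e (D (suc k) t g)
      ≡⟨ cong₂ (λ u v → u - (v + s * (+ suc k * ⟦ suc k ≡ᵇ m ⟧) * g [ suc j ]ᵉ) + Ψ (suc j) m e (D (suc k) t g))
           (cong₂ (λ a b → ⟦ a ⟧ * s * g [ b ]ᵉ)
             (suc≤ᵇ+ j (suc k′) (suc m))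
             (trans (cong (j ℕ.+ suc m ∸_) (sym (ℕP.+-suc j (suc k′)))) (ℕP.[m+n]∸[m+o]≡n∸o j (suc m) (suc (suc k′)))))
           (cong (λ a → ⟦ a ⟧ * s * X) (≤ᵇ-false (s≤s (subst (suc j ≤_) (sym (ℕP.+-suc j k′)) (s≤s (ℕP.m≤m+n j k′)))))) ⟩
    B * s * G - (+ 0 * s * X + s * (+ suc k * ⟦ suc k ≡ᵇ m ⟧) * g [ suc j ]ᵉ)
      + Ψ (suc j) m e (D (suc k) t g)
      ≡⟨ cong₂ (λ u v → B * s * G - (+ 0 * s * X + u) + v)
           (trans (alg₁ s (+ suc k) ⟦ suc k ≡ᵇ m ⟧ (g [ suc j ]ᵉ)) (cong (_*_ (s * + suc k))
             (≡ᵇ-*-cong (suc k) m (λ { refl → cong (λ z → g [ z ]ᵉ)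
               (sym (trans (cong (_∸ k′) (ℕP.+-suc j k′)) (ℕP.m+n∸n≡m (suc j) k′))) }))))
           (Ψ-D-> (suc j) k k′ m q (ℕP.+-suc j k′)) ⟩
    B * s * G - (+ 0 * s * X + s * + suc k * (⟦ suc k ≡ᵇ m ⟧ * G))
      + s * (+ suc k′ * B - + suc k * ⟦ suc k <ᵇ m ⟧) * G
      ≡⟨ alg₂ s (+ suc k) (+ suc k′) G X B ⟦ suc k ≡ᵇ m ⟧ ⟦ suc k <ᵇ m ⟧ ⟩
    s * ((+ 1 + + suc k′) * B - + suc k * (⟦ suc k <ᵇ m ⟧ + ⟦ suc k ≡ᵇ m ⟧)) * G
      ≡⟨ cong (λ z → s * (+ suc (suc k′) * B - + suc k * z) * G) (sym (<ᵇ-suc (suc k) m)) ⟩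
    s * (+ suc (suc k′) * B - + suc k * ⟦ suc k <ᵇ suc m ⟧) * G ∎
    where
    open ≡-Reasoning
    B = ⟦ k′ <ᵇ m ⟧
    G = g [ m ∸ suc k′ ]ᵉ
    X = Ψ 0 m e (λ α → g ((j ∸ k , e) ∷ α))
    alg₁ : ∀ s k b x → s * (k * b) * x ≡ s * k * (b * x)
    alg₁ = solve-∀
    alg₂ : ∀ s k k′ G X B b c → B * s * G - (+ 0 * s * X + s * k * (b * G)) + s * (k′ * B - k * c) * G
                             ≡ s * ((+ 1 + k′) * B - k * (c + b)) * G
    alg₂ = solve-∀

L-++ : Comp → (Comp → ℤ) → Comp → ℤ
L-++ γ g α = L γ (λ β → g (α ++ β))

L-++-QuasiSym : ∀ γ {g} → QuasiSym g → QuasiSym (L-++ γ g)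
L-++-QuasiSym γ q α = L-linear γ .lin-cong (λ β → QuasiSym-++ʳ q β α)

_≟ᶜ_ : (x y : ℕ × Sign) → Dec (x ≡ y)
(k , s) ≟ᶜ (m , t) with k ℕ.≟ m | s ≟ˢ t
... | yes refl | yes refl = yes refl
... | no k≢m   | _        = no (λ { refl → k≢m refl })
... | yes _    | no s≢t   = no (λ { refl → s≢t refl })

-- p_k^t acts on the functionals L_γ as a derivation.
L-D : ∀ k t m s γ {g} → QuasiSym g →
  L ((m , s) ∷ γ) (D (suc k) t g) ≡
    (+ 1 + sg s ⊖ * sg t ⊖) * (+ suc k * ⟦ suc k ≡ᵇ m ⟧) * L γ g
    + (Ψ 0 m ⊕ (λ α → L γ (D (suc k) t (λ β → g (α ++ β)))) + sg s ⊖ * Ψ 0 m ⊖ (λ α → L γ (D (suc k) t (λ β → g (α ++ β)))))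
L-D k t m s γ {g} q = trans (cong₂ (λ a b → a + sg s ⊖ * b) (half ⊕) (half ⊖))
  (trans (cong (λ z → z * (+ suc k * ⟦ suc k ≡ᵇ m ⟧) * L γ g + rest ⊕ + sg s ⊖ * (sg t ⊖ * (+ suc k * ⟦ suc k ≡ᵇ m ⟧) * L γ g + rest ⊖)) (sg-⊕ t))
  (alg (sg s ⊖) (sg t ⊖) (+ suc k * ⟦ suc k ≡ᵇ m ⟧) (L γ g) (rest ⊕) (rest ⊖)))
  where
  rest : Sign → ℤ
  rest e = Ψ 0 m e (λ α → L γ (D (suc k) t (λ β → g (α ++ β))))
  alg : ∀ a b x l u v → + 1 * x * l + u + a * (b * x * l + v) ≡ (+ 1 + a * b) * x * l + (u + a * v)
  alg = solve-∀
  half : ∀ e → Ψ 0 m e (L-++ γ (D (suc k) t g)) ≡ sg t e * (+ suc k * ⟦ suc k ≡ᵇ m ⟧) * L γ g + rest e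
  half e = begin
    Ψ 0 m e (L-++ γ (D (suc k) t g))
      ≡⟨ Ψ-linear 0 m e .lin-cong (λ α → trans (L-linear γ .lin-cong (D-++ (suc k) t g α)) (L-linear γ .lin-+ _ _)) ⟩
    Ψ 0 m e (λ α → L γ (λ β → D (suc k) t (λ α′ → g (α′ ++ β)) α) + L γ (λ β → D (suc k) t (λ β′ → g (α ++ β′)) β))
      ≡⟨ Ψ-linear 0 m e .lin-+ _ _ ⟩
    Ψ 0 m e (λ α → L γ (λ β → D (suc k) t (λ α′ → g (α′ ++ β)) α)) + rest e
      ≡⟨ cong (λ z → z + rest e) (Ψ-linear 0 m e .lin-cong (D-linear (suc k) t (L-linear γ) (λ α β → g (α ++ β)))) ⟩
    Ψ 0 m e (D (suc k) t (L-++ γ g)) + rest e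
      ≡⟨ cong (λ z → z + rest e) (Ψ-D-here e t k m (L-++-QuasiSym γ q)) ⟩
    sg t e * (+ suc k * ⟦ suc k ≡ᵇ m ⟧) * L γ g + rest e ∎
    where open ≡-Reasoning

allZero : Comp → Bool
allZero []                = true
allZero ((zero , e) ∷ δ)  = allZero δ
allZero ((suc k , e) ∷ δ) = false

-- The coefficient of δ in the product of the p_k^t over (k , t) ∈ C.
P : Comp → Comp → ℤ
P []            δ = ⟦ allZero δ ⟧
P ((k , t) ∷ C) δ = D k t (P C) δ

P-QuasiSym : ∀ {C} → Pos C → QuasiSym (P C)
P-QuasiSym [] []                = refl
P-QuasiSym [] ((zero , e) ∷ δ)  = P-QuasiSym [] δ
P-QuasiSym [] ((suc k , e) ∷ δ) = refl
P-QuasiSym {(suc k , t) ∷ C} (_ ∷ pos) = D-QuasiSym k t (P-QuasiSym pos)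

picks : {A : Set} → List A → List (A × List A)
picks []       = []
picks (x ∷ xs) = (x , xs) ∷ map (λ { (y , ys) → y , x ∷ ys }) (picks xs)

picks-↭ : {A : Set} (xs : List A) → All (λ { (y , ys) → xs ↭ y ∷ ys }) (picks xs)
picks-↭ []       = []
picks-↭ (x ∷ xs) = Perm.refl ∷ AllP.map⁺ (All.map (λ p → Perm.trans (Perm.prep x p) (Perm.swap x _ Perm.refl)) (picks-↭ xs))

∑-All-0 : {A : Set} {f : A → ℤ} (xs : List A) → All (λ x → f x ≡ + 0) xs → ∑ xs f ≡ + 0
∑-All-0 []       []       = refl
∑-All-0 (x ∷ xs) (p ∷ ps) = cong₂ _+_ p (∑-All-0 xs ps)

-- The value of Ψ_m^+ ± Ψ_m^- on the power sum of degree `suc k` and sign `t`. The two colours add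
-- up to 1 + 1 or 1 - 1, so it is twice `suc k` on equal parts and zero otherwise.
pairing : ℕ → Sign → ℕ × Sign → ℤ
pairing k t (m , s) = (+ 1 + sg s ⊖ * sg t ⊖) * (+ suc k * ⟦ suc k ≡ᵇ m ⟧)

pairing-≢ : ∀ k t x → x ≢ (suc k , t) → pairing k t x ≡ + 0
pairing-≢ k t (m , s) x≢ with suc k ≡ᵇ m in eq
... | false = alg (+ 1 + sg s ⊖ * sg t ⊖) (+ suc k)
  where
  alg : ∀ a b → a * (b * + 0) ≡ + 0
  alg = solve-∀
... | true = cong (_* (+ suc k * + 1)) (signs s t (λ { refl → x≢ (cong (_, t) (sym (ℕP.≡ᵇ⇒≡ (suc k) m (subst T (sym eq) tt)))) }))
  where
  signs : ∀ s t → s ≢ t → + 1 + sg s ⊖ * sg t ⊖ ≡ + 0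
  signs ⊕ ⊕ h = ⊥-elim (h refl)
  signs ⊕ ⊖ h = refl
  signs ⊖ ⊕ h = refl
  signs ⊖ ⊖ h = ⊥-elim (h refl)

-- `L-D` iterated over the blocks: by the Leibniz rule the power sum meets one block of `γ` at a
-- time and removes it.
L-D-picks : ∀ k t γ {g} → QuasiSym g →
  L γ (D (suc k) t g) ≡ ∑ (picks γ) (λ p → pairing k t (proj₁ p) * L (proj₂ p) g)
L-D-picks k t [] q = refl
L-D-picks k t ((m , s) ∷ γ) {g} q = trans (L-D k t m s γ q) (cong (_+_ (pairing k t (m , s) * L γ g)) (begin
  Ψ 0 m ⊕ (λ α → L γ (D (suc k) t (λ β → g (α ++ β)))) + sg s ⊖ * Ψ 0 m ⊖ (λ α → L γ (D (suc k) t (λ β → g (α ++ β))))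
    ≡⟨ cong₂ (λ a b → a + sg s ⊖ * b) (half ⊕) (half ⊖) ⟩
  ∑ (picks γ) (λ p → c p * part p ⊕) + sg s ⊖ * ∑ (picks γ) (λ p → c p * part p ⊖)
    ≡⟨ cong (_+_ (∑ (picks γ) (λ p → c p * part p ⊕))) (sym (∑-*ˡ (sg s ⊖) (picks γ) (λ p → c p * part p ⊖))) ⟩
  ∑ (picks γ) (λ p → c p * part p ⊕) + ∑ (picks γ) (λ p → sg s ⊖ * (c p * part p ⊖))
    ≡⟨ sym (∑-∙ (picks γ) (λ p → c p * part p ⊕) (λ p → sg s ⊖ * (c p * part p ⊖))) ⟩
  ∑ (picks γ) (λ p → c p * part p ⊕ + sg s ⊖ * (c p * part p ⊖))
    ≡⟨ ∑-cong (picks γ) (λ p → alg (c p) (part p ⊕) (sg s ⊖) (part p ⊖)) ⟩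
  ∑ (picks γ) (λ p → c p * L ((m , s) ∷ proj₂ p) g)
    ≡⟨ sym (∑-map (λ { (y , ys) → y , (m , s) ∷ ys }) (picks γ) (λ p → c p * L (proj₂ p) g)) ⟩
  ∑ (map (λ { (y , ys) → y , (m , s) ∷ ys }) (picks γ)) (λ p → c p * L (proj₂ p) g) ∎))
  where
  open ≡-Reasoning
  c : (ℕ × Sign) × Comp → ℤ
  c p = pairing k t (proj₁ p)
  part : (ℕ × Sign) × Comp → Sign → ℤ
  part p e = Ψ 0 m e (L-++ (proj₂ p) g)
  alg : ∀ c a s b → c * a + s * (c * b) ≡ c * (a + s * b)
  alg = solve-∀
  half : ∀ e → Ψ 0 m e (λ α → L γ (D (suc k) t (λ β → g (α ++ β)))) ≡ ∑ (picks γ) (λ p → c p * part p e)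
  half e = begin
    Ψ 0 m e (λ α → L γ (D (suc k) t (λ β → g (α ++ β))))
      ≡⟨ Ψ-linear 0 m e .lin-cong (λ α → L-D-picks k t γ (QuasiSym-++ˡ q α)) ⟩
    Ψ 0 m e (λ α → ∑ (picks γ) (λ p → c p * L-++ (proj₂ p) g α))
      ≡⟨ lin-∑ (Ψ-linear 0 m e) (picks γ) (λ p α → c p * L-++ (proj₂ p) g α) ⟩
    ∑ (picks γ) (λ p → Ψ 0 m e (λ α → c p * L-++ (proj₂ p) g α))
      ≡⟨ ∑-cong (picks γ) (λ p → Ψ-linear 0 m e .lin-* (c p) (L-++ (proj₂ p) g)) ⟩
    ∑ (picks γ) (λ p → c p * part p e) ∎

allZero-size : ∀ δ → 1 ≤ size δ → allZero δ ≡ false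
allZero-size ((zero , e) ∷ δ)  h = allZero-size δ h
allZero-size ((suc k , e) ∷ δ) h = refl

-- Each factor of `P C` can only be absorbed by an equal part of `γ`. After both are removed, the
-- rests are still not rearrangements of each other. In the end a nonempty `γ` meets the constant 1,
-- which has no coefficients in positive degree.
L-P-orthogonal : ∀ C γ → Pos C → Pos γ → ¬ (C ↭ γ) → L γ (P C) ≡ + 0
L-P-orthogonal [] []                _ _ h = ⊥-elim (h Perm.refl)
L-P-orthogonal [] ((suc m , s) ∷ γ) _ (s≤s z≤n ∷ _) h =
  trans (L-support ((suc m , s) ∷ γ) (λ δ _ sz → cong ⟦_⟧ (allZero-size δ (subst (1 ≤_) (sym sz) (s≤s z≤n)))))
        (lin-0 (L-linear ((suc m , s) ∷ γ)))
L-P-orthogonal ((suc k , t) ∷ C) γ (_ ∷ pC) pγ h =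
  trans (L-D-picks k t γ (P-QuasiSym pC)) (∑-All-0 (picks γ) (All.map term (picks-↭ γ)))
  where
  term : ∀ {p} → γ ↭ proj₁ p ∷ proj₂ p → pairing k t (proj₁ p) * L (proj₂ p) (P C) ≡ + 0
  term {x , γ′} perm with x ≟ᶜ (suc k , t)
  ... | no x≢ = cong (_* L γ′ (P C)) (pairing-≢ k t x x≢)
  ... | yes refl = trans (cong (_*_ (pairing k t x))
          (L-P-orthogonal C γ′ pC (All.tail (PermP.All-resp-↭ perm pγ))
            (λ q → h (Perm.trans (Perm.prep x q) (Perm.↭-sym perm)))))
          (ℤP.*-zeroʳ (pairing k t x))

-- The coefficients of h_n(x), for all n at once

allPlus : Comp → Bool
allPlus []                = true
allPlus ((k , ⊕) ∷ δ)     = allPlus δ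
allPlus ((zero , ⊖) ∷ δ)  = allPlus δ
allPlus ((suc k , ⊖) ∷ δ) = false

allPlus-++ : ∀ α β → ⟦ allPlus (α ++ β) ⟧ ≡ ⟦ allPlus β ⟧ * ⟦ allPlus α ⟧
allPlus-++ []                β = sym (ℤP.*-identityʳ _)
allPlus-++ ((k , ⊕) ∷ α)     β = allPlus-++ α β
allPlus-++ ((zero , ⊖) ∷ α)  β = allPlus-++ α β
allPlus-++ ((suc k , ⊖) ∷ α) β = sym (ℤP.*-zeroʳ ⟦ allPlus β ⟧)

Ψ-allPlus-⊕ : ∀ j m → Ψ j m ⊕ (λ α → ⟦ allPlus α ⟧) ≡ ⟦ 0 <ᵇ m ⟧
Ψ-allPlus-⊕ j zero    = refl
Ψ-allPlus-⊕ j (suc m) = trans (cong₂ (λ a b → + 1 - a + b) (Ψ-allPlus-⊕ 0 m) (Ψ-allPlus-⊕ (suc j) m)) (alg ⟦ 0 <ᵇ m ⟧)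
  where
  alg : ∀ a → + 1 - a + a ≡ + 1
  alg = solve-∀

Ψ-allPlus-⊖ : ∀ j m → Ψ j m ⊖ (λ α → ⟦ allPlus α ⟧) ≡ + 0
Ψ-allPlus-⊖ j zero = refl
Ψ-allPlus-⊖ j (suc m) rewrite ℕP.+-suc j m =
  cong₂ (λ a b → + 0 - a + b) (lin-0 (Ψ-linear 0 m ⊖)) (Ψ-allPlus-⊖ (suc j) m)

-- The coefficients are multiplicative under concatenation, so `L γ` splits into its blocks. On each
-- block Ψ^+ telescopes to 1 and Ψ^- gives 0, whence bars make no difference.
L-allPlus : ∀ γ → Pos γ → L γ (λ δ → ⟦ allPlus δ ⟧) ≡ + 1
L-allPlus [] _ = refl
L-allPlus ((suc m , s) ∷ γ) (_ ∷ pos) =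
  trans (cong₂ (λ a b → a + sg s ⊖ * b) (trans (half ⊕) (Ψ-allPlus-⊕ 0 (suc m))) (trans (half ⊖) (Ψ-allPlus-⊖ 0 (suc m))))
        (cong (_+_ (+ 1)) (ℤP.*-zeroʳ (sg s ⊖)))
  where
  half : ∀ e → Ψ 0 (suc m) e (L-++ γ (λ δ → ⟦ allPlus δ ⟧)) ≡ Ψ 0 (suc m) e (λ α → ⟦ allPlus α ⟧)
  half e = Ψ-linear 0 (suc m) e .lin-cong (λ α → begin
    L γ (λ β → ⟦ allPlus (α ++ β) ⟧)
      ≡⟨ L-linear γ .lin-cong (λ β → trans (allPlus-++ α β) (ℤP.*-comm ⟦ allPlus β ⟧ ⟦ allPlus α ⟧)) ⟩
    L γ (λ β → ⟦ allPlus α ⟧ * ⟦ allPlus β ⟧)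
      ≡⟨ L-linear γ .lin-* ⟦ allPlus α ⟧ (λ β → ⟦ allPlus β ⟧) ⟩
    ⟦ allPlus α ⟧ * L γ (λ β → ⟦ allPlus β ⟧)
      ≡⟨ cong (_*_ ⟦ allPlus α ⟧) (L-allPlus γ pos) ⟩
    ⟦ allPlus α ⟧ * + 1
      ≡⟨ ℤP.*-identityʳ _ ⟩
    ⟦ allPlus α ⟧ ∎)
    where open ≡-Reasoning

-- The functionals separate quasisymmetric functions

Ψ-comm : ∀ j m e {Φ} → Linear Φ → (G : Comp → Comp → ℤ) →
         Φ (λ β → Ψ j m e (λ α → G α β)) ≡ Ψ j m e (λ α → Φ (G α))
Ψ-comm j zero    e lin G = lin-0 lin
Ψ-comm j (suc m) e {Φ} lin G = begin
  Φ (λ β → a β - b β + c β)               ≡⟨ lin-+ lin (λ β → a β - b β) c ⟩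
  Φ (λ β → a β - b β) + Φ c               ≡⟨ cong (_+ Φ c) (lin-cong lin (λ β → cong (_+_ (a β)) (sym (ℤP.-1*i≡-i (b β))))) ⟩
  Φ (λ β → a β + -[1+ 0 ] * b β) + Φ c    ≡⟨ cong (_+ Φ c) (lin-+ lin a (λ β → -[1+ 0 ] * b β)) ⟩
  Φ a + Φ (λ β → -[1+ 0 ] * b β) + Φ c    ≡⟨ cong (λ z → Φ a + z + Φ c) (trans (lin-* lin -[1+ 0 ] b) (ℤP.-1*i≡-i (Φ b))) ⟩
  Φ a - Φ b + Φ c
    ≡⟨ cong₂ (λ y z → Φ a - y + z) (Ψ-comm 0 m e lin (λ α → G ((suc j , e) ∷ α))) (Ψ-comm (suc j) m e lin G) ⟩
  Ψ j (suc m) e (λ α → Φ (G α)) ∎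
  where
  open ≡-Reasoning
  a b c : Comp → ℤ
  a = G ((j ℕ.+ suc m , e) ∷ [])
  b β = Ψ 0 m e (λ α → G ((suc j , e) ∷ α) β)
  c β = Ψ (suc j) m e (λ α → G α β)

-- Each level of the recursion contributes the one-part composition once, which makes `m` copies;
-- every other composition begins with a smaller part and is killed by the hypothesis.
Ψ-lead : ∀ j m e {h} → (∀ i α → i < j ℕ.+ m → Pos ((i , e) ∷ α) → i ℕ.+ size α ≡ j ℕ.+ m → h ((i , e) ∷ α) ≡ + 0) →
         Ψ j m e h ≡ + m * h ((j ℕ.+ m , e) ∷ [])
Ψ-lead j zero e van = refl
Ψ-lead j (suc zero) e {h} van = alg (h ((j ℕ.+ 1 , e) ∷ []))
  where
  alg : ∀ x → x - + 0 + + 0 ≡ + 1 * x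
  alg = solve-∀
Ψ-lead j (suc (suc m)) e {h} van = begin
  H - Ψ 0 (suc m) e (λ α → h ((suc j , e) ∷ α)) + Ψ (suc j) (suc m) e h
    ≡⟨ cong₂ (λ a b → H - a + b)
         (trans (Ψ-support 0 (suc m) e (λ α p sz → van (suc j) α (subst (suc j <_) (sym (ℕP.+-suc j (suc m))) (s≤s (subst (suc j ≤_) (sym (ℕP.+-suc j m)) (s≤s (ℕP.m≤m+n j m)))))
                  (s≤s z≤n ∷ p) (trans (cong (suc j ℕ.+_) sz) (sym (ℕP.+-suc j (suc m))))))
                (lin-0 (Ψ-linear 0 (suc m) e)))
         (Ψ-lead (suc j) (suc m) e {h} (λ i α lt p sz → van i α (subst (i <_) (sym (ℕP.+-suc j (suc m))) lt) p (trans sz (sym (ℕP.+-suc j (suc m)))))) ⟩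
  H - + 0 + + suc m * h ((suc j ℕ.+ suc m , e) ∷ [])
    ≡⟨ cong (λ z → H - + 0 + + suc m * h ((z , e) ∷ [])) (sym (ℕP.+-suc j (suc m))) ⟩
  H - + 0 + + suc m * H
    ≡⟨ alg H (+ suc m) ⟩
  (+ 1 + + suc m) * H ∎
  where
  open ≡-Reasoning
  H = h ((j ℕ.+ suc (suc m) , e) ∷ [])
  alg : ∀ x m → x - + 0 + m * x ≡ (+ 1 + m) * x
  alg = solve-∀

-- The unbarred and the barred block give the sum and the difference of the two colours; separating
-- them costs a factor 2, which cancels in ℤ.
both-zero : ∀ a b → (∀ s → a + sg s ⊖ * b ≡ + 0) → (a ≡ + 0) × (b ≡ + 0)
both-zero a b h = a≡0 , trans (sym (trans (cong (λ z → z + + 1 * b) a≡0) (alg₂ b))) (h ⊕)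
  where
  alg : ∀ a b → (+ 2) * a ≡ (a + + 1 * b) + (a + -[1+ 0 ] * b)
  alg = solve-∀
  alg₂ : ∀ b → + 0 + + 1 * b ≡ b
  alg₂ = solve-∀
  a≡0 : a ≡ + 0
  a≡0 = ℤP.*-cancelˡ-≡ (+ 2) a (+ 0) (trans (alg a b) (cong₂ _+_ (h ⊕) (h ⊖)))

-- Peeling off the first block shows that every Ψ_k annihilates g in its first parts; since Ψ_k is k times the
-- one-part composition plus terms with smaller first part, g vanishes by induction on the first part.
L-injective : ∀ B n g → n ≤ B → (∀ γ → Pos γ → size γ ≡ n → L γ g ≡ + 0) →
              ∀ δ → Pos δ → size δ ≡ n → g δ ≡ + 0
L-injective B .0 g n≤B van [] p refl = van [] [] refl
L-injective zero n g z≤n van ((suc k , e) ∷ δ) (s≤s z≤n ∷ _) ()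
L-injective (suc B) n g n≤B van ((k , e) ∷ δ) pδ szδ = lead (suc k) k ℕP.≤-refl e δ pδ szδ
  where
  -- As a function of the parts after the first block, the value has smaller degree. So the bound
  -- `B` drops and the induction hypothesis applies, once for each sign of the block.
  block : ∀ k e δ → Pos ((k , e) ∷ δ) → k ℕ.+ size δ ≡ n → Ψ 0 k e (λ α → g (α ++ δ)) ≡ + 0
  block k e δ (1≤k ∷ pos) sz = select e
    where
    g′ : Sign → Comp → ℤ
    g′ s β = Ψ 0 k ⊕ (λ α → g (α ++ β)) + sg s ⊖ * Ψ 0 k ⊖ (λ α → g (α ++ β))
    L-g′ : ∀ s γ → L γ (g′ s) ≡ L ((k , s) ∷ γ) g
    L-g′ s γ = trans (L-linear γ .lin-+ (λ β → Ψ 0 k ⊕ (λ α → g (α ++ β))) (λ β → sg s ⊖ * Ψ 0 k ⊖ (λ α → g (α ++ β))))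
      (cong₂ _+_ (Ψ-comm 0 k ⊕ (L-linear γ) (λ α β → g (α ++ β)))
        (trans (L-linear γ .lin-* (sg s ⊖) (λ β → Ψ 0 k ⊖ (λ α → g (α ++ β))))
               (cong (_*_ (sg s ⊖)) (Ψ-comm 0 k ⊖ (L-linear γ) (λ α β → g (α ++ β))))))
    g′≡0 : ∀ s → g′ s δ ≡ + 0
    g′≡0 s = L-injective B (size δ) (g′ s)
      (ℕP.≤-pred (ℕP.≤-trans (ℕP.+-monoˡ-≤ (size δ) 1≤k) (subst (_≤ suc B) (sym sz) n≤B)))
      (λ γ p q → trans (L-g′ s γ) (van ((k , s) ∷ γ) (1≤k ∷ p) (trans (cong (k ℕ.+_) q) sz))) δ pos refl
    zeros = both-zero (Ψ 0 k ⊕ (λ α → g (α ++ δ))) (Ψ 0 k ⊖ (λ α → g (α ++ δ))) g′≡0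
    select : ∀ e → Ψ 0 k e (λ α → g (α ++ δ)) ≡ + 0
    select ⊕ = proj₁ zeros
    select ⊖ = proj₂ zeros
  -- Induction on the first part alone, with `b` as a strict bound: passing from `(k , e) ∷ δ` to
  -- `α ++ δ` shortens the first part but may increase the number of parts.
  lead : ∀ b k → k < b → ∀ e δ → Pos ((k , e) ∷ δ) → k ℕ.+ size δ ≡ n → g ((k , e) ∷ δ) ≡ + 0
  lead (suc b) (suc k) (s≤s k<b) e δ (1≤k ∷ pos) sz =
    ℤP.*-cancelˡ-≡ (+ suc k) (g ((suc k , e) ∷ δ)) (+ 0) (trans (trans (sym (Ψ-lead 0 (suc k) e {λ α → g (α ++ δ)}
      (λ { i α i<k (1≤i ∷ p) q → lead b i (ℕP.≤-trans i<k k<b) e (α ++ δ) (1≤i ∷ Pos-++ p pos)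
             (trans (cong (i ℕ.+_) (size-++ α δ)) (trans (sym (ℕP.+-assoc i (size α) (size δ))) (trans (cong (ℕ._+ size δ) q) sz))) })))
      (block (suc k) e δ (1≤k ∷ pos) sz)) (sym (ℤP.*-zeroʳ (+ suc k))))

-- The functions F_σ: weights and ribbons

-- A part `k` of sign `e` consumes `k` positions of sign `e`; all but the last of them must lie
-- outside S, since no cut of σ may fall inside a part.
Fc : List (Maybe Sign × Sign) → Comp → Bool
Fc []             []                     = true
Fc (_ ∷ _)        []                     = false
Fc zs             ((zero , e) ∷ δ)       = Fc zs δ
Fc []             ((suc k , e) ∷ δ)      = false
Fc ((x , s) ∷ zs) ((suc zero , e) ∷ δ)   = (s ==ˢ e) ∧ Fc zs δ
Fc ((x , s) ∷ zs) ((suc (suc k) , e) ∷ δ) = (s ==ˢ e) ∧ (not (isJust x) ∧ Fc zs ((suc k , e) ∷ δ))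

-- F zs δ is the coefficient of the monomial quasisymmetric function of δ in F_σ, where zs = zip σ ε̃:
-- it is 1 if δ refines σ and 0 otherwise.
F : List (Maybe Sign × Sign) → Comp → ℤ
F zs δ = ⟦ Fc zs δ ⟧

Fc-0∷ : ∀ zs e δ → Fc zs ((zero , e) ∷ δ) ≡ Fc zs δ
Fc-0∷ []       e δ = refl
Fc-0∷ (_ ∷ _)  e δ = refl

Fc-norm : ∀ zs δ → Fc zs (norm δ) ≡ Fc zs δ
Fc-norm zs [] = refl
Fc-norm zs ((zero , e) ∷ δ) = trans (Fc-norm zs δ) (sym (Fc-0∷ zs e δ))
Fc-norm [] ((suc k , e) ∷ δ) = refl
Fc-norm ((x , s) ∷ zs) ((suc zero , e) ∷ δ) = cong ((s ==ˢ e) ∧_) (Fc-norm zs δ)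
Fc-norm ((x , s) ∷ zs) ((suc (suc k) , e) ∷ δ) =
  cong (λ b → (s ==ˢ e) ∧ (not (isJust x) ∧ b)) (Fc-norm zs ((suc k , e) ∷ δ))

F-QuasiSym : ∀ zs → QuasiSym (F zs)
F-QuasiSym zs δ = cong ⟦_⟧ (Fc-norm zs δ)

Fc-size : ∀ zs δ → T (Fc zs δ) → size δ ≡ length zs
Fc-size [] [] h = refl
Fc-size [] ((zero , e) ∷ δ) h = Fc-size [] δ h
Fc-size (z ∷ zs) ((zero , e) ∷ δ) h = Fc-size (z ∷ zs) δ h
Fc-size ((x , s) ∷ zs) ((suc zero , e) ∷ δ) h with s ==ˢ e
... | true = cong suc (Fc-size zs δ h)
Fc-size ((x , s) ∷ zs) ((suc (suc k) , e) ∷ δ) h with s ==ˢ e | not (isJust x)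
... | true | true = cong suc (Fc-size zs ((suc k , e) ∷ δ) h)

Ψ-shift : ∀ j m e {g g′ : Comp → ℤ} → (∀ i α → g ((suc (suc i) , e) ∷ α) ≡ g′ ((suc i , e) ∷ α)) →
          Ψ (suc j) m e g ≡ Ψ j m e g′
Ψ-shift j zero    e eq = refl
Ψ-shift j (suc m) e {g} {g′} eq = cong₂ _+_
  (cong₂ _-_ (trans (cong (λ z → g ((suc z , e) ∷ [])) (ℕP.+-suc j m))
                    (trans (eq (j ℕ.+ m) []) (cong (λ z → g′ ((z , e) ∷ [])) (sym (ℕP.+-suc j m)))))
             (Ψ-linear 0 m e .lin-cong (eq j)))
  (Ψ-shift (suc j) m e eq)

uncut : Sign → List (Maybe Sign × Sign) → ℤ
uncut e []                   = + 0
uncut e ((x , s) ∷ [])       = ⟦ s ==ˢ e ⟧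
uncut e ((x , s) ∷ y ∷ ys)   = ⟦ s ==ˢ e ⟧ * (⟦ not (isJust x) ⟧ * uncut e (y ∷ ys))

-- The value of a single Ψ^e on a block, thus the weight of the block without the sign of its bar.
-- Leading positions of S contribute -1 each; after the first position outside S, `uncut` admits no
-- element of S before the end of the block.
blockWt : Sign → List (Maybe Sign × Sign) → ℤ
blockWt e []                       = + 0
blockWt e ((x , s) ∷ [])           = ⟦ s ==ˢ e ⟧
blockWt e ((just _ , s) ∷ y ∷ ys)  = - (⟦ s ==ˢ e ⟧ * blockWt e (y ∷ ys))
blockWt e ((nothing , s) ∷ y ∷ ys) = ⟦ s ==ˢ e ⟧ * uncut e (y ∷ ys)

F-∷1 : ∀ x s zs e δ → F ((x , s) ∷ zs) ((1 , e) ∷ δ) ≡ ⟦ s ==ˢ e ⟧ * F zs δ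
F-∷1 x s zs e δ = ⟦∧⟧ (s ==ˢ e) (Fc zs δ)

F-∷suc : ∀ x s zs e k δ → F ((x , s) ∷ zs) ((suc (suc k) , e) ∷ δ) ≡ ⟦ s ==ˢ e ⟧ * (⟦ not (isJust x) ⟧ * F zs ((suc k , e) ∷ δ))
F-∷suc x s zs e k δ = trans (⟦∧⟧ (s ==ˢ e) _) (cong (_*_ ⟦ s ==ˢ e ⟧) (⟦∧⟧ (not (isJust x)) _))

F-uncut : ∀ e y ys zs β → F (y ∷ ys ++ zs) ((suc (length ys) , e) ∷ β) ≡ uncut e (y ∷ ys) * F zs β
F-uncut e (x , s) []       zs β = F-∷1 x s zs e β
F-uncut e (x , s) (y ∷ ys) zs β = begin
  F ((x , s) ∷ y ∷ ys ++ zs) ((suc (suc (length ys)) , e) ∷ β)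
    ≡⟨ F-∷suc x s (y ∷ ys ++ zs) e (length ys) β ⟩
  a * (b * F (y ∷ ys ++ zs) ((suc (length ys) , e) ∷ β))
    ≡⟨ cong (λ z → a * (b * z)) (F-uncut e y ys zs β) ⟩
  a * (b * (uncut e (y ∷ ys) * F zs β))
    ≡⟨ alg a b (uncut e (y ∷ ys)) (F zs β) ⟩
  a * (b * uncut e (y ∷ ys)) * F zs β ∎
  where
  open ≡-Reasoning
  a = ⟦ s ==ˢ e ⟧
  b = ⟦ not (isJust x) ⟧
  alg : ∀ a b c d → a * (b * (c * d)) ≡ a * (b * c) * d
  alg = solve-∀

-- The three terms of the recursion take the block as one part, cut after its first position, or
-- join that position to the next. At a position of S only the cut survives, with a minus sign.
-- Outside S the cut and the join cancel, and the one-part composition remains: this is where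
-- initial segments come from.
Ψ-F : ∀ e ys zs β → Ψ 0 (length ys) e (λ α → F (ys ++ zs) (α ++ β)) ≡ blockWt e ys * F zs β
Ψ-F e [] zs β = refl
Ψ-F e ((x , s) ∷ []) zs β = trans (alg _) (F-∷1 x s zs e β)
  where
  alg : ∀ x → x - + 0 + + 0 ≡ x
  alg = solve-∀
Ψ-F e ((x , s) ∷ y ∷ ys) zs β = begin
  F ((x , s) ∷ y ∷ ys ++ zs) ((suc (suc (length ys)) , e) ∷ β)
    - Ψ 0 m e (λ α → F ((x , s) ∷ y ∷ ys ++ zs) ((1 , e) ∷ α ++ β))
    + Ψ 1 m e (λ α → F ((x , s) ∷ y ∷ ys ++ zs) (α ++ β))
    ≡⟨ cong₂ _+_ (cong₂ _-_ (F-uncut e (x , s) (y ∷ ys) zs β)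
         (trans (Ψ-linear 0 m e .lin-cong (λ α → F-∷1 x s (y ∷ ys ++ zs) e (α ++ β)))
           (trans (Ψ-linear 0 m e .lin-* a (λ α → F (y ∷ ys ++ zs) (α ++ β))) (cong (_*_ a) (Ψ-F e (y ∷ ys) zs β)))))
         (trans (Ψ-shift 0 m e {λ α → F ((x , s) ∷ y ∷ ys ++ zs) (α ++ β)} {λ α → (a * b) * F (y ∷ ys ++ zs) (α ++ β)}
                  (λ i α → trans (F-∷suc x s (y ∷ ys ++ zs) e i (α ++ β)) (sym (ℤP.*-assoc a b _))))
           (trans (Ψ-linear 0 m e .lin-* (a * b) (λ α → F (y ∷ ys ++ zs) (α ++ β))) (cong (_*_ (a * b)) (Ψ-F e (y ∷ ys) zs β)))) ⟩
  a * (b * uncut e (y ∷ ys)) * F zs β - a * (blockWt e (y ∷ ys) * F zs β) + a * b * (blockWt e (y ∷ ys) * F zs β)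
    ≡⟨ cases x ⟩
  blockWt e ((x , s) ∷ y ∷ ys) * F zs β ∎
  where
  open ≡-Reasoning
  m = suc (length ys)
  a = ⟦ s ==ˢ e ⟧
  b = ⟦ not (isJust x) ⟧
  alg₁ : ∀ a u w f → a * (+ 0 * u) * f - a * (w * f) + a * + 0 * (w * f) ≡ - (a * w) * f
  alg₁ = solve-∀
  alg₂ : ∀ a u w f → a * (+ 1 * u) * f - a * (w * f) + a * + 1 * (w * f) ≡ a * u * f
  alg₂ = solve-∀
  cases : ∀ x′ → a * (⟦ not (isJust x′) ⟧ * uncut e (y ∷ ys)) * F zs β - a * (blockWt e (y ∷ ys) * F zs β)
            + a * ⟦ not (isJust x′) ⟧ * (blockWt e (y ∷ ys) * F zs β) ≡ blockWt e ((x′ , s) ∷ y ∷ ys) * F zs β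
  cases (just _) = alg₁ a (uncut e (y ∷ ys)) (blockWt e (y ∷ ys)) (F zs β)
  cases nothing  = alg₂ a (uncut e (y ∷ ys)) (blockWt e (y ∷ ys)) (F zs β)

negOnePow-suc : ∀ k → negOnePow (suc k) ≡ - negOnePow k
negOnePow-suc zero          = refl
negOnePow-suc (suc zero)    = refl
negOnePow-suc (suc (suc k)) = negOnePow-suc k

negOnePow-+ : ∀ k l → negOnePow (k ℕ.+ l) ≡ negOnePow k * negOnePow l
negOnePow-+ zero    l = sym (ℤP.*-identityˡ _)
negOnePow-+ (suc k) l = trans (negOnePow-suc (k ℕ.+ l)) (trans (cong -_ (negOnePow-+ k l))
  (trans (ℤP.neg-distribˡ-* (negOnePow k) (negOnePow l)) (cong (_* negOnePow l) (sym (negOnePow-suc k)))))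

val : Maybe ℕ → ℤ
val nothing  = + 0
val (just k) = negOnePow k

val-combine : ∀ x xs → val (combine (x ∷ xs)) ≡ val x * val (combine xs)
val-combine nothing  xs = refl
val-combine (just k) xs with combine xs
... | nothing = sym (ℤP.*-zeroʳ (negOnePow k))
... | just l  = negOnePow-+ k l

-- The last position of a block lies in S(γ) and does not enter the exponent of the weight, hence
-- `initL`.
justs : List (Maybe Sign × Sign) → List Bool
justs ys = map (λ p → isJust (proj₁ p)) (initL ys)

signsAre : Sign → List (Maybe Sign × Sign) → Bool
signsAre e = allB (λ p → proj₂ p ==ˢ e)

uncut-eval : ∀ e y ys → uncut e (y ∷ ys) ≡ ⟦ allB not (justs (y ∷ ys)) ∧ signsAre e (y ∷ ys) ⟧
uncut-eval e (x , s) [] with s ==ˢ e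
... | true  = refl
... | false = refl
uncut-eval e (x , s) (y ∷ ys) = trans (cong (λ z → ⟦ s ==ˢ e ⟧ * (⟦ not (isJust x) ⟧ * z)) (uncut-eval e y ys))
  (bools (s ==ˢ e) (not (isJust x)) (allB not (justs (y ∷ ys))) (signsAre e (y ∷ ys)))
  where
  bools : ∀ a b c d → ⟦ a ⟧ * (⟦ b ⟧ * ⟦ c ∧ d ⟧) ≡ ⟦ (b ∧ c) ∧ (a ∧ d) ⟧
  bools false false c     d = refl
  bools false true  false d = refl
  bools false true  true  d = refl
  bools true  false c     d = refl
  bools true  true  false d = refl
  bools true  true  true  false = refl
  bools true  true  true  true = refl

countTrue-none : ∀ bs → T (allB not bs) → countTrue bs ≡ 0
countTrue-none []           h = refl
countTrue-none (false ∷ bs) h = countTrue-none bs h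

blockWt-eval : ∀ e y ys → blockWt e (y ∷ ys) ≡
  ⟦ isInitialSeg (justs (y ∷ ys)) ∧ signsAre e (y ∷ ys) ⟧ * negOnePow (countTrue (justs (y ∷ ys)))
blockWt-eval e (x , s) [] with s ==ˢ e
... | true  = refl
... | false = refl
blockWt-eval e (just _ , s) (y ∷ ys) = begin
  - (⟦ s ==ˢ e ⟧ * blockWt e (y ∷ ys))          ≡⟨ cong (λ z → - (⟦ s ==ˢ e ⟧ * z)) (blockWt-eval e y ys) ⟩
  - (⟦ s ==ˢ e ⟧ * (⟦ I ∧ A ⟧ * negOnePow N))   ≡⟨ alg ⟦ s ==ˢ e ⟧ ⟦ I ∧ A ⟧ (negOnePow N) ⟩
  (⟦ s ==ˢ e ⟧ * ⟦ I ∧ A ⟧) * - negOnePow N     ≡⟨ cong₂ _*_ (bools (s ==ˢ e) I A) (sym (negOnePow-suc N)) ⟩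
  ⟦ I ∧ ((s ==ˢ e) ∧ A) ⟧ * negOnePow (suc N)   ∎
  where
  open ≡-Reasoning
  I = isInitialSeg (justs (y ∷ ys))
  A = signsAre e (y ∷ ys)
  N = countTrue (justs (y ∷ ys))
  alg : ∀ a b c → - (a * (b * c)) ≡ (a * b) * - c
  alg = solve-∀
  bools : ∀ a b c → ⟦ a ⟧ * ⟦ b ∧ c ⟧ ≡ ⟦ b ∧ (a ∧ c) ⟧
  bools false false c = refl
  bools false true  c = refl
  bools true  false c = refl
  bools true  true  c = ℤP.*-identityˡ ⟦ c ⟧
blockWt-eval e (nothing , s) (y ∷ ys) = trans (cong (_*_ ⟦ s ==ˢ e ⟧) (uncut-eval e y ys))
  (bools (s ==ˢ e) (allB not (justs (y ∷ ys))) (signsAre e (y ∷ ys)) (λ h → cong negOnePow (countTrue-none (justs (y ∷ ys)) h)))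
  where
  bools : ∀ a b c {z} → (T b → z ≡ + 1) → ⟦ a ⟧ * ⟦ b ∧ c ⟧ ≡ ⟦ b ∧ (a ∧ c) ⟧ * z
  bools false false c     h = refl
  bools false true  c     h = refl
  bools true  false c     h = refl
  bools true  true  false h = refl
  bools true  true  true  h rewrite h tt = refl

==ˢ-refl : ∀ e → (e ==ˢ e) ≡ true
==ˢ-refl ⊕ = refl
==ˢ-refl ⊖ = refl

-- `blockWt e` vanishes unless `e` is the sign of the first position, so at most one summand is
-- nonzero. A bar changes the sign of the `⊖` summand only, exactly as n_γ(σ) does.
val-blockExp : ∀ ys s → val (blockExp (ys , s)) ≡ blockWt ⊕ ys + sg s ⊖ * blockWt ⊖ ys
val-blockExp [] s = sym (trans (ℤP.+-identityˡ _) (ℤP.*-zeroʳ (sg s ⊖)))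
val-blockExp ((x , e) ∷ ys) s = trans (lemma (isInitialSeg (justs ((x , e) ∷ ys))) (signsAre e ys) (countTrue (justs ((x , e) ∷ ys))) s e)
  (trans (cong (_*_ (sg s e)) (trans (cong (λ z → ⟦ isInitialSeg (justs ((x , e) ∷ ys)) ∧ (z ∧ signsAre e ys) ⟧ * negOnePow (countTrue (justs ((x , e) ∷ ys)))) (sym (==ˢ-refl e))) (sym (blockWt-eval e (x , e) ys))))
  (choose e s (wrong x e ys)))
  where
  lemma : ∀ b c N s e → val (if b ∧ c then just (N ℕ.+ (if (s ==ˢ ⊖) ∧ (e ==ˢ ⊖) then 1 else 0)) else nothing)
                      ≡ sg s e * (⟦ b ∧ c ⟧ * negOnePow N)
  lemma b c N s e with b ∧ c
  ... | false = sym (ℤP.*-zeroʳ (sg s e))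
  ... | true  = trans (negOnePow-+ N _) (trans (ℤP.*-comm (negOnePow N) _) (cong₂ _*_ (sgs s e) (sym (ℤP.*-identityˡ (negOnePow N)))))
    where
    sgs : ∀ s e → negOnePow (if (s ==ˢ ⊖) ∧ (e ==ˢ ⊖) then 1 else 0) ≡ sg s e
    sgs ⊕ e = refl
    sgs ⊖ ⊕ = refl
    sgs ⊖ ⊖ = refl
  wrong : ∀ x e ys e′ → (e ==ˢ e′) ≡ false → blockWt e′ ((x , e) ∷ ys) ≡ + 0
  wrong x e [] e′ h = cong ⟦_⟧ h
  wrong (just _) e (y ∷ ys) e′ h rewrite h = refl
  wrong nothing  e (y ∷ ys) e′ h rewrite h = refl
  choose : ∀ e s → (∀ e′ → (e ==ˢ e′) ≡ false → blockWt e′ ((x , e) ∷ ys) ≡ + 0) →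
           sg s e * blockWt e ((x , e) ∷ ys) ≡ blockWt ⊕ ((x , e) ∷ ys) + sg s ⊖ * blockWt ⊖ ((x , e) ∷ ys)
  choose ⊕ s h = trans (cong (_* blockWt ⊕ ((x , ⊕) ∷ ys)) (sg-⊕ s)) (trans (alg _ (sg s ⊖)) (cong (λ z → blockWt ⊕ ((x , ⊕) ∷ ys) + sg s ⊖ * z) (sym (h ⊖ refl))))
    where
    alg : ∀ a b → + 1 * a ≡ a + b * + 0
    alg = solve-∀
  choose ⊖ s h = trans (sym (ℤP.+-identityˡ _)) (cong (_+ sg s ⊖ * blockWt ⊖ ((x , ⊖) ∷ ys)) (sym (h ⊕ refl)))

L-F : ∀ γ zs → size γ ≡ length zs → L γ (F zs) ≡ val (combine (map blockExp (chunks γ zs)))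
L-F [] [] eq = refl
L-F ((k , s) ∷ γ) zs eq = begin
  Ψ 0 k ⊕ (L-++ γ (F zs)) + sg s ⊖ * Ψ 0 k ⊖ (L-++ γ (F zs))
    ≡⟨ cong₂ (λ a b → a + sg s ⊖ * b) (half ⊕) (half ⊖) ⟩
  blockWt ⊕ ys * L γ (F zs′) + sg s ⊖ * (blockWt ⊖ ys * L γ (F zs′))
    ≡⟨ alg (blockWt ⊕ ys) (L γ (F zs′)) (sg s ⊖) (blockWt ⊖ ys) ⟩
  (blockWt ⊕ ys + sg s ⊖ * blockWt ⊖ ys) * L γ (F zs′)
    ≡⟨ cong₂ _*_ (sym (val-blockExp ys s)) (L-F γ zs′ size-rest) ⟩
  val (blockExp (ys , s)) * val (combine (map blockExp (chunks γ zs′)))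
    ≡⟨ sym (val-combine (blockExp (ys , s)) (map blockExp (chunks γ zs′))) ⟩
  val (combine (blockExp (ys , s) ∷ map blockExp (chunks γ zs′))) ∎
  where
  open ≡-Reasoning
  ys  = take k zs
  zs′ = drop k zs
  alg : ∀ a l c b → a * l + c * (b * l) ≡ (a + c * b) * l
  alg = solve-∀
  k≤ : k ≤ length zs
  k≤ = subst (k ≤_) eq (ℕP.m≤m+n k (size γ))
  length-ys : length ys ≡ k
  length-ys = trans (ListP.length-take k zs) (ℕP.m≤n⇒m⊓n≡m k≤)
  size-rest : size γ ≡ length zs′
  size-rest = trans (sym (ℕP.m+n∸m≡n k (size γ))) (trans (cong (_∸ k) eq) (sym (ListP.length-drop k zs)))
  half : ∀ e → Ψ 0 k e (L-++ γ (F zs)) ≡ blockWt e ys * L γ (F zs′)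
  half e = begin
    Ψ 0 k e (λ α → L γ (λ β → F zs (α ++ β)))
      ≡⟨ sym (Ψ-comm 0 k e (L-linear γ) (λ α β → F zs (α ++ β))) ⟩
    L γ (λ β → Ψ 0 k e (λ α → F zs (α ++ β)))
      ≡⟨ L-linear γ .lin-cong (λ β → trans (cong₂ (λ l z → Ψ 0 l e (λ α → F z (α ++ β))) (sym length-ys) (sym (ListP.take++drop≡id k zs))) (Ψ-F e ys zs′ β)) ⟩
    L γ (λ β → blockWt e ys * F zs′ β)
      ≡⟨ L-linear γ .lin-* (blockWt e ys) (F zs′) ⟩
    blockWt e ys * L γ (F zs′) ∎

withSigns : List (Maybe Sign) → List (Maybe Sign × Sign)
withSigns σ = zip σ (tildeList σ)

length-withSigns : ∀ σ → length (withSigns σ) ≡ length σ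
length-withSigns []      = refl
length-withSigns (x ∷ σ) = cong suc (length-withSigns σ)

wt≡L-F : ∀ {n} γ (σ : Vec (Maybe Sign) n) → size γ ≡ n → wt γ σ ≡ L γ (F (withSigns (toList σ)))
wt≡L-F {n} γ σ eq = trans unfold (sym (L-F γ (withSigns (toList σ))
    (trans eq (sym (trans (length-withSigns (toList σ)) (VecP.length-toList σ))))))
  where
  unfold : wt γ σ ≡ val (combine (map blockExp (chunks γ (withSigns (toList σ)))))
  unfold with combine (map blockExp (chunks γ (zip (toList σ) (tildeList (toList σ)))))
  ... | nothing = refl
  ... | just k  = refl

-- Ribbon functionals

headSign : List (Maybe Sign) → Sign
headSign σ = fromMaybeS (firstJust σ)

-- The ribbon functional dual to F_σ, with j added to the first part.
Rib : ℕ → List (Maybe Sign) → (Comp → ℤ) → ℤ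
Rib j []              g = + 0
Rib j (nothing ∷ σ)   g = Rib (suc j) σ g
Rib j (just e ∷ [])   g = g ((suc j , e) ∷ [])
Rib j (just e ∷ x ∷ σ) g = Rib 0 (x ∷ σ) (λ α → g ((suc j , e) ∷ α)) - ⟦ headSign (x ∷ σ) ==ˢ e ⟧ * Rib (suc j) (x ∷ σ) g

Rib-support : ∀ j σ {g h} → (∀ δ → Pos δ → size δ ≡ j ℕ.+ length σ → g δ ≡ h δ) → Rib j σ g ≡ Rib j σ h
Rib-support j []               eq = refl
Rib-support j (nothing ∷ σ)    eq = Rib-support (suc j) σ (λ δ p sz → eq δ p (trans sz (sym (ℕP.+-suc j (length σ)))))
Rib-support j (just e ∷ [])    eq = eq _ (s≤s z≤n ∷ []) (trans (ℕP.+-identityʳ _) (ℕP.+-comm 1 j))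
Rib-support j (just e ∷ x ∷ σ) eq = cong₂ (λ a b → a - ⟦ headSign (x ∷ σ) ==ˢ e ⟧ * b)
  (Rib-support 0 (x ∷ σ) (λ α p sz → eq _ (s≤s z≤n ∷ p) (trans (cong (suc j ℕ.+_) sz) (sym (ℕP.+-suc j (length (x ∷ σ)))))))
  (Rib-support (suc j) (x ∷ σ) (λ δ p sz → eq δ p (trans sz (sym (ℕP.+-suc j (length (x ∷ σ)))))))

Rib-linear : ∀ j σ → Linear (Rib j σ)
Rib-linear j σ .lin-cong eq = Rib-support j σ (λ δ _ _ → eq δ)
Rib-linear j []               .lin-+ g h = refl
Rib-linear j (nothing ∷ σ)    .lin-+ g h = Rib-linear (suc j) σ .lin-+ g h
Rib-linear j (just e ∷ [])    .lin-+ g h = refl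
Rib-linear j (just e ∷ x ∷ σ) .lin-+ g h =
  trans (cong₂ (λ a b → a - c * b) (Rib-linear 0 (x ∷ σ) .lin-+ (g ∘ y) (h ∘ y)) (Rib-linear (suc j) (x ∷ σ) .lin-+ g h))
        (alg c (Rib 0 (x ∷ σ) (g ∘ y)) (Rib 0 (x ∷ σ) (h ∘ y)) (Rib (suc j) (x ∷ σ) g) (Rib (suc j) (x ∷ σ) h))
  where
  c = ⟦ headSign (x ∷ σ) ==ˢ e ⟧
  y : Comp → Comp
  y α = (suc j , e) ∷ α
  alg : ∀ c a b p q → (a + b) - c * (p + q) ≡ (a - c * p) + (b - c * q)
  alg = solve-∀
Rib-linear j []               .lin-* c g = sym (ℤP.*-zeroʳ c)
Rib-linear j (nothing ∷ σ)    .lin-* c g = Rib-linear (suc j) σ .lin-* c g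
Rib-linear j (just e ∷ [])    .lin-* c g = refl
Rib-linear j (just e ∷ x ∷ σ) .lin-* d g =
  trans (cong₂ (λ a b → a - c * b) (Rib-linear 0 (x ∷ σ) .lin-* d (g ∘ y)) (Rib-linear (suc j) (x ∷ σ) .lin-* d g))
        (alg c d (Rib 0 (x ∷ σ) (g ∘ y)) (Rib (suc j) (x ∷ σ) g))
  where
  c = ⟦ headSign (x ∷ σ) ==ˢ e ⟧
  y : Comp → Comp
  y α = (suc j , e) ∷ α
  alg : ∀ c d a p → d * a - c * (d * p) ≡ d * (a - c * p)
  alg = solve-∀

Rib-shift : ∀ j σ {g g′ : Comp → ℤ} → (∀ i e α → g ((suc (suc i) , e) ∷ α) ≡ g′ ((suc i , e) ∷ α)) →
            Rib (suc j) σ g ≡ Rib j σ g′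
Rib-shift j []               eq = refl
Rib-shift j (nothing ∷ σ)    eq = Rib-shift (suc j) σ eq
Rib-shift j (just e ∷ [])    eq = eq j e []
Rib-shift j (just e ∷ x ∷ σ) eq = cong₂ (λ a b → a - ⟦ headSign (x ∷ σ) ==ˢ e ⟧ * b)
  (Rib-linear 0 (x ∷ σ) .lin-cong (eq j e)) (Rib-shift (suc j) (x ∷ σ) eq)

F-head : ∀ y τ k e δ → ⟦ headSign (y ∷ τ) ==ˢ e ⟧ * F (withSigns (y ∷ τ)) ((suc k , e) ∷ δ) ≡ F (withSigns (y ∷ τ)) ((suc k , e) ∷ δ)
F-head y τ zero    e δ with headSign (y ∷ τ) ==ˢ e
... | true  = ℤP.*-identityˡ _
... | false = refl
F-head y τ (suc k) e δ with headSign (y ∷ τ) ==ˢ e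
... | true  = ℤP.*-identityˡ _
... | false = refl

Rib-1-F : ∀ y y′ τ σ → Rib 1 σ (F (withSigns (y ∷ y′ ∷ τ))) ≡ ⟦ not (isJust y) ⟧ * Rib 0 σ (F (withSigns (y′ ∷ τ)))
Rib-1-F y y′ τ σ = trans (Rib-shift 0 σ (eq y)) (Rib-linear 0 σ .lin-* ⟦ not (isJust y) ⟧ (F (withSigns (y′ ∷ τ))))
  where
  eq : ∀ y i e α → F (withSigns (y ∷ y′ ∷ τ)) ((suc (suc i) , e) ∷ α) ≡ ⟦ not (isJust y) ⟧ * F (withSigns (y′ ∷ τ)) ((suc i , e) ∷ α)
  eq (just s) i e α = trans (F-∷suc (just s) s (withSigns (y′ ∷ τ)) e i α) (ℤP.*-zeroʳ ⟦ s ==ˢ e ⟧)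
  eq nothing i e α = trans (F-∷suc nothing (headSign (y′ ∷ τ)) (withSigns (y′ ∷ τ)) e i α)
    (trans (cong (_*_ ⟦ headSign (y′ ∷ τ) ==ˢ e ⟧) (ℤP.*-identityˡ _))
    (trans (F-head y′ τ i e α) (sym (ℤP.*-identityˡ _))))

Rib-1∷-F : ∀ y τ σ e → Rib 0 σ (λ α → F (withSigns (y ∷ τ)) ((1 , e) ∷ α)) ≡ ⟦ headSign (y ∷ τ) ==ˢ e ⟧ * Rib 0 σ (F (withSigns τ))
Rib-1∷-F y τ σ e = trans (Rib-linear 0 σ .lin-cong (F-∷1 y (headSign (y ∷ τ)) (withSigns τ) e))
                         (Rib-linear 0 σ .lin-* ⟦ headSign (y ∷ τ) ==ˢ e ⟧ (F (withSigns τ)))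

-- A product of two ribbons is the concatenated ribbon plus, for equal signs, the merged one; `Rib`
-- solves this for the former. If τ is cut at the position in question, the merged term vanishes on
-- F_τ. If it is not, the two terms agree and cancel.
Rib-F : ∀ σ τ → length τ ≡ length σ → T (lastIsJust σ) → T (lastIsJust τ) → (d : Dec (τ ≡ σ)) →
        Rib 0 σ (F (withSigns τ)) ≡ 𝟙 d
Rib-F (just e ∷ []) (just e′ ∷ []) len vσ vτ d = trans (⟦∧⟧ (e′ ==ˢ e) true)
  (trans (trans (ℤP.*-identityʳ _) (⟦⌊⌋⟧ (e′ ≟ˢ e))) (𝟙-cong (e′ ≟ˢ e) d (λ { refl → refl }) (λ { refl → refl })))
Rib-F (nothing ∷ x ∷ σ) (just e ∷ y ∷ τ) len vσ vτ d = trans (Rib-1-F (just e) y τ (x ∷ σ)) (sym (𝟙-no d λ ()))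
Rib-F (nothing ∷ x ∷ σ) (nothing ∷ y ∷ τ) len vσ vτ d = trans (Rib-1-F nothing y τ (x ∷ σ))
  (trans (ℤP.*-identityˡ _) (trans (Rib-F (x ∷ σ) (y ∷ τ) (ℕP.suc-injective len) vσ vτ d′)
    (𝟙-cong d′ d (cong (nothing ∷_)) ListP.∷-injectiveʳ)))
  where d′ = ListP.≡-dec (MaybeP.≡-dec _≟ˢ_) (y ∷ τ) (x ∷ σ)
Rib-F (just e ∷ x ∷ σ) (z ∷ y ∷ τ) len vσ vτ d = trans
  (cong₂ (λ a b → a - ⟦ headSign (x ∷ σ) ==ˢ e ⟧ * b)
    (trans (Rib-1∷-F z (y ∷ τ) (x ∷ σ) e) (cong (_*_ ⟦ headSign (z ∷ y ∷ τ) ==ˢ e ⟧) (Rib-F (x ∷ σ) (y ∷ τ) (ℕP.suc-injective len) vσ (tailJust z vτ) d′)))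
    (trans (Rib-1-F z y τ (x ∷ σ)) (cong (_*_ ⟦ not (isJust z) ⟧) (Rib-F (x ∷ σ) (y ∷ τ) (ℕP.suc-injective len) vσ (tailJust z vτ) d′))))
  (final z d)
  where
  d′ = ListP.≡-dec (MaybeP.≡-dec _≟ˢ_) (y ∷ τ) (x ∷ σ)
  tailJust : ∀ z → T (lastIsJust (z ∷ y ∷ τ)) → T (lastIsJust (y ∷ τ))
  tailJust (just _) h = h
  tailJust nothing  h = h
  alg₁ : ∀ a b c → a * c - b * (+ 0 * c) ≡ a * c
  alg₁ = solve-∀
  alg₂ : ∀ a c → a * c - a * (+ 1 * c) ≡ + 0
  alg₂ = solve-∀
  final : ∀ z (d : Dec (z ∷ y ∷ τ ≡ just e ∷ x ∷ σ)) →
    ⟦ headSign (z ∷ y ∷ τ) ==ˢ e ⟧ * 𝟙 d′ - ⟦ headSign (x ∷ σ) ==ˢ e ⟧ * (⟦ not (isJust z) ⟧ * 𝟙 d′) ≡ 𝟙 d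
  final (just e′) d = trans (alg₁ ⟦ e′ ==ˢ e ⟧ ⟦ headSign (x ∷ σ) ==ˢ e ⟧ (𝟙 d′))
    (trans (trans (cong (_* 𝟙 d′) (⟦⌊⌋⟧ (e′ ≟ˢ e))) (sym (𝟙-× (e′ ≟ˢ e) d′))) (𝟙-cong ((e′ ≟ˢ e) ×-dec d′) d (λ { (refl , p) → cong (just e ∷_) p }) (λ { refl → refl , refl })))
  final nothing d = trans (cancel d′) (sym (𝟙-no d λ ()))
    where
    cancel : (d″ : Dec (y ∷ τ ≡ x ∷ σ)) →
      ⟦ headSign (y ∷ τ) ==ˢ e ⟧ * 𝟙 d″ - ⟦ headSign (x ∷ σ) ==ˢ e ⟧ * (+ 1 * 𝟙 d″) ≡ + 0
    cancel (yes refl) = alg₂ ⟦ headSign (x ∷ σ) ==ˢ e ⟧ (+ 1)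
    cancel (no _)     = cong₂ (λ a b → a - b) (ℤP.*-zeroʳ ⟦ headSign (y ∷ τ) ==ˢ e ⟧) (ℤP.*-zeroʳ ⟦ headSign (x ∷ σ) ==ˢ e ⟧)

-- Coefficients of power sums

flat : ∀ {M} → Monomial M → Comp
flat ([] , [])             = []
flat (x ∷ xs , y ∷ ys) = (y , ⊖) ∷ (x , ⊕) ∷ flat (xs , ys)

infixl 6 _⊹_
_⊹_ : ∀ {M} → Vec ℕ M → Vec ℕ M → Vec ℕ M
_⊹_ = Vec.zipWith ℕ._+_

lower : ∀ {M} → Fin M → ℕ → Vec ℕ M → Vec ℕ M
lower a k xs = Vec.updateAt xs a (_∸ k)

zeroExp-⊹ : ∀ {M} (v : Vec ℕ M) → zeroExp M ⊹ v ≡ v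
zeroExp-⊹ []      = refl
zeroExp-⊹ (x ∷ v) = cong (x ∷_) (zeroExp-⊹ v)

kAt-suc : ∀ {M} k (a : Fin M) → kAt k (Fin.suc a) ≡ 0 ∷ kAt k a
kAt-suc k a = cong (0 ∷_) (VecP.tabulate-cong same)
  where
  same : ∀ b → (if ⌊ Fin.suc a Fin.≟ Fin.suc b ⌋ then k else 0) ≡ (if ⌊ a Fin.≟ b ⌋ then k else 0)
  same b with a Fin.≟ b
  ... | yes _ = refl
  ... | no _  = refl

kAt-⊹ : ∀ {M} k (a : Fin M) u x → kAt k a ⊹ u ≡ x → (k ≤ Vec.lookup x a) × (u ≡ lower a k x)
kAt-⊹ k Fin.zero (u ∷ us) .(kAt k Fin.zero ⊹ (u ∷ us)) refl = ℕP.m≤m+n k u , cong₂ _∷_ (sym (ℕP.m+n∸m≡n k u)) (sym (zeroExp-⊹ us))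
kAt-⊹ k (Fin.suc a) (u ∷ us) x eq with trans (cong (_⊹ (u ∷ us)) (sym (kAt-suc k a))) eq
... | refl = let p , q = kAt-⊹ k a us _ refl in p , cong (u ∷_) q

kAt-⊹⁻¹ : ∀ {M} k (a : Fin M) x → k ≤ Vec.lookup x a → kAt k a ⊹ lower a k x ≡ x
kAt-⊹⁻¹ k Fin.zero    (x ∷ xs) k≤ = cong₂ _∷_ (ℕP.m+[n∸m]≡n k≤) (zeroExp-⊹ xs)
kAt-⊹⁻¹ k (Fin.suc a) (x ∷ xs) k≤ = trans (cong (_⊹ (x ∷ lower a k xs)) (kAt-suc k a)) (cong (x ∷_) (kAt-⊹⁻¹ k a xs k≤))

unit : ∀ {M} → Sign → ℕ → Fin M → Monomial M
unit ⊕ k a = kAt k a , zeroExp _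
unit ⊖ k a = zeroExp _ , kAt k a

_⊹ᵐ_ : ∀ {M} → Monomial M → Monomial M → Monomial M
(a , b) ⊹ᵐ (a′ , b′) = a ⊹ a′ , b ⊹ b′

expo : ∀ {M} → Sign → Monomial M → Fin M → ℕ
expo ⊕ (x , y) a = Vec.lookup x a
expo ⊖ (x , y) a = Vec.lookup y a

lowerᵐ : ∀ {M} → Sign → Fin M → ℕ → Monomial M → Monomial M
lowerᵐ ⊕ a k (x , y) = lower a k x , y
lowerᵐ ⊖ a k (x , y) = x , lower a k y

𝟙-unit-⊹ : ∀ {M} s k (a : Fin M) u m → 𝟙 ((unit s k a ⊹ᵐ u) ≟ᵐ m) ≡ ⟦ k ≤ᵇ expo s m a ⟧ * 𝟙 (u ≟ᵐ lowerᵐ s a k m)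
𝟙-unit-⊹ s k a u m = trans (𝟙-cong ((unit s k a ⊹ᵐ u) ≟ᵐ m) (T? (k ≤ᵇ expo s m a) ×-dec (u ≟ᵐ lowerᵐ s a k m)) (to s u m) (from s u m))
  (𝟙-× (T? (k ≤ᵇ expo s m a)) (u ≟ᵐ lowerᵐ s a k m))
  where
  to : ∀ s u m → unit s k a ⊹ᵐ u ≡ m → T (k ≤ᵇ expo s m a) × (u ≡ lowerᵐ s a k m)
  to ⊕ (u , v) m refl = let p , q = kAt-⊹ k a u _ refl in ℕP.≤⇒≤ᵇ p , cong₂ _,_ q (sym (zeroExp-⊹ v))
  to ⊖ (u , v) m refl = let p , q = kAt-⊹ k a v _ refl in ℕP.≤⇒≤ᵇ p , cong₂ _,_ (sym (zeroExp-⊹ u)) q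
  from : ∀ s u m → T (k ≤ᵇ expo s m a) × (u ≡ lowerᵐ s a k m) → unit s k a ⊹ᵐ u ≡ m
  from ⊕ u (x , y) (p , refl) = cong₂ _,_ (kAt-⊹⁻¹ k a x (ℕP.≤ᵇ⇒≤ k _ p)) (zeroExp-⊹ y)
  from ⊖ u (x , y) (p , refl) = cong₂ _,_ (zeroExp-⊹ x) (kAt-⊹⁻¹ k a y (ℕP.≤ᵇ⇒≤ k _ p))

∑-cartesianProductWith : {A B C : Set} (f : A → B → C) (xs : List A) (ys : List B) (h : C → ℤ) →
  ∑ (List.cartesianProductWith f xs ys) h ≡ ∑ xs (λ x → ∑ ys (λ y → h (f x y)))
∑-cartesianProductWith f []       ys h = refl
∑-cartesianProductWith f (x ∷ xs) ys h = trans (∑-++ (map (f x) ys) _ h)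
  (cong₂ _+_ (∑-map (f x) ys h) (∑-cartesianProductWith f xs ys h))

coeff-∑ : ∀ {M} (m : Monomial M) (Q : Poly M) → coeff m Q ≡ ∑ Q (λ t → 𝟙 (proj₂ t ≟ᵐ m) * proj₁ t)
coeff-∑ m Q = sum-filter (λ t → proj₂ t ≟ᵐ m) proj₁ Q

-- Every term of a power sum is a power of one variable, so extracting a coefficient from the
-- product amounts to lowering one exponent of `m`.
coeff-polyMul : ∀ {M} (m : Monomial M) k t (Q : Poly M) →
  coeff m (polyMul (powerSum M k t) Q) ≡
  ∑ (allFin M) (λ a → ⟦ k ≤ᵇ expo ⊕ m a ⟧ * sg t ⊕ * coeff (lowerᵐ ⊕ a k m) Q + ⟦ k ≤ᵇ expo ⊖ m a ⟧ * sg t ⊖ * coeff (lowerᵐ ⊖ a k m) Q)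
coeff-polyMul {M} m k t Q = begin
  coeff m (polyMul (powerSum M k t) Q)
    ≡⟨ coeff-∑ m (polyMul (powerSum M k t) Q) ⟩
  ∑ (polyMul (powerSum M k t) Q) h
    ≡⟨ ∑-cartesianProductWith _ (powerSum M k t) Q h ⟩
  ∑ (powerSum M k t) (λ s → ∑ Q (λ q → h (mul s q)))
    ≡⟨ ∑-concatMap (λ a → (+ 1 , unit ⊕ k a) ∷ (sgnℤ t , unit ⊖ k a) ∷ []) (allFin M) (λ s → ∑ Q (λ q → h (mul s q))) ⟩
  ∑ (allFin M) (λ a → ∑ Q (λ q → h (mul (+ 1 , unit ⊕ k a) q)) + (∑ Q (λ q → h (mul (sgnℤ t , unit ⊖ k a) q)) + + 0))
    ≡⟨ ∑-cong (allFin M) (λ a → cong₂ _+_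
         (trans (term (+ 1) ⊕ a) (cong (λ c → ⟦ k ≤ᵇ expo ⊕ m a ⟧ * c * coeff (lowerᵐ ⊕ a k m) Q) (sym (sg-⊕ t))))
         (trans (ℤP.+-identityʳ _) (trans (term (sgnℤ t) ⊖ a) (cong (λ c → ⟦ k ≤ᵇ expo ⊖ m a ⟧ * c * coeff (lowerᵐ ⊖ a k m) Q) (sgnℤ≡sg-⊖ t))))) ⟩
  ∑ (allFin M) (λ a → ⟦ k ≤ᵇ expo ⊕ m a ⟧ * sg t ⊕ * coeff (lowerᵐ ⊕ a k m) Q + ⟦ k ≤ᵇ expo ⊖ m a ⟧ * sg t ⊖ * coeff (lowerᵐ ⊖ a k m) Q) ∎
  where
  open ≡-Reasoning
  h : ℤ × Monomial M → ℤ
  h r = 𝟙 (proj₂ r ≟ᵐ m) * proj₁ r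
  mul : ℤ × Monomial M → ℤ × Monomial M → ℤ × Monomial M
  mul (c , u) (d , v) = c * d , u ⊹ᵐ v
  alg : ∀ b o c d → b * o * (c * d) ≡ b * c * (o * d)
  alg = solve-∀
  term : ∀ c s a → ∑ Q (λ q → h (mul (c , unit s k a) q)) ≡ ⟦ k ≤ᵇ expo s m a ⟧ * c * coeff (lowerᵐ s a k m) Q
  term c s a = begin
    ∑ Q (λ q → 𝟙 ((unit s k a ⊹ᵐ proj₂ q) ≟ᵐ m) * (c * proj₁ q))
      ≡⟨ ∑-cong Q (λ q → trans (cong (_* (c * proj₁ q)) (𝟙-unit-⊹ s k a (proj₂ q) m))
                               (alg ⟦ k ≤ᵇ expo s m a ⟧ (𝟙 (proj₂ q ≟ᵐ lowerᵐ s a k m)) c (proj₁ q))) ⟩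
    ∑ Q (λ q → ⟦ k ≤ᵇ expo s m a ⟧ * c * (𝟙 (proj₂ q ≟ᵐ lowerᵐ s a k m) * proj₁ q))
      ≡⟨ ∑-*ˡ (⟦ k ≤ᵇ expo s m a ⟧ * c) Q (λ q → 𝟙 (proj₂ q ≟ᵐ lowerᵐ s a k m) * proj₁ q) ⟩
    ⟦ k ≤ᵇ expo s m a ⟧ * c * ∑ Q (λ q → 𝟙 (proj₂ q ≟ᵐ lowerᵐ s a k m) * proj₁ q)
      ≡⟨ cong (_*_ (⟦ k ≤ᵇ expo s m a ⟧ * c)) (sym (coeff-∑ (lowerᵐ s a k m) Q)) ⟩
    ⟦ k ≤ᵇ expo s m a ⟧ * c * coeff (lowerᵐ s a k m) Q ∎

D-flat : ∀ {M} k t (g : Comp → ℤ) (m : Monomial M) →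
  ∑ (allFin M) (λ a → ⟦ k ≤ᵇ expo ⊕ m a ⟧ * sg t ⊕ * g (flat (lowerᵐ ⊕ a k m)) + ⟦ k ≤ᵇ expo ⊖ m a ⟧ * sg t ⊖ * g (flat (lowerᵐ ⊖ a k m)))
  ≡ D k t g (flat m)
D-flat k t g ([] , []) = refl
D-flat {suc M} k t g (x ∷ xs , y ∷ ys) = trans (∑-allFin-suc M (λ a → ⟦ k ≤ᵇ expo ⊕ m a ⟧ * sg t ⊕ * g (flat (lowerᵐ ⊕ a k m))
                                                                      + ⟦ k ≤ᵇ expo ⊖ m a ⟧ * sg t ⊖ * g (flat (lowerᵐ ⊖ a k m))))
  (trans (cong (_+_ (A + B)) (D-flat k t (λ β → g ((y , ⊖) ∷ (x , ⊕) ∷ β)) (xs , ys)))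
         (alg A B (D k t (λ β → g ((y , ⊖) ∷ (x , ⊕) ∷ β)) (flat (xs , ys)))))
  where
  m : Monomial (suc M)
  m = (x ∷ xs , y ∷ ys)
  A = ⟦ k ≤ᵇ x ⟧ * sg t ⊕ * g ((y , ⊖) ∷ (x ∸ k , ⊕) ∷ flat (xs , ys))
  B = ⟦ k ≤ᵇ y ⟧ * sg t ⊖ * g ((y ∸ k , ⊖) ∷ (x , ⊕) ∷ flat (xs , ys))
  alg : ∀ a b c → a + b + c ≡ b + (a + c)
  alg = solve-∀

coeff-polyOne : ∀ {M} (m : Monomial M) → coeff m (polyOne M) ≡ ⟦ allZero (flat m) ⟧
coeff-polyOne {M} m = trans (coeff-∑ m (polyOne M)) (trans (ℤP.+-identityʳ _) (trans (ℤP.*-identityʳ _)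
  (𝟙-cong ((zeroExp M , zeroExp M) ≟ᵐ m) (T? (allZero (flat m))) (λ { refl → to M }) (from m))))
  where
  to : ∀ M → T (allZero (flat (zeroExp M , zeroExp M)))
  to zero    = tt
  to (suc M) = to M
  from : ∀ {M} (m : Monomial M) → T (allZero (flat m)) → (zeroExp M , zeroExp M) ≡ m
  from ([] , []) h = refl
  from (zero ∷ xs , zero ∷ ys) h with refl ← from (xs , ys) h = refl

coeff-powerSums : ∀ {M} C (m : Monomial M) →
  coeff m (foldr (λ c Q → polyMul (powerSum M (proj₁ c) (proj₂ c)) Q) (polyOne M) C) ≡ P C (flat m)
coeff-powerSums [] m = coeff-polyOne m
coeff-powerSums {M} ((k , t) ∷ C) m = trans (coeff-polyMul m k t Q)
  (trans (∑-cong (allFin M) (λ a → cong₂ (λ u v → ⟦ k ≤ᵇ expo ⊕ m a ⟧ * sg t ⊕ * u + ⟦ k ≤ᵇ expo ⊖ m a ⟧ * sg t ⊖ * v)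
            (coeff-powerSums C (lowerᵐ ⊕ a k m)) (coeff-powerSums C (lowerᵐ ⊖ a k m))))
         (D-flat k t (P C) m))
  where
  Q : Poly M
  Q = foldr (λ c Q → polyMul (powerSum M (proj₁ c) (proj₂ c)) Q) (polyOne M) C

-- Coefficients of F_σ

isZero : ℕ → Bool
isZero zero    = true
isZero (suc _) = false

-- All variables occurring in the monomial have index > p (if d holds) or ≥ p.
supportFrom : ∀ {M} → Fin M → Bool → Monomial M → Bool
supportFrom Fin.zero    false m                 = true
supportFrom Fin.zero    true  (x ∷ _ , y ∷ _)   = isZero x ∧ isZero y
supportFrom (Fin.suc p) d     (x ∷ xs , y ∷ ys) = (isZero x ∧ isZero y) ∧ supportFrom p d (xs , ys)

step : Bool → ℕ → ℕ → Bool
step d a b = if d then a <ᵇ b else a ≤ᵇ b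

step-suc : ∀ d a b → step d (suc a) (suc b) ≡ step d a b
step-suc true  a       b = refl
step-suc false zero    b = refl
step-suc false (suc a) b = refl

-- If the rest of the word uses indices from `a` on, then `a` is the smallest index of the whole
-- monomial, and comparing `p` with `a` is the same as comparing `p` with the support. The condition
-- thereby becomes independent of the first letter.
step-support : ∀ {M} d d′ s (p a : Fin M) (m : Monomial M) → T (1 ≤ᵇ expo s m a) →
  step d (toℕ p) (toℕ a) ∧ supportFrom a d′ (lowerᵐ s a 1 m) ≡ supportFrom p d m ∧ supportFrom a d′ (lowerᵐ s a 1 m)
step-support false d′ s Fin.zero a m h = refl
step-support true d′ ⊕ Fin.zero Fin.zero (suc x ∷ xs , y ∷ ys) h = refl
step-support true d′ ⊖ Fin.zero Fin.zero (zero ∷ xs , suc y ∷ ys) h = refl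
step-support true d′ ⊖ Fin.zero Fin.zero (suc x ∷ xs , suc y ∷ ys) h = refl
step-support true d′ ⊕ Fin.zero (Fin.suc a) (x ∷ xs , y ∷ ys) h with isZero x ∧ isZero y
... | true  = refl
... | false = refl
step-support true d′ ⊖ Fin.zero (Fin.suc a) (x ∷ xs , y ∷ ys) h with isZero x ∧ isZero y
... | true  = refl
... | false = refl
step-support true  d′ ⊕ (Fin.suc p) Fin.zero (suc x ∷ xs , y ∷ ys) h = refl
step-support false d′ ⊕ (Fin.suc p) Fin.zero (suc x ∷ xs , y ∷ ys) h = refl
step-support true  d′ ⊖ (Fin.suc p) Fin.zero (zero ∷ xs , suc y ∷ ys) h = refl
step-support true  d′ ⊖ (Fin.suc p) Fin.zero (suc x ∷ xs , suc y ∷ ys) h = refl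
step-support false d′ ⊖ (Fin.suc p) Fin.zero (zero ∷ xs , suc y ∷ ys) h = refl
step-support false d′ ⊖ (Fin.suc p) Fin.zero (suc x ∷ xs , suc y ∷ ys) h = refl
step-support d d′ ⊕ (Fin.suc p) (Fin.suc a) (x ∷ xs , y ∷ ys) h rewrite step-suc d (toℕ p) (toℕ a) with isZero x ∧ isZero y
... | true  = step-support d d′ ⊕ p a (xs , ys) h
... | false = BoolP.∧-zeroʳ _
step-support d d′ ⊖ (Fin.suc p) (Fin.suc a) (x ∷ xs , y ∷ ys) h rewrite step-suc d (toℕ p) (toℕ a) with isZero x ∧ isZero y
... | true  = step-support d d′ ⊖ p a (xs , ys) h
... | false = BoolP.∧-zeroʳ _

-- A position j of a signed set with membership x, sign s and descent flag d: j ∉ S (mid), j = n (end), or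
-- j ∈ S and the next block has sign e (cut).
data Local : Maybe Sign → Sign → Bool → List (Maybe Sign × Sign) → Set where
  mid : ∀ {s y zs} → Local nothing s false ((y , s) ∷ zs)
  end : ∀ {s} → Local (just s) s false []
  cut : ∀ {s y e zs} → Local (just s) s (not ((s ==ˢ ⊖) ∧ (e ==ˢ ⊕))) ((y , e) ∷ zs)

-- `X` and `Y` are the exponents at the smallest index that occurs. Removing the first letter lowers
-- one of them, and a strict ascent to the next letter demands that both are then used up. Both
-- sides compute to the same value once the exponents are compared with small numbers.
first-letter : ∀ {x s d zs} → Local x s d zs → ∀ X Y δ → T (not (isZero X ∧ isZero Y)) →
  let (X′ , Y′) = (if s ==ˢ ⊕ then (X ∸ 1 , Y) else (X , Y ∸ 1)) in
  (1 ≤ᵇ (if s ==ˢ ⊕ then X else Y)) ∧ ((if d then isZero X′ ∧ isZero Y′ else true) ∧ Fc zs ((Y′ , ⊖) ∷ (X′ , ⊕) ∷ δ))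
  ≡ Fc ((x , s) ∷ zs) ((Y , ⊖) ∷ (X , ⊕) ∷ δ)
first-letter {s = ⊕} mid zero          (suc zero)    δ h = refl
first-letter {s = ⊕} mid zero          (suc (suc Y)) δ h = refl
first-letter {s = ⊕} mid (suc zero)    zero          δ h = refl
first-letter {s = ⊕} mid (suc (suc X)) zero          δ h = refl
first-letter {s = ⊕} mid (suc X)       (suc zero)    δ h = refl
first-letter {s = ⊕} mid (suc X)       (suc (suc Y)) δ h = refl
first-letter {s = ⊕} end zero          (suc zero)    δ h = refl
first-letter {s = ⊕} end zero          (suc (suc Y)) δ h = refl
first-letter {s = ⊕} end (suc zero)    zero          δ h = refl
first-letter {s = ⊕} end (suc (suc X)) zero          δ h = refl
first-letter {s = ⊕} end (suc X)       (suc zero)    δ h = refl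
first-letter {s = ⊕} end (suc X)       (suc (suc Y)) δ h = refl
first-letter {s = ⊕} cut zero          (suc zero)    δ h = refl
first-letter {s = ⊕} cut zero          (suc (suc Y)) δ h = refl
first-letter {s = ⊕} cut (suc zero)    zero          δ h = refl
first-letter {s = ⊕} cut (suc (suc X)) zero          δ h = refl
first-letter {s = ⊕} cut (suc zero)    (suc zero)    δ h = refl
first-letter {s = ⊕} cut (suc zero)    (suc (suc Y)) δ h = refl
first-letter {s = ⊕} cut (suc (suc X)) (suc zero)    δ h = refl
first-letter {s = ⊕} cut (suc (suc X)) (suc (suc Y)) δ h = refl
first-letter {s = ⊖} mid (suc zero)    zero          δ h = refl
first-letter {s = ⊖} mid (suc (suc X)) zero          δ h = refl
first-letter {s = ⊖} mid X             (suc zero)    δ h = refl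
first-letter {s = ⊖} mid X             (suc (suc Y)) δ h = refl
first-letter {s = ⊖} end (suc zero)    zero          δ h = refl
first-letter {s = ⊖} end (suc (suc X)) zero          δ h = refl
first-letter {s = ⊖} end X             (suc zero)    δ h = refl
first-letter {s = ⊖} end X             (suc (suc Y)) δ h = refl
first-letter {s = ⊖} (cut {e = e}) (suc zero)    zero δ h = refl
first-letter {s = ⊖} (cut {e = e}) (suc (suc X)) zero δ h = refl
first-letter {s = ⊖} (cut {e = ⊕}) X             (suc zero)    δ h = refl
first-letter {s = ⊖} (cut {e = ⊕}) X             (suc (suc zero))    δ h = refl
first-letter {s = ⊖} (cut {e = ⊕}) X             (suc (suc (suc Y))) δ h = refl
first-letter {s = ⊖} (cut {e = ⊖}) zero          (suc zero)    δ h = refl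
first-letter {s = ⊖} (cut {e = ⊖}) (suc zero)    (suc zero)    δ h = refl
first-letter {s = ⊖} (cut {e = ⊖}) (suc (suc X)) (suc zero)    δ h = refl
first-letter {s = ⊖} (cut {e = ⊖}) zero          (suc (suc Y)) δ h = refl
first-letter {s = ⊖} (cut {e = ⊖}) (suc X)       (suc (suc Y)) δ h = refl

firstTerm : ∀ {M} → Sign → Bool → List (Maybe Sign × Sign) → Monomial M → Fin M → ℤ
firstTerm s d zs m a = ⟦ 1 ≤ᵇ expo s m a ⟧ * (⟦ supportFrom a d (lowerᵐ s a 1 m) ⟧ * F zs (flat (lowerᵐ s a 1 m)))

F-first-nonzero : ∀ {M x s d zs} → Local x s d zs → ∀ X₀ (X : Vec ℕ M) Y₀ (Y : Vec ℕ M) → (isZero X₀ ∧ isZero Y₀) ≡ false →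
  ∑ (allFin (suc M)) (firstTerm s d zs (X₀ ∷ X , Y₀ ∷ Y)) ≡ F ((x , s) ∷ zs) (flat (X₀ ∷ X , Y₀ ∷ Y))
F-first-nonzero {M} {x} {s} {d} {zs} loc X₀ X Y₀ Y eq = begin
  ∑ (allFin (suc M)) (firstTerm s d zs m)
    ≡⟨ ∑-allFin-suc M (firstTerm s d zs m) ⟩
  firstTerm s d zs m Fin.zero + ∑ (allFin M) (λ a → firstTerm s d zs m (Fin.suc a))
    ≡⟨ cong₂ _+_ (head s d loc) (∑-ε (allFin M) (tail s)) ⟩
  F ((x , s) ∷ zs) (flat m) + + 0
    ≡⟨ ℤP.+-identityʳ _ ⟩
  F ((x , s) ∷ zs) (flat m) ∎
  where
  open ≡-Reasoning
  m : Monomial (suc M)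
  m = X₀ ∷ X , Y₀ ∷ Y
  nz : T (not (isZero X₀ ∧ isZero Y₀))
  nz = subst (T ∘ not) (sym eq) tt
  bools : ∀ a b c → ⟦ a ⟧ * (⟦ b ⟧ * ⟦ c ⟧) ≡ ⟦ a ∧ (b ∧ c) ⟧
  bools a b c = sym (trans (⟦∧⟧ a (b ∧ c)) (cong (_*_ ⟦ a ⟧) (⟦∧⟧ b c)))
  head : ∀ s d → Local x s d zs → firstTerm s d zs m Fin.zero ≡ F ((x , s) ∷ zs) (flat m)
  head ⊕ true  loc = trans (bools (1 ≤ᵇ X₀) (supportFrom Fin.zero true (lowerᵐ ⊕ Fin.zero 1 m)) (Fc zs (flat (lowerᵐ ⊕ Fin.zero 1 m)))) (cong ⟦_⟧ (first-letter loc X₀ Y₀ (flat (X , Y)) nz))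
  head ⊕ false loc = trans (bools (1 ≤ᵇ X₀) (supportFrom Fin.zero false (lowerᵐ ⊕ Fin.zero 1 m)) (Fc zs (flat (lowerᵐ ⊕ Fin.zero 1 m)))) (cong ⟦_⟧ (first-letter loc X₀ Y₀ (flat (X , Y)) nz))
  head ⊖ true  loc = trans (bools (1 ≤ᵇ Y₀) (supportFrom Fin.zero true (lowerᵐ ⊖ Fin.zero 1 m)) (Fc zs (flat (lowerᵐ ⊖ Fin.zero 1 m)))) (cong ⟦_⟧ (first-letter loc X₀ Y₀ (flat (X , Y)) nz))
  head ⊖ false loc = trans (bools (1 ≤ᵇ Y₀) (supportFrom Fin.zero false (lowerᵐ ⊖ Fin.zero 1 m)) (Fc zs (flat (lowerᵐ ⊖ Fin.zero 1 m)))) (cong ⟦_⟧ (first-letter loc X₀ Y₀ (flat (X , Y)) nz))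
  tail : ∀ s a → firstTerm s d zs m (Fin.suc a) ≡ + 0
  tail ⊕ a rewrite eq = ℤP.*-zeroʳ ⟦ 1 ≤ᵇ expo ⊕ (X , Y) a ⟧
  tail ⊖ a rewrite eq = ℤP.*-zeroʳ ⟦ 1 ≤ᵇ expo ⊖ (X , Y) a ⟧

-- Only the smallest index of the monomial can carry the first letter: for a later `a` the support
-- condition fails, and an index with both exponents zero is skipped.
F-first : ∀ {M x s d zs} → Local x s d zs → (m : Monomial M) →
  ∑ (allFin M) (firstTerm s d zs m) ≡ F ((x , s) ∷ zs) (flat m)
F-first loc ([] , []) = refl
F-first {suc M} {x} {s} {d} {zs} loc (zero ∷ X , zero ∷ Y) = begin
  ∑ (allFin (suc M)) (firstTerm s d zs (zero ∷ X , zero ∷ Y))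
    ≡⟨ ∑-allFin-suc M (firstTerm s d zs (zero ∷ X , zero ∷ Y)) ⟩
  firstTerm s d zs (zero ∷ X , zero ∷ Y) Fin.zero + ∑ (allFin M) (λ a → firstTerm s d zs (zero ∷ X , zero ∷ Y) (Fin.suc a))
    ≡⟨ cong₂ _+_ (head s) (∑-cong (allFin M) (tail s)) ⟩
  + 0 + ∑ (allFin M) (firstTerm s d zs (X , Y))
    ≡⟨ ℤP.+-identityˡ _ ⟩
  ∑ (allFin M) (firstTerm s d zs (X , Y))
    ≡⟨ F-first loc (X , Y) ⟩
  F ((x , s) ∷ zs) (flat (X , Y)) ∎
  where
  open ≡-Reasoning
  head : ∀ s → firstTerm s d zs (zero ∷ X , zero ∷ Y) Fin.zero ≡ + 0
  head ⊕ = refl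
  head ⊖ = refl
  tail : ∀ s a → firstTerm s d zs (zero ∷ X , zero ∷ Y) (Fin.suc a) ≡ firstTerm s d zs (X , Y) a
  tail ⊕ a = cong (λ b → ⟦ 1 ≤ᵇ expo ⊕ (X , Y) a ⟧ * (⟦ supportFrom a d (lowerᵐ ⊕ a 1 (X , Y)) ⟧ * ⟦ b ⟧))
                  (trans (Fc-0∷ zs ⊖ _) (Fc-0∷ zs ⊕ (flat (lowerᵐ ⊕ a 1 (X , Y)))))
  tail ⊖ a = cong (λ b → ⟦ 1 ≤ᵇ expo ⊖ (X , Y) a ⟧ * (⟦ supportFrom a d (lowerᵐ ⊖ a 1 (X , Y)) ⟧ * ⟦ b ⟧))
                  (trans (Fc-0∷ zs ⊖ _) (Fc-0∷ zs ⊕ (flat (lowerᵐ ⊖ a 1 (X , Y)))))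
F-first loc (zero ∷ X  , suc Y₀ ∷ Y) = F-first-nonzero loc zero X (suc Y₀) Y refl
F-first loc (suc X₀ ∷ X , Y₀ ∷ Y)    = F-first-nonzero loc (suc X₀) X Y₀ Y refl

descentFlag : List (Maybe Sign) → Bool
descentFlag σ with wDesList σ
... | []    = false
... | d ∷ _ = d

wDesList-∷ : ∀ x σ → wDesList (x ∷ σ) ≡ descentFlag (x ∷ σ) ∷ wDesList σ
wDesList-∷ nothing  σ = refl
wDesList-∷ (just e) σ = refl

firstJust-valid : ∀ y σ → T (lastIsJust (y ∷ σ)) → firstJust (y ∷ σ) ≡ just (headSign (y ∷ σ))
firstJust-valid (just e) σ       h = refl
firstJust-valid nothing  (z ∷ σ) h = firstJust-valid z σ h

local : ∀ x σ → T (lastIsJust (x ∷ σ)) → Local x (headSign (x ∷ σ)) (descentFlag (x ∷ σ)) (withSigns σ)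
local nothing  (y ∷ σ) h = mid
local (just e) []      h = end
local (just e) (y ∷ σ) h rewrite firstJust-valid y σ h = cut

lastIsJust-tail : ∀ x y σ → T (lastIsJust (x ∷ y ∷ σ)) → T (lastIsJust (y ∷ σ))
lastIsJust-tail (just _) y σ h = h
lastIsJust-tail nothing  y σ h = h

letters : ∀ {n M} → (Fin n → Fin M) → List ℕ
letters f = map toℕ (toList (tabulate f))

letters-cong : ∀ {n M} {f g : Fin n → Fin M} → f ≗ g → letters f ≡ letters g
letters-cong eq = cong (λ v → map toℕ (toList v)) (VecP.tabulate-cong eq)

occurrences : ∀ {n M} → Sign → List Sign → (Fin n → Fin M) → Fin M → ℕ
occurrences {n} s ε f a = countTrue (map (λ p → ⌊ f (proj₁ p) Fin.≟ a ⌋ ∧ (proj₂ p ==ˢ s)) (zip (allFin n) ε))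

countTrue-∷ : ∀ b bs → countTrue (b ∷ bs) ≡ (if b then 1 else 0) ℕ.+ countTrue bs
countTrue-∷ true  bs = refl
countTrue-∷ false bs = refl

zip-mapˡ : {A B C : Set} (h : A → B) (xs : List A) (ys : List C) → zip (map h xs) ys ≡ map (λ p → h (proj₁ p) , proj₂ p) (zip xs ys)
zip-mapˡ h []       ys       = refl
zip-mapˡ h (x ∷ xs) []       = refl
zip-mapˡ h (x ∷ xs) (y ∷ ys) = cong (_ ∷_) (zip-mapˡ h xs ys)

occurrences-cons : ∀ {n M} s e ε (b : Fin M) (f : Fin n → Fin M) a →
  occurrences s (e ∷ ε) (cons b f) a ≡ (if ⌊ b Fin.≟ a ⌋ ∧ (e ==ˢ s) then 1 else 0) ℕ.+ occurrences s ε f a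
occurrences-cons {n} s e ε b f a = trans (countTrue-∷ (⌊ b Fin.≟ a ⌋ ∧ (e ==ˢ s)) (map φ (zip (List.tabulate Fin.suc) ε)))
  (cong (λ l → (if ⌊ b Fin.≟ a ⌋ ∧ (e ==ˢ s) then 1 else 0) ℕ.+ countTrue l)
    (trans (cong (λ l → map φ (zip l ε)) (sym (ListP.map-tabulate id Fin.suc)))
    (trans (cong (map φ) (zip-mapˡ Fin.suc (allFin n) ε)) (sym (ListP.map-∘ (zip (allFin n) ε))))))
  where
  φ : Fin (suc n) × Sign → Bool
  φ p = ⌊ cons b f (proj₁ p) Fin.≟ a ⌋ ∧ (proj₂ p ==ˢ s)

occurrences-cong : ∀ {n M} s ε {f g : Fin n → Fin M} → f ≗ g → occurrences s ε f ≗ occurrences s ε g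
occurrences-cong {n} s ε eq a = cong countTrue (ListP.map-cong (λ p → cong (λ z → ⌊ z Fin.≟ a ⌋ ∧ (proj₂ p ==ˢ s)) (eq (proj₁ p))) (zip (allFin n) ε))

seqMonomial-cong : ∀ {n M} ε {f g : Fin n → Fin M} → f ≗ g → seqMonomial ε f ≡ seqMonomial ε g
seqMonomial-cong ε {f} {g} eq = cong₂ _,_ (VecP.tabulate-cong (occurrences-cong ⊕ ε {f} {g} eq)) (VecP.tabulate-cong (occurrences-cong ⊖ ε {f} {g} eq))

tabulate-⊹ : ∀ {M} (f g : Fin M → ℕ) → tabulate (λ a → f a ℕ.+ g a) ≡ tabulate f ⊹ tabulate g
tabulate-⊹ {zero}  f g = refl
tabulate-⊹ {suc M} f g = cong (f Fin.zero ℕ.+ g Fin.zero ∷_) (tabulate-⊹ (f ∘ Fin.suc) (g ∘ Fin.suc))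

seqMonomial-cons : ∀ {n M} s ε (a : Fin M) (f : Fin n → Fin M) →
  seqMonomial (s ∷ ε) (cons a f) ≡ unit s 1 a ⊹ᵐ seqMonomial ε f
seqMonomial-cons {n} {M} s ε a f = trans
  (cong₂ _,_ (trans (VecP.tabulate-cong (occurrences-cons ⊕ s ε a f)) (tabulate-⊹ _ (occurrences ⊕ ε f)))
             (trans (VecP.tabulate-cong (occurrences-cons ⊖ s ε a f)) (tabulate-⊹ _ (occurrences ⊖ ε f))))
  (split s)
  where
  hit : ∀ b → (if b ∧ true then 1 else 0) ≡ (if b then 1 else 0)
  hit true  = refl
  hit false = refl
  miss : ∀ b → (if b ∧ false then 1 else 0) ≡ 0
  miss true  = refl
  miss false = refl
  unitHere = VecP.tabulate-cong (λ b → hit ⌊ a Fin.≟ b ⌋)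
  unitNone = VecP.tabulate-cong (λ b → miss ⌊ a Fin.≟ b ⌋)
  split : ∀ s → (tabulate (λ b → if ⌊ a Fin.≟ b ⌋ ∧ (s ==ˢ ⊕) then 1 else 0) ⊹ tabulate (occurrences ⊕ ε f) ,
                 tabulate (λ b → if ⌊ a Fin.≟ b ⌋ ∧ (s ==ˢ ⊖) then 1 else 0) ⊹ tabulate (occurrences ⊖ ε f))
              ≡ unit s 1 a ⊹ᵐ seqMonomial ε f
  split ⊕ = cong₂ (λ u v → u ⊹ tabulate (occurrences ⊕ ε f) , v ⊹ tabulate (occurrences ⊖ ε f)) unitHere unitNone
  split ⊖ = cong₂ (λ u v → u ⊹ tabulate (occurrences ⊕ ε f) , v ⊹ tabulate (occurrences ⊖ ε f)) unitNone unitHere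

-- `h` is `id` at the start of a word and afterwards prepends the letter just removed, with which
-- the next letter still has to be compared.
chainTerm : ∀ {n M} → (List ℕ → List ℕ) → List Bool → List Sign → Monomial M → (Fin n → Fin M) → ℤ
chainTerm h ds ε m f = ⟦ chainOK (h (letters f)) ds ⟧ * 𝟙 (seqMonomial ε f ≟ᵐ m)

chainTerm-cong : ∀ {n M} h ds ε (m : Monomial M) {f g : Fin n → Fin M} → f ≗ g → chainTerm h ds ε m f ≡ chainTerm h ds ε m g
chainTerm-cong h ds ε m eq = cong₂ (λ l u → ⟦ chainOK (h l) ds ⟧ * 𝟙 (u ≟ᵐ m)) (letters-cong eq) (seqMonomial-cong ε eq)

chainCount : ∀ {M} (n : ℕ) → (List ℕ → List ℕ) → List Bool → List Sign → Monomial M → ℤ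
chainCount {M} n h ds ε m = ∑ (Words M n) (chainTerm h ds ε m)

chainCount-∷ : ∀ {M} n (h : List ℕ → List ℕ) (b : Fin M → Bool) ds d ds′ s ε (m : Monomial M) →
  (∀ a l → chainOK (h (toℕ a ∷ l)) ds ≡ b a ∧ chainOK (toℕ a ∷ l) (d ∷ ds′)) →
  chainCount (suc n) h ds (s ∷ ε) m ≡
  ∑ (allFin M) (λ a → ⟦ b a ⟧ * (⟦ 1 ≤ᵇ expo s m a ⟧ * chainCount n (toℕ a ∷_) (d ∷ ds′) ε (lowerᵐ s a 1 m)))
chainCount-∷ {M} n h b ds d ds′ s ε m split = begin
  ∑ (Words M (suc n)) (chainTerm h ds (s ∷ ε) m)
    ≡⟨ ∑-allFuns-suc (allFin M) n (chainTerm h ds (s ∷ ε) m) (chainTerm-cong h ds (s ∷ ε) m) ⟩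
  ∑ (Words M n) (λ f → ∑ (allFin M) (λ a → chainTerm h ds (s ∷ ε) m (cons a f)))
    ≡⟨ ∑-swap (Words M n) (allFin M) (λ f a → chainTerm h ds (s ∷ ε) m (cons a f)) ⟩
  ∑ (allFin M) (λ a → ∑ (Words M n) (λ f → chainTerm h ds (s ∷ ε) m (cons a f)))
    ≡⟨ ∑-cong (allFin M) (λ a → trans (∑-cong (Words M n) (term a))
         (trans (∑-*ˡ ⟦ b a ⟧ (Words M n) (λ f → ⟦ 1 ≤ᵇ expo s m a ⟧ * chainTerm (toℕ a ∷_) (d ∷ ds′) ε (lowerᵐ s a 1 m) f))
                (cong (_*_ ⟦ b a ⟧) (∑-*ˡ ⟦ 1 ≤ᵇ expo s m a ⟧ (Words M n) (chainTerm (toℕ a ∷_) (d ∷ ds′) ε (lowerᵐ s a 1 m)))))) ⟩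
  ∑ (allFin M) (λ a → ⟦ b a ⟧ * (⟦ 1 ≤ᵇ expo s m a ⟧ * chainCount n (toℕ a ∷_) (d ∷ ds′) ε (lowerᵐ s a 1 m))) ∎
  where
  open ≡-Reasoning
  alg : ∀ p q r t → (p * q) * (r * t) ≡ p * (r * (q * t))
  alg = solve-∀
  term : ∀ a f → chainTerm h ds (s ∷ ε) m (cons a f) ≡
                 ⟦ b a ⟧ * (⟦ 1 ≤ᵇ expo s m a ⟧ * chainTerm (toℕ a ∷_) (d ∷ ds′) ε (lowerᵐ s a 1 m) f)
  term a f = trans (cong₂ _*_ (trans (cong ⟦_⟧ (split a (letters f))) (⟦∧⟧ (b a) (chainOK (toℕ a ∷ letters f) (d ∷ ds′))))
                              (trans (cong (λ u → 𝟙 (u ≟ᵐ m)) (seqMonomial-cons s ε a f)) (𝟙-unit-⊹ s 1 a (seqMonomial ε f) m)))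
    (alg ⟦ b a ⟧ ⟦ chainOK (toℕ a ∷ letters f) (d ∷ ds′) ⟧ ⟦ 1 ≤ᵇ expo s m a ⟧ (𝟙 (seqMonomial ε f ≟ᵐ lowerᵐ s a 1 m)))

Valid : List (Maybe Sign) → Set
Valid []      = ⊤
Valid (x ∷ σ) = T (lastIsJust (x ∷ σ))

Valid-tail : ∀ x σ → Valid (x ∷ σ) → Valid σ
Valid-tail x []      h = tt
Valid-tail x (y ∷ σ) h = lastIsJust-tail x y σ h

empty-monomial : ∀ {M} (m : Monomial M) → 𝟙 ((zeroExp M , zeroExp M) ≟ᵐ m) ≡ F [] (flat m)
empty-monomial {M} m = trans (sym (trans (coeff-∑ m (polyOne M)) (trans (ℤP.+-identityʳ _) (ℤP.*-identityʳ _))))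
                             (trans (coeff-polyOne m) (cong ⟦_⟧ (nil (flat m))))
  where
  nil : ∀ δ → allZero δ ≡ Fc [] δ
  nil []                = refl
  nil ((zero , e) ∷ δ)  = nil δ
  nil ((suc k , e) ∷ δ) = refl

supportFrom-zero : ∀ {M} (p : Fin M) d m → T (Fc [] (flat m)) → supportFrom p d m ≡ true
supportFrom-zero Fin.zero    true  (zero ∷ xs , zero ∷ ys) h = refl
supportFrom-zero Fin.zero    false m                       h = refl
supportFrom-zero (Fin.suc p) d     (zero ∷ xs , zero ∷ ys) h = supportFrom-zero p d (xs , ys) h

-- A monomial belongs to at most one admissible word, as indices increase and y comes before x
-- within an index; so the count is an indicator. The preceding letter `p` enters only through the
-- support of the monomial.
chainCount-F : ∀ {n M} (σ : Vec (Maybe Sign) n) → Valid (toList σ) → (p : Fin M) (d : Bool) (m : Monomial M) →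
  chainCount n (toℕ p ∷_) (d ∷ wDesList (toList σ)) (tildeList (toList σ)) m
  ≡ ⟦ supportFrom p d m ⟧ * F (withSigns (toList σ)) (flat m)
chainCount-F {M = M} [] v p d m = trans (ℤP.+-identityʳ _) (trans (ℤP.*-identityˡ _) (trans (empty-monomial m) (absorb (Fc [] (flat m)) refl)))
  where
  absorb : ∀ b → Fc [] (flat m) ≡ b → ⟦ b ⟧ ≡ ⟦ supportFrom p d m ⟧ * ⟦ b ⟧
  absorb true  eq rewrite supportFrom-zero p d m (subst T (sym eq) tt) = refl
  absorb false eq = sym (ℤP.*-zeroʳ ⟦ supportFrom p d m ⟧)
chainCount-F {suc n} {M} (x ∷ σ) v p d m = begin
  chainCount (suc n) (toℕ p ∷_) (d ∷ wDesList (x ∷ σ′)) (s ∷ tildeList σ′) m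
    ≡⟨ chainCount-∷ n (toℕ p ∷_) (λ a → step d (toℕ p) (toℕ a)) (d ∷ wDesList (x ∷ σ′)) d′ (wDesList σ′) s (tildeList σ′) m
         (λ a l → cong (λ ds → step d (toℕ p) (toℕ a) ∧ chainOK (toℕ a ∷ l) ds) (wDesList-∷ x σ′)) ⟩
  ∑ (allFin M) (λ a → ⟦ step d (toℕ p) (toℕ a) ⟧ * (⟦ 1 ≤ᵇ expo s m a ⟧ * chainCount n (toℕ a ∷_) (d′ ∷ wDesList σ′) (tildeList σ′) (lowerᵐ s a 1 m)))
    ≡⟨ ∑-cong (allFin M) (λ a → cong (λ z → ⟦ step d (toℕ p) (toℕ a) ⟧ * (⟦ 1 ≤ᵇ expo s m a ⟧ * z)) (chainCount-F σ (Valid-tail x σ′ v) a d′ (lowerᵐ s a 1 m))) ⟩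
  ∑ (allFin M) (λ a → ⟦ step d (toℕ p) (toℕ a) ⟧ * firstTerm s d′ zs m a)
    ≡⟨ ∑-cong (allFin M) (λ a → exchange (1 ≤ᵇ expo s m a) {step d (toℕ p) (toℕ a)} {supportFrom a d′ (lowerᵐ s a 1 m)} {supportFrom p d m} {F zs (flat (lowerᵐ s a 1 m))} (step-support d d′ s p a m)) ⟩
  ∑ (allFin M) (λ a → ⟦ supportFrom p d m ⟧ * firstTerm s d′ zs m a)
    ≡⟨ ∑-*ˡ ⟦ supportFrom p d m ⟧ (allFin M) (firstTerm s d′ zs m) ⟩
  ⟦ supportFrom p d m ⟧ * ∑ (allFin M) (firstTerm s d′ zs m)
    ≡⟨ cong (_*_ ⟦ supportFrom p d m ⟧) (F-first (local x σ′ v) m) ⟩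
  ⟦ supportFrom p d m ⟧ * F (withSigns (x ∷ σ′)) (flat m) ∎
  where
  open ≡-Reasoning
  σ′ = toList σ
  s  = headSign (x ∷ σ′)
  d′ = descentFlag (x ∷ σ′)
  zs = withSigns σ′
  alg : ∀ u v w → u * (+ 1 * (v * w)) ≡ u * v * w
  alg = solve-∀
  exchange : ∀ c {u v r f} → (T c → u ∧ v ≡ r ∧ v) → ⟦ u ⟧ * (⟦ c ⟧ * (⟦ v ⟧ * f)) ≡ ⟦ r ⟧ * (⟦ c ⟧ * (⟦ v ⟧ * f))
  exchange false {u} {r = r} h = trans (ℤP.*-zeroʳ ⟦ u ⟧) (sym (ℤP.*-zeroʳ ⟦ r ⟧))
  exchange true {u} {v} {r} {f} h = trans (alg ⟦ u ⟧ ⟦ v ⟧ f) (trans (cong (_* f) (trans (sym (⟦∧⟧ u v)) (trans (cong ⟦_⟧ (h tt)) (⟦∧⟧ r v))))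
                                          (sym (alg ⟦ r ⟧ ⟦ v ⟧ f)))

coeffF-F : ∀ {n M} (σ : Vec (Maybe Sign) n) → IsSignedSet σ → (m : Monomial M) → coeffF m σ ≡ F (withSigns (toList σ)) (flat m)
coeffF-F {suc n} {M} (x ∷ σ) v m = begin
  coeffF m (x ∷ σ)
    ≡⟨ length-filter (λ f → T? (chainOK (letters f) (wDesList (x ∷ σ′))) ×-dec (seqMonomial (s ∷ tildeList σ′) f ≟ᵐ m)) (Words M (suc n)) ⟩
  ∑ (Words M (suc n)) (λ f → 𝟙 (T? (chainOK (letters f) (wDesList (x ∷ σ′))) ×-dec (seqMonomial (s ∷ tildeList σ′) f ≟ᵐ m)))
    ≡⟨ ∑-cong (Words M (suc n)) (λ f → 𝟙-× (T? (chainOK (letters f) (wDesList (x ∷ σ′)))) (seqMonomial (s ∷ tildeList σ′) f ≟ᵐ m)) ⟩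
  chainCount (suc n) id (wDesList (x ∷ σ′)) (s ∷ tildeList σ′) m
    -- The first letter has no predecessor, so its comparison is constantly `true`.
    ≡⟨ chainCount-∷ n id (λ _ → true) (wDesList (x ∷ σ′)) d′ (wDesList σ′) s (tildeList σ′) m
         (λ a l → cong (chainOK (toℕ a ∷ l)) (wDesList-∷ x σ′)) ⟩
  ∑ (allFin M) (λ a → + 1 * (⟦ 1 ≤ᵇ expo s m a ⟧ * chainCount n (toℕ a ∷_) (d′ ∷ wDesList σ′) (tildeList σ′) (lowerᵐ s a 1 m)))
    ≡⟨ ∑-cong (allFin M) (λ a → trans (ℤP.*-identityˡ (⟦ 1 ≤ᵇ expo s m a ⟧ * chainCount n (toℕ a ∷_) (d′ ∷ wDesList σ′) (tildeList σ′) (lowerᵐ s a 1 m)))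
         (cong (_*_ ⟦ 1 ≤ᵇ expo s m a ⟧) (chainCount-F σ (Valid-tail x σ′ v) a d′ (lowerᵐ s a 1 m)))) ⟩
  ∑ (allFin M) (firstTerm s d′ (withSigns σ′) m)
    ≡⟨ F-first (local x σ′ v) m ⟩
  F (withSigns (x ∷ σ′)) (flat m) ∎
  where
  open ≡-Reasoning
  σ′ = toList σ
  s  = headSign (x ∷ σ′)
  d′ = descentFlag (x ∷ σ′)

-- Cycles of signed permutations

search : ∀ {n} → (Fin n → Fin n) → Fin n → ℕ → ℕ → ℕ
search f i k zero    = k
search f i k (suc b) = if ⌊ iter k f i Fin.≟ i ⌋ then k else search f i (suc k) b

-- The placeholder stands for the local function of orbitLen, which cannot be named here; the with-abstraction
-- turns its arguments into variables, so that unification finds it.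
mutual
  orbitLen-search : ∀ {n} (f : Fin (suc n) → Fin (suc n)) i → orbitLen f i ≡ search f i 1 (suc n)
  orbitLen-search {n} f i with suc n | 2
  ... | N | k = cong (λ z → if ⌊ f i Fin.≟ i ⌋ then 1 else z) (go-search f i k n)

  go-search : ∀ {n} (f : Fin n → Fin n) i k b → _ ≡ search f i k b
  go-search f i k zero    = refl
  go-search f i k (suc b) with iter k f i Fin.≟ i
  ... | yes _ = refl
  ... | no _  = go-search f i (suc k) b

search-spec : ∀ {n} (f : Fin n → Fin n) i k b → (∀ t → 1 ≤ t → t < k → iter t f i ≢ i) →
  (k ≤ search f i k b) × (∀ t → 1 ≤ t → t < search f i k b → iter t f i ≢ i) ×
  ((iter (search f i k b) f i ≡ i) ⊎ (search f i k b ≡ k ℕ.+ b))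
search-spec f i k zero    h = ℕP.≤-refl , h , inj₂ (sym (ℕP.+-identityʳ k))
search-spec f i k (suc b) h with iter k f i Fin.≟ i
... | yes p = ℕP.≤-refl , h , inj₁ p
... | no ¬p = let (p , q , r) = search-spec f i (suc k) b (λ t 1≤t t<1+k → extend t 1≤t (ℕP.m≤n⇒m<n∨m≡n (ℕP.≤-pred t<1+k))) in
    ℕP.<⇒≤ p , q , Sum.map₂ (λ e → trans e (sym (ℕP.+-suc k b))) r
  where
  extend : ∀ t → 1 ≤ t → (t < k) ⊎ (t ≡ k) → iter t f i ≢ i
  extend t 1≤t (inj₁ lt)   = h t 1≤t lt
  extend t 1≤t (inj₂ refl) = ¬p

-- The fuel suffices: a search that ran out would have stopped at `1 + n` and thus have passed the
-- return time `t ≤ n`.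
orbitLen-spec : ∀ {n} (f : Fin n → Fin n) i → (∃ λ t → (1 ≤ t) × (t ≤ n) × (iter t f i ≡ i)) →
  (1 ≤ orbitLen f i) × (∀ t → 1 ≤ t → t < orbitLen f i → iter t f i ≢ i) × (iter (orbitLen f i) f i ≡ i)
orbitLen-spec {suc m} f i (t , 1≤t , t≤n , eq) rewrite orbitLen-search f i
  with search-spec f i 1 (suc m) (λ { t 1≤t (s≤s t≤0) _ → ℕP.<⇒≱ 1≤t t≤0 })
... | p , q , inj₁ r = p , q , r
... | p , q , inj₂ r = ⊥-elim (q t 1≤t (subst (t <_) (sym r) (s≤s t≤n)) eq)

T-allB⁻ : {A : Set} (p : A → Bool) {xs : List A} → T (allB p xs) → ∀ {x} → x ∈ xs → T (p x)
T-allB⁻ p {y ∷ ys} h (here refl) with p y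
... | true = tt
T-allB⁻ p {y ∷ ys} h (there m) with p y
... | true = T-allB⁻ p h m

T-allB⁺ : {A : Set} (p : A → Bool) {xs : List A} → (∀ {x} → x ∈ xs → T (p x)) → T (allB p xs)
T-allB⁺ p {[]}     h = tt
T-allB⁺ p {y ∷ ys} h with p y | h (here refl)
... | true | _ = T-allB⁺ p (λ m → h (there m))

Injective′ : ∀ {m n} → (Fin m → Fin n) → Set
Injective′ f = ∀ i j → f i ≡ f j → i ≡ j

isInjective⁻ : ∀ {n} (π : Fin n → Fin n) → T (isInjective π) → Injective′ π
isInjective⁻ {n} π h i j eq = pick (T-allB⁻ _ (T-allB⁻ _ h (∈P.∈-allFin i)) (∈P.∈-allFin j))
  where
  pick : T (not ⌊ π i Fin.≟ π j ⌋ ∨ ⌊ i Fin.≟ j ⌋) → i ≡ j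
  pick h with π i Fin.≟ π j | i Fin.≟ j
  ... | _     | yes p = p
  ... | no ¬e | no _  = ⊥-elim (¬e eq)

isInjective⁺ : ∀ {n} (π : Fin n → Fin n) → Injective′ π → T (isInjective π)
isInjective⁺ {n} π inj = T-allB⁺ _ {allFin n} (λ {i} _ → T-allB⁺ _ {allFin n} (λ {j} _ → put i j))
  where
  put : ∀ i j → T (not ⌊ π i Fin.≟ π j ⌋ ∨ ⌊ i Fin.≟ j ⌋)
  put i j with π i Fin.≟ π j | i Fin.≟ j
  ... | no _  | _     = tt
  ... | yes _ | yes _ = tt
  ... | yes e | no ¬p = ⊥-elim (¬p (inj i j e))

iter-+ : ∀ {n} a b (f : Fin n → Fin n) i → iter (a ℕ.+ b) f i ≡ iter a f (iter b f i)
iter-+ zero    b f i = refl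
iter-+ (suc a) b f i = cong f (iter-+ a b f i)

module Orbits {n : ℕ} (π : Fin n → Fin n) (π-inj : Injective′ π) where

  len : Fin n → ℕ
  len = orbitLen π

  iter-injective : ∀ t {a b} → iter t π a ≡ iter t π b → a ≡ b
  iter-injective zero    eq = eq
  iter-injective (suc t) eq = iter-injective t (π-inj _ _ eq)

  cancel-iter : ∀ s t i → iter s π i ≡ iter (t ℕ.+ s) π i → iter t π i ≡ i
  cancel-iter s t i eq = sym (iter-injective s (trans eq (trans (cong (λ z → iter z π i) (ℕP.+-comm t s)) (iter-+ s t π i))))

  -- Pigeonhole among `n + 1` iterates; injectivity turns a coincidence of two of them into a return
  -- to `i`.
  some-return : ∀ i → ∃ λ t → (1 ≤ t) × (t ≤ n) × (iter t π i ≡ i)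
  some-return i with a , b , a<b , eq ← FinP.pigeonhole (ℕP.n<1+n n) (λ (t : Fin (suc n)) → iter (toℕ t) π i) =
    toℕ b ∸ toℕ a , ℕP.m<n⇒0<n∸m a<b , ℕP.≤-trans (ℕP.m∸n≤m (toℕ b) (toℕ a)) (FinP.toℕ≤pred[n] b) ,
    cancel-iter (toℕ a) (toℕ b ∸ toℕ a) i (trans eq (cong (λ z → iter z π i) (sym (ℕP.m∸n+n≡m (ℕP.<⇒≤ a<b)))))

  len-spec : ∀ i → (1 ≤ len i) × (∀ t → 1 ≤ t → t < len i → iter t π i ≢ i) × (iter (len i) π i ≡ i)
  len-spec i = orbitLen-spec π i (some-return i)

  len-pos : ∀ i → 1 ≤ len i
  len-pos i = proj₁ (len-spec i)

  iter-len : ∀ i → iter (len i) π i ≡ i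
  iter-len i = proj₂ (proj₂ (len-spec i))

  iter-distinct-< : ∀ i {s t} → s < t → t < len i → iter s π i ≢ iter t π i
  iter-distinct-< i {s} {t} s<t t<l eq = proj₁ (proj₂ (len-spec i)) (t ∸ s) (ℕP.m<n⇒0<n∸m s<t)
    (ℕP.≤-<-trans (ℕP.m∸n≤m t s) t<l) (cancel-iter s (t ∸ s) i (trans eq (cong (λ z → iter z π i) (sym (ℕP.m∸n+n≡m (ℕP.<⇒≤ s<t))))))

  iter-distinct : ∀ i {s t} → s < len i → t < len i → iter s π i ≡ iter t π i → s ≡ t
  iter-distinct i {s} {t} s<l t<l eq with ℕP.<-cmp s t
  ... | tri< s<t _ _ = ⊥-elim (iter-distinct-< i s<t t<l eq)
  ... | tri≈ _ s≡t _ = s≡t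
  ... | tri> _ _ t<s = ⊥-elim (iter-distinct-< i t<s s<l (sym eq))

  reduce : ∀ i t → ∃ λ s → (s < len i) × (iter t π i ≡ iter s π i)
  reduce i zero = 0 , len-pos i , refl
  reduce i (suc t) with s , s<l , eq ← reduce i t with ℕP.m≤n⇒m<n∨m≡n s<l
  ... | inj₁ lt = suc s , lt , cong π eq
  ... | inj₂ e  = 0 , len-pos i , trans (cong π eq) (trans (cong (λ z → iter z π i) e) (iter-len i))

  orbit-sym : ∀ i t → ∃ λ s → iter s π (iter t π i) ≡ i
  orbit-sym i t with s , s<l , eq ← reduce i t = len i ∸ s ,
    trans (cong (iter (len i ∸ s) π) eq) (trans (sym (iter-+ (len i ∸ s) s π i))
      (trans (cong (λ z → iter z π i) (ℕP.m∸n+n≡m (ℕP.<⇒≤ s<l))) (iter-len i)))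

  minimal : ∀ i k → ∃ λ t → ∀ s → s ≤ k → toℕ (iter t π i) ≤ toℕ (iter s π i)
  minimal i zero = 0 , λ { .0 z≤n → ℕP.≤-refl }
  minimal i (suc k) with t , h ← minimal i k with ℕP.≤-total (toℕ (iter t π i)) (toℕ (iter (suc k) π i))
  ... | inj₁ le = t , λ s s≤ → [ (λ lt → h s (ℕP.≤-pred lt)) , (λ { refl → le }) ]′ (ℕP.m≤n⇒m<n∨m≡n s≤)
  ... | inj₂ ge = suc k , λ s s≤ → [ (λ lt → ℕP.≤-trans ge (h s (ℕP.≤-pred lt))) , (λ { refl → ℕP.≤-refl }) ]′ (ℕP.m≤n⇒m<n∨m≡n s≤)

  IsMin : Fin n → Set
  IsMin r = ∀ t → toℕ r ≤ toℕ (iter t π r)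

  min-in-orbit : ∀ i → ∃ λ r → IsMin r × ∃ λ t → (t < len r) × (iter t π r ≡ i)
  min-in-orbit i with t , h ← minimal i (len i) = iter t π i ,
    (λ s → let (u , u<l , eq) = reduce i (s ℕ.+ t) in
      ℕP.≤-trans (h u (ℕP.<⇒≤ u<l)) (ℕP.≤-reflexive (cong toℕ (trans (sym eq) (iter-+ s t π i))))) ,
    (let (s , eq) = orbit-sym i t ; (u , u<l , eq′) = reduce (iter t π i) s in u , u<l , trans (sym eq′) eq)

  min-unique : ∀ {r r′} → IsMin r → IsMin r′ → ∀ s t → iter s π r ≡ iter t π r′ → r ≡ r′
  min-unique {r} {r′} m m′ s t eq = FinP.toℕ-injective (ℕP.≤-antisym (below s t m eq) (below t s m′ (sym eq)))
    where
    below : ∀ {r r′} s t → IsMin r → iter s π r ≡ iter t π r′ → toℕ r ≤ toℕ r′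
    below {r} {r′} s t m eq with u , e ← orbit-sym r′ t =
      ℕP.≤-trans (m (u ℕ.+ s)) (ℕP.≤-reflexive (cong toℕ (trans (iter-+ u s π r) (trans (cong (iter u π) eq) e))))

psign : ∀ {n} → SPerm n → ℕ → Fin n → Sign
psign w zero    r = ⊕
psign w (suc t) r = psign w t r ·ˢ sign w (iter t (perm w) r)

·ˢ-assoc : ∀ a b c → (a ·ˢ b) ·ˢ c ≡ a ·ˢ (b ·ˢ c)
·ˢ-assoc ⊕ b c = refl
·ˢ-assoc ⊖ ⊕ c = refl
·ˢ-assoc ⊖ ⊖ ⊕ = refl
·ˢ-assoc ⊖ ⊖ ⊖ = refl

·ˢ-identityʳ : ∀ a → a ·ˢ ⊕ ≡ a
·ˢ-identityʳ ⊕ = refl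
·ˢ-identityʳ ⊖ = refl

orbitSign-psign : ∀ {n} (w : SPerm n) i → orbitSign w i ≡ psign w (orbitLen (perm w) i) i
orbitSign-psign w i = go (orbitLen (perm w) i)
  where
  f : ℕ → Sign
  f t = sign w (iter t (perm w) i)
  snoc : ∀ xs t → foldr _·ˢ_ ⊕ (map f (xs List.∷ʳ t)) ≡ foldr _·ˢ_ ⊕ (map f xs) ·ˢ f t
  snoc []       t = ·ˢ-identityʳ (f t)
  snoc (x ∷ xs) t = trans (cong (f x ·ˢ_) (snoc xs t)) (sym (·ˢ-assoc (f x) _ (f t)))
  go : ∀ k → foldr _·ˢ_ ⊕ (map f (upTo k)) ≡ psign w k i
  go zero    = refl
  go (suc k) = trans (cong (λ l → foldr _·ˢ_ ⊕ (map f l)) (sym (ListP.upTo-∷ʳ k))) (trans (snoc (upTo k) k) (cong (_·ˢ f k) (go k)))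

-- A parametrisation of [n] by the cycles of w: every i is w^(time i) applied to the root of its cycle.
record Cycles {n : ℕ} (w : SPerm n) (q : ℕ) (root : Fin q → Fin n) : Set where
  private
    π = perm w
  field
    index  : Fin n → Fin q
    time   : Fin n → ℕ
    time<  : ∀ i → time i < orbitLen π (root (index i))
    locate : ∀ i → iter (time i) π (root (index i)) ≡ i
    unique : ∀ j t → t < orbitLen π (root j) → (index (iter t π (root j)) ≡ j) × (time (iter t π (root j)) ≡ t)

module _ {n : ℕ} (w : SPerm n) where

  private
    π = perm w
    open Orbits π (isInjective⁻ π (inj w))

  isCycleRep⁻ : ∀ {r} → T (isCycleRep w r) → IsMin r
  isCycleRep⁻ {r} h t with s , s<l , eq ← reduce r t =
    subst (λ z → toℕ r ≤ toℕ z) (sym eq) (ℕP.≤ᵇ⇒≤ _ _ (T-allB⁻ _ h (∈P.∈-upTo⁺ s<l)))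

  isCycleRep⁺ : ∀ {r} → IsMin r → T (isCycleRep w r)
  isCycleRep⁺ {r} h = T-allB⁺ _ {upTo (len r)} (λ {t} _ → ℕP.≤⇒≤ᵇ (h t))

  mkCycles : ∀ {q} (root : Fin q → Fin n) → (∀ j → T (isCycleRep w (root j))) → Injective′ root →
             (∀ r → T (isCycleRep w r) → ∃ λ j → root j ≡ r) → Cycles w q root
  mkCycles {q} root rep root-inj complete = record
    { index = λ i → proj₁ (coord i) ; time = λ i → proj₁ (proj₂ (coord i))
    ; time< = λ i → proj₁ (proj₂ (proj₂ (coord i))) ; locate = λ i → proj₂ (proj₂ (proj₂ (coord i))) ; unique = uniq }
    where
    coord : ∀ i → ∃ λ j → ∃ λ t → (t < len (root j)) × (iter t π (root j) ≡ i)
    coord i with r , m , t , t<l , eq ← min-in-orbit i with j , refl ← complete r (isCycleRep⁺ m) = j , t , t<l , eq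
    uniq : ∀ j t → t < len (root j) → let (j′ , t′ , _) = coord (iter t π (root j)) in (j′ ≡ j) × (t′ ≡ t)
    uniq j t t<l with coord (iter t π (root j))
    ... | j′ , t′ , t′<l , eq with refl ← root-inj j′ j (min-unique (isCycleRep⁻ (rep j′)) (isCycleRep⁻ (rep j)) t′ t eq) =
      refl , iter-distinct (root j) t′<l t<l eq

  reps : List (Fin n)
  reps = filter (λ i → T? (isCycleRep w i)) (allFin n)

  cycleType : Fin n → ℕ × Sign
  cycleType r = orbitLen π r , orbitSign w r

  signedCycles-reps : signedCycles w ≡ map cycleType reps
  signedCycles-reps = go (allFin n)
    where
    go : ∀ xs → List.mapMaybe (λ i → if isCycleRep w i then just (cycleType i) else nothing) xs ≡ map cycleType (filter (λ i → T? (isCycleRep w i)) xs)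
    go [] = refl
    go (x ∷ xs) with isCycleRep w x
    ... | true  = cong (cycleType x ∷_) (go xs)
    ... | false = go xs

  reps-unique : Unique reps
  reps-unique = UniqueP.filter⁺ _ (UniqueP.allFin⁺ n)

  signedCycles-Pos : Pos (signedCycles w)
  signedCycles-Pos = subst Pos (sym signedCycles-reps) (AllP.map⁺ (All.universal len-pos reps))

  repCycles : ∀ {q} (root : Fin q → Fin n) → Injective′ root → (∀ j → root j ∈ reps) → (∀ {r} → r ∈ reps → ∃ λ j → root j ≡ r) → Cycles w q root
  repCycles root root-inj rep complete = mkCycles root (λ j → proj₂ (∈P.∈-filter⁻ (λ i → T? (isCycleRep w i)) {xs = allFin n} (rep j))) root-inj
    (λ r h → complete (∈P.∈-filter⁺ _ (∈P.∈-allFin r) h))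

  module _ {q} {root : Fin q → Fin n} (c : Cycles w q root) where
    open Cycles c

    cycle : Fin q → List (Fin n)
    cycle j = map (λ t → iter t π (root j)) (upTo (len (root j)))

    private
      cycle⁻ : ∀ {j i} → i ∈ cycle j → index i ≡ j
      cycle⁻ {j} h with t , t∈ , refl ← ∈P.∈-map⁻ _ h = proj₁ (unique j t (∈P.∈-upTo⁻ t∈))

      cycle-unique : ∀ j → Unique (cycle j)
      cycle-unique j = subst Unique (sym (ListP.map-upTo (λ t → iter t π (root j)) (len (root j))))
        (UniqueP.applyUpTo⁺₁ (λ t → iter t π (root j)) (len (root j)) (λ s<t t<l → iter-distinct-< (root j) s<t t<l))

      cycles-unique : ∀ js → Unique js → Unique (concatMap cycle js)
      cycles-unique []       _        = []
      cycles-unique (j ∷ js) (p ∷ ps) = UniqueP.++⁺ (cycle-unique j) (cycles-unique js ps)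
        (λ { (a , b) → clash p (cycle⁻ a) (∈P.∈-concatMap⁻ cycle {xs = js} b) })
        where
        clash : ∀ {i ks} → All (j ≢_) ks → index i ≡ j → Any (λ k → i ∈ cycle k) ks → ⊥
        clash (q ∷ _)  e (here h)  = q (trans (sym e) (cycle⁻ h))
        clash (_ ∷ qs) e (there h) = clash qs e h

    cycles-↭ : concatMap cycle (allFin q) ↭ allFin n
    cycles-↭ = ∼bag⇒↭ (unique∧set⇒bag (cycles-unique (allFin q) (UniqueP.allFin⁺ q)) (UniqueP.allFin⁺ n)
      (λ {i} → mk⇔ (λ _ → ∈P.∈-allFin i) (λ _ → ∈P.∈-concatMap⁺ cycle (Any.map (λ { refl → here′ i }) (∈P.∈-allFin (index i))))))
      where
      here′ : ∀ i → i ∈ cycle (index i)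
      here′ i = subst (_∈ cycle (index i)) (locate i) (∈P.∈-map⁺ (λ t → iter t π (root (index i))) (∈P.∈-upTo⁺ (time< i)))

    index-perm : ∀ i → index (π i) ≡ index i
    index-perm i with s , s<l , eq ← reduce (root (index i)) (suc (time i)) =
      trans (cong index (trans (cong π (sym (locate i))) eq)) (proj₁ (unique (index i) s s<l))

-- Conjugacy and characters

·ˢ-comm : ∀ a b → a ·ˢ b ≡ b ·ˢ a
·ˢ-comm ⊕ ⊕ = refl
·ˢ-comm ⊕ ⊖ = refl
·ˢ-comm ⊖ ⊕ = refl
·ˢ-comm ⊖ ⊖ = refl

·ˢ-self : ∀ a → a ·ˢ a ≡ ⊕
·ˢ-self ⊕ = refl
·ˢ-self ⊖ = refl

·ˢ-swap : ∀ a b → (b ·ˢ a) ·ˢ (a ·ˢ b) ≡ ⊕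
·ˢ-swap a b = trans (cong (_·ˢ (a ·ˢ b)) (·ˢ-comm b a)) (·ˢ-self (a ·ˢ b))

·ˢ-cancelˡ : ∀ a b → a ·ˢ (a ·ˢ b) ≡ b
·ˢ-cancelˡ a b = trans (sym (·ˢ-assoc a a b)) (cong (_·ˢ b) (·ˢ-self a))

module Transport {n q : ℕ} (w w′ : SPerm n) {root root′ : Fin q → Fin n}
  (c : Cycles w q root) (c′ : Cycles w′ q root′)
  (len≡ : ∀ j → orbitLen (perm w) (root j) ≡ orbitLen (perm w′) (root′ j)) where

  private
    π  = perm w
    π′ = perm w′
    open Cycles c
    module C′ = Cycles c′

  to : Fin n → Fin n
  to i = iter (time i) π′ (root′ (index i))

  -- The sign by which `w` and `w′` differ after `time i` steps from their roots; twisting by it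
  -- makes the relabelling `to` respect signs.
  to-sign : Fin n → Sign
  to-sign i = psign w′ (time i) (root′ (index i)) ·ˢ psign w (time i) (root (index i))

  to-coords : ∀ i → (C′.index (to i) ≡ index i) × (C′.time (to i) ≡ time i)
  to-coords i = C′.unique (index i) (time i) (subst (time i <_) (len≡ (index i)) (time< i))

  to-at : ∀ {i j t} → index i ≡ j → time i ≡ t → (to i ≡ iter t π′ (root′ j)) × (to-sign i ≡ psign w′ t (root′ j) ·ˢ psign w t (root j))
  to-at refl refl = refl , refl

  next : ∀ i → ((suc (time i) < orbitLen π (root (index i))) × (index (π i) ≡ index i) × (time (π i) ≡ suc (time i)))
             ⊎ ((suc (time i) ≡ orbitLen π (root (index i))) × (index (π i) ≡ index i) × (time (π i) ≡ 0))
  next i with ℕP.m≤n⇒m<n∨m≡n (time< i)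
  ... | inj₁ lt = inj₁ (lt , subst (λ z → (index z ≡ index i) × (time z ≡ suc (time i))) (cong π (locate i)) (unique (index i) (suc (time i)) lt))
  ... | inj₂ eq = inj₂ (eq , subst (λ z → (index z ≡ index i) × (time z ≡ 0)) returns (unique (index i) 0 (Orbits.len-pos π (isInjective⁻ π (inj w)) (root (index i)))))
    where
    returns : root (index i) ≡ π i
    returns = trans (sym (Orbits.iter-len π (isInjective⁻ π (inj w)) (root (index i)))) (trans (cong (λ z → iter z π (root (index i))) (sym eq)) (cong π (locate i)))

  to-perm : ∀ i → to (π i) ≡ π′ (to i)
  to-perm i with next i
  ... | inj₁ (_ , e , f) = proj₁ (to-at e f)
  ... | inj₂ (l , e , f) = trans (proj₁ (to-at e f)) (sym (trans (cong (λ z → iter z π′ (root′ (index i))) (trans l (len≡ (index i))))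
                                    (Orbits.iter-len π′ (isInjective⁻ π′ (inj w′)) (root′ (index i)))))

  -- Inside a cycle both partial products gain one factor and the identity is formal. When the cycle
  -- closes they restart, and the identity says that the two cycles have the same total sign.
  to-sign-perm : (∀ j → orbitSign w (root j) ≡ orbitSign w′ (root′ j)) → ∀ i → sign w i ·ˢ to-sign (π i) ≡ to-sign i ·ˢ sign w′ (to i)
  to-sign-perm tot≡ i with next i
  ... | inj₁ (_ , e , f) = begin
    sign w i ·ˢ to-sign (π i)       ≡⟨ cong₂ _·ˢ_ sign-i (proj₂ (to-at e f)) ⟩
    s ·ˢ ((p′ ·ˢ s′) ·ˢ (p ·ˢ s))   ≡⟨ rearrange s s′ p p′ ⟩
    (p′ ·ˢ p) ·ˢ s′                 ∎
    where
    open ≡-Reasoning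
    s  = sign w (iter (time i) π (root (index i)))
    s′ = sign w′ (to i)
    p  = psign w (time i) (root (index i))
    p′ = psign w′ (time i) (root′ (index i))
    sign-i : sign w i ≡ s
    sign-i = cong (sign w) (sym (locate i))
    rearrange : ∀ s s′ p p′ → s ·ˢ ((p′ ·ˢ s′) ·ˢ (p ·ˢ s)) ≡ (p′ ·ˢ p) ·ˢ s′
    rearrange s s′ p p′ = begin
      s ·ˢ ((p′ ·ˢ s′) ·ˢ (p ·ˢ s))   ≡⟨ cong (s ·ˢ_) (trans (cong ((p′ ·ˢ s′) ·ˢ_) (·ˢ-comm p s)) (·ˢ-comm (p′ ·ˢ s′) (s ·ˢ p))) ⟩
      s ·ˢ ((s ·ˢ p) ·ˢ (p′ ·ˢ s′))   ≡⟨ cong (s ·ˢ_) (·ˢ-assoc s p (p′ ·ˢ s′)) ⟩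
      s ·ˢ (s ·ˢ (p ·ˢ (p′ ·ˢ s′)))   ≡⟨ ·ˢ-cancelˡ s (p ·ˢ (p′ ·ˢ s′)) ⟩
      p ·ˢ (p′ ·ˢ s′)                 ≡⟨ sym (·ˢ-assoc p p′ s′) ⟩
      (p ·ˢ p′) ·ˢ s′                 ≡⟨ cong (_·ˢ s′) (·ˢ-comm p p′) ⟩
      (p′ ·ˢ p) ·ˢ s′                 ∎
  ... | inj₂ (l , e , f) = begin
    sign w i ·ˢ to-sign (π i)  ≡⟨ cong₂ _·ˢ_ (cong (sign w) (sym (locate i))) (proj₂ (to-at e f)) ⟩
    s ·ˢ ⊕                     ≡⟨ ·ˢ-identityʳ s ⟩
    s                          ≡⟨ sym (·ˢ-cancelˡ p s) ⟩
    p ·ˢ (p ·ˢ s)              ≡⟨ cong (p ·ˢ_) totals ⟩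
    p ·ˢ (p′ ·ˢ s′)            ≡⟨ sym (·ˢ-assoc p p′ s′) ⟩
    (p ·ˢ p′) ·ˢ s′            ≡⟨ cong (_·ˢ s′) (·ˢ-comm p p′) ⟩
    (p′ ·ˢ p) ·ˢ s′            ∎
    where
    open ≡-Reasoning
    s  = sign w (iter (time i) π (root (index i)))
    s′ = sign w′ (to i)
    p  = psign w (time i) (root (index i))
    p′ = psign w′ (time i) (root′ (index i))
    totals : psign w (suc (time i)) (root (index i)) ≡ psign w′ (suc (time i)) (root′ (index i))
    totals = trans (cong (λ z → psign w z (root (index i))) l) (trans (sym (orbitSign-psign w (root (index i))))
      (trans (tot≡ (index i)) (trans (orbitSign-psign w′ (root′ (index i)))
        (cong (λ z → psign w′ z (root′ (index i))) (trans (sym (len≡ (index i))) (sym l))))))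

module Conjugate {n q : ℕ} (w w′ : SPerm n) {root root′ : Fin q → Fin n}
  (c : Cycles w q root) (c′ : Cycles w′ q root′)
  (len≡ : ∀ j → orbitLen (perm w) (root j) ≡ orbitLen (perm w′) (root′ j))
  (tot≡ : ∀ j → orbitSign w (root j) ≡ orbitSign w′ (root′ j)) where

  private
    module G = Transport w w′ c c′ len≡
    module H = Transport w′ w c′ c (λ j → sym (len≡ j))

    round : ∀ i → (H.to (G.to i) ≡ i) × (G.to-sign i ·ˢ H.to-sign (G.to i) ≡ ⊕)
    round i with e , f ← G.to-coords i with p , s ← H.to-at e f =
      trans p (Cycles.locate c i) , trans (cong (G.to-sign i ·ˢ_) s) (·ˢ-swap (psign w (Cycles.time c i) (root (Cycles.index c i))) (psign w′ (Cycles.time c i) (root′ (Cycles.index c i))))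

    round′ : ∀ i → (G.to (H.to i) ≡ i) × (H.to-sign i ·ˢ G.to-sign (H.to i) ≡ ⊕)
    round′ i with e , f ← H.to-coords i with p , s ← G.to-at e f =
      trans p (Cycles.locate c′ i) , trans (cong (H.to-sign i ·ˢ_) s) (·ˢ-swap (psign w′ (Cycles.time c′ i) (root′ (Cycles.index c′ i))) (psign w (Cycles.time c′ i) (root (Cycles.index c′ i))))

    G-inj : Injective′ G.to
    G-inj i j eq = trans (sym (proj₁ (round i))) (trans (cong H.to eq) (proj₁ (round j)))

    H-inj : Injective′ H.to
    H-inj i j eq = trans (sym (proj₁ (round′ i))) (trans (cong G.to eq) (proj₁ (round′ j)))

  -- Conjugacy without inverses: `w` and `w′` are the two products of the same pair, so tr(AB) =
  -- tr(BA) suffices to compare their traces.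
  h u : SPerm n
  h = sperm H.to H.to-sign (isInjective⁺ H.to H-inj)
  u = sperm (λ i → G.to (perm w i)) (λ i → sign w i ·ˢ G.to-sign (perm w i))
            (isInjective⁺ _ (λ i j eq → isInjective⁻ (perm w) (inj w) i j (G-inj _ _ eq)))

  w≡hu : IsProduct w h u
  w≡hu i = sym (proj₁ (round (perm w i))) ,
    sym (trans (·ˢ-assoc (sign w i) _ _) (trans (cong (sign w i ·ˢ_) (proj₂ (round (perm w i)))) (·ˢ-identityʳ _)))

  w′≡uh : IsProduct w′ u h
  w′≡uh i = sym (trans (G.to-perm (H.to i)) (cong (perm w′) (proj₁ (round′ i)))) ,
    sym (trans (cong (H.to-sign i ·ˢ_) (G.to-sign-perm tot≡ (H.to i)))
        (trans (sym (·ˢ-assoc (H.to-sign i) (G.to-sign (H.to i)) _))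
        (trans (cong (_·ˢ sign w′ (G.to (H.to i))) (proj₂ (round′ i))) (cong (sign w′) (proj₁ (round′ i))))))

zipOn : {A B X : Set} (f : A → X) (g : B → X) (xs : List A) (ys : List B) → map f xs ≡ map g ys →
  ∃ λ zs → (map proj₁ zs ≡ xs) × (map proj₂ zs ≡ ys) × All (λ z → f (proj₁ z) ≡ g (proj₂ z)) zs
zipOn f g []       []       eq = [] , refl , refl , []
zipOn f g (x ∷ xs) (y ∷ ys) eq with zs , refl , refl , h ← zipOn f g xs ys (ListP.∷-injectiveʳ eq) =
  (x , y) ∷ zs , refl , refl , ListP.∷-injectiveˡ eq ∷ h

lookup-Unique : {A B : Set} (f : B → A) (zs : List B) → Unique (map f zs) → ∀ i j → f (List.lookup zs i) ≡ f (List.lookup zs j) → i ≡ j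
lookup-Unique f (z ∷ zs) (p ∷ ps) Fin.zero    Fin.zero    eq = refl
lookup-Unique f (z ∷ zs) (p ∷ ps) Fin.zero    (Fin.suc j) eq = ⊥-elim (All.lookup p (∈P.∈-map⁺ f (∈P.∈-lookup {xs = zs} j)) eq)
lookup-Unique f (z ∷ zs) (p ∷ ps) (Fin.suc i) Fin.zero    eq = ⊥-elim (All.lookup p (∈P.∈-map⁺ f (∈P.∈-lookup {xs = zs} i)) (sym eq))
lookup-Unique f (z ∷ zs) (p ∷ ps) (Fin.suc i) (Fin.suc j) eq = cong Fin.suc (lookup-Unique f zs ps i j eq)

listCycles : ∀ {n} {B : Set} (w : SPerm n) (f : B → Fin n) (zs : List B) → map f zs ↭ reps w →
             Cycles w (length zs) (λ j → f (List.lookup zs j))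
listCycles w f zs perm = repCycles w (λ j → f (List.lookup zs j))
  (lookup-Unique f zs (PermSP.Unique-resp-↭ (≡-setoid (Fin _)) (Perm.↭⇒↭ₛ (Perm.↭-sym perm)) (reps-unique w)))
  (λ j → PermP.∈-resp-↭ perm (∈P.∈-map⁺ f (∈P.∈-lookup {xs = zs} j)))
  (λ r∈ → let (z , z∈ , eq) = ∈P.∈-map⁻ f (PermP.∈-resp-↭ (Perm.↭-sym perm) r∈) in
          Any.index z∈ , trans (cong f (sym (AnyP.lookup-index z∈))) (sym eq))

module Character (n : ℕ) (χ : SPerm n → ℤ) (isχ : IsCharacter n χ) where

  private
    K = proj₁ isχ
    open CharZeroField K renaming (_+_ to _⊕ᴷ_; _*_ to _⊗ᴷ_; -_ to ⊖ᴷ_; setoid to K-setoid; refl to ≈-refl; sym to ≈-sym; trans to ≈-trans)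
    open MatrixOps K
    d = proj₁ (proj₂ isχ)
    ρ = proj₁ (proj₂ (proj₂ isχ))
    ρ-product = proj₁ (proj₂ (proj₂ (proj₂ isχ)))
    ρ-trace = proj₂ (proj₂ (proj₂ (proj₂ (proj₂ isχ))))
    module S = FiniteSum +-commutativeMonoid
    open RingProperties ring using (-‿involutive)

    ℕ→K-+ : ∀ a b → ℕ→K (a ℕ.+ b) ≈ ℕ→K a ⊕ᴷ ℕ→K b
    ℕ→K-+ zero    b = ≈-sym (+-identityˡ _)
    ℕ→K-+ (suc a) b = ≈-trans (+-congˡ (ℕ→K-+ a b)) (≈-sym (+-assoc _ _ _))

    cancel : ∀ x {a b} → x ⊕ᴷ a ≈ x ⊕ᴷ b → a ≈ b
    cancel x {a} {b} eq = begin
      a                    ≈⟨ ≈-sym (+-identityˡ a) ⟩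
      0# ⊕ᴷ a              ≈⟨ +-congʳ (≈-sym (-‿inverseˡ x)) ⟩
      (⊖ᴷ x ⊕ᴷ x) ⊕ᴷ a     ≈⟨ +-assoc _ _ _ ⟩
      ⊖ᴷ x ⊕ᴷ (x ⊕ᴷ a)     ≈⟨ +-congˡ eq ⟩
      ⊖ᴷ x ⊕ᴷ (x ⊕ᴷ b)     ≈⟨ ≈-sym (+-assoc _ _ _) ⟩
      (⊖ᴷ x ⊕ᴷ x) ⊕ᴷ b     ≈⟨ +-congʳ (-‿inverseˡ x) ⟩
      0# ⊕ᴷ b              ≈⟨ +-identityˡ b ⟩
      b                    ∎
      where open SetoidReasoning K-setoid

    ℕ→K-injective : ∀ a b → ℕ→K a ≈ ℕ→K b → a ≡ b
    ℕ→K-injective zero    zero    eq = refl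
    ℕ→K-injective zero    (suc b) eq = ⊥-elim (charZero b (≈-sym eq))
    ℕ→K-injective (suc a) zero    eq = ⊥-elim (charZero a eq)
    ℕ→K-injective (suc a) (suc b) eq = cong suc (ℕ→K-injective a b (cancel 1# eq))

    opposite : ∀ a b → ¬ (ℕ→K a ≈ ⊖ᴷ ℕ→K (suc b))
    opposite a b eq = charZero (b ℕ.+ a) (≈-trans (ℕ→K-+ (suc b) a) (≈-trans (+-congˡ eq) (-‿inverseʳ _)))

    -- Traces are compared in the field but the values of χ in ℤ; characteristic zero makes the
    -- passage injective.
    ℤ→K-injective : ∀ a b → ℤ→K a ≈ ℤ→K b → a ≡ b
    ℤ→K-injective (+ a)    (+ b)    eq = cong +_ (ℕ→K-injective a b eq)
    ℤ→K-injective (+ a)    -[1+ b ] eq = ⊥-elim (opposite a b eq)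
    ℤ→K-injective -[1+ a ] (+ b)    eq = ⊥-elim (opposite b a (≈-sym eq))
    ℤ→K-injective -[1+ a ] -[1+ b ] eq = cong -[1+_] (ℕP.suc-injective (ℕ→K-injective (suc a) (suc b)
      (≈-trans (≈-sym (-‿involutive _)) (≈-trans (-‿cong eq) (-‿involutive _)))))

    trace-comm : ∀ (A B : Mat d) → trace (A ·ᴹ B) ≈ trace (B ·ᴹ A)
    trace-comm A B = ≈-trans (S.∑-swap (allFin d) (allFin d) (λ i j → A i j ⊗ᴷ B j i))
      (S.∑-cong (allFin d) (λ j → S.∑-cong (allFin d) (λ i → *-comm (A i j) (B j i))))

    trace-cong : ∀ {A B : Mat d} → A ≈ᴹ B → trace A ≈ trace B
    trace-cong eq = S.∑-cong (allFin d) (λ i → eq i i)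

  χ-products : ∀ {w w′ h u} → IsProduct w h u → IsProduct w′ u h → χ w ≡ χ w′
  χ-products {w} {w′} {h} {u} p q = ℤ→K-injective (χ w) (χ w′) (begin
    ℤ→K (χ w)         ≈⟨ ≈-sym (ρ-trace w) ⟩
    trace (ρ w)       ≈⟨ trace-cong (ρ-product w h u p) ⟩
    trace (ρ h ·ᴹ ρ u) ≈⟨ trace-comm (ρ h) (ρ u) ⟩
    trace (ρ u ·ᴹ ρ h) ≈⟨ trace-cong (λ i j → ≈-sym (ρ-product w′ u h q i j)) ⟩
    trace (ρ w′)      ≈⟨ ρ-trace w′ ⟩
    ℤ→K (χ w′)        ∎)
    where open SetoidReasoning K-setoid

  -- The rearrangement of cycle types is lifted to the representatives, which pairs each cycle of
  -- `w` with a cycle of `w′` of the same length and sign.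
  χ-cycleType : ∀ w w′ → signedCycles w ↭ signedCycles w′ → χ w ≡ χ w′
  χ-cycleType w w′ perm with R , eq , permR ← PermP.↭-map-inv (cycleType w′) (subst (map (cycleType w′) (reps w′) ↭_) (signedCycles-reps w) (subst (_↭ signedCycles w) (signedCycles-reps w′) (Perm.↭-sym perm)))
    with zs , eq₁ , eq₂ , h ← zipOn (cycleType w) (cycleType w′) (reps w) R eq =
    χ-products {w} {w′} {C.h} {C.u} C.w≡hu C.w′≡uh
    where
    types : ∀ j → cycleType w (proj₁ (List.lookup zs j)) ≡ cycleType w′ (proj₂ (List.lookup zs j))
    types j = All.lookup h (∈P.∈-lookup {xs = zs} j)
    module C = Conjugate w w′ (listCycles w proj₁ zs (Perm.↭-reflexive eq₁)) (listCycles w′ proj₂ zs (subst (_↭ reps w′) (sym eq₂) (Perm.↭-sym permR)))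
      (λ j → cong proj₁ (types j)) (λ j → cong proj₂ (types j))

-- Pólya enumeration

mult : ∀ {ℓ} → Vec (ℕ × Sign) ℓ → Fin ℓ → ℕ
mult v a = proj₁ (Vec.lookup v a)

signAt : ∀ {ℓ} → Vec (ℕ × Sign) ℓ → Fin ℓ → Sign
signAt v a = proj₂ (Vec.lookup v a)

lowerAt : ∀ {ℓ} → Fin ℓ → ℕ → Vec (ℕ × Sign) ℓ → Vec (ℕ × Sign) ℓ
lowerAt a k v = Vec.updateAt v a (λ p → proj₁ p ∸ k , proj₂ p)

mult-lowerAt : ∀ {ℓ} (a : Fin ℓ) k v → mult (lowerAt a k v) a ≡ mult v a ∸ k
mult-lowerAt a k v = cong proj₁ (VecP.lookup∘updateAt a v)

mult-lowerAt-≢ : ∀ {ℓ} (a b : Fin ℓ) k v → b ≢ a → mult (lowerAt a k v) b ≡ mult v b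
mult-lowerAt-≢ a b k v b≢a = cong proj₁ (VecP.lookup∘updateAt′ b a b≢a v)

signAt-lowerAt : ∀ {ℓ} (a b : Fin ℓ) k v → signAt (lowerAt a k v) b ≡ signAt v b
signAt-lowerAt Fin.zero    Fin.zero    k (x ∷ v) = refl
signAt-lowerAt Fin.zero    (Fin.suc b) k (x ∷ v) = refl
signAt-lowerAt (Fin.suc a) Fin.zero    k (x ∷ v) = refl
signAt-lowerAt (Fin.suc a) (Fin.suc b) k (x ∷ v) = signAt-lowerAt a b k v

D-toList : ∀ {ℓ} k t g (v : Vec (ℕ × Sign) ℓ) →
  D k t g (toList v) ≡ ∑ (allFin ℓ) (λ a → ⟦ k ≤ᵇ mult v a ⟧ * sg t (signAt v a) * g (toList (lowerAt a k v)))
D-toList k t g [] = refl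
D-toList {suc ℓ} k t g ((d , e) ∷ v) =
  trans (cong (_+_ (⟦ k ≤ᵇ d ⟧ * sg t e * g ((d ∸ k , e) ∷ toList v))) (D-toList k t (λ β → g ((d , e) ∷ β)) v))
        (sym (∑-allFin-suc ℓ (λ a → ⟦ k ≤ᵇ mult ((d , e) ∷ v) a ⟧ * sg t (signAt ((d , e) ∷ v) a) * g (toList (lowerAt a k ((d , e) ∷ v))))))

at : ∀ {ℓ} → Fin ℓ → Fin ℓ → ℕ → ℕ
at b a k = if does (b Fin.≟ a) then k else 0

at-self : ∀ {ℓ} (a : Fin ℓ) k → at a a k ≡ k
at-self a k rewrite dec-true (a Fin.≟ a) refl = refl

at-≢ : ∀ {ℓ} {a b : Fin ℓ} k → b ≢ a → at a b k ≡ 0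
at-≢ {a = a} {b} k b≢a rewrite dec-false (a Fin.≟ b) (b≢a ∘ sym) = refl

-- `h` colours `q` objects of sizes `k`. The objects will be the cycles of a permutation, or the
-- points of [n], each of size one.
content : ∀ {ℓ q} → (Fin q → ℕ) → (Fin q → Fin ℓ) → Fin ℓ → ℕ
content {q = q} k h a = ∑ℕ (allFin q) (λ j → at (h j) a (k j))

content-cong : ∀ {ℓ q} (k : Fin q → ℕ) {h h′ : Fin q → Fin ℓ} → h ≗ h′ → content k h ≗ content k h′
content-cong {q = q} k eq a = ∑ℕ-cong (allFin q) (λ j → cong (λ b → at b a (k j)) (eq j))

HasContent : ∀ {ℓ q} → (Fin q → ℕ) → (Fin q → Fin ℓ) → Vec (ℕ × Sign) ℓ → Set
HasContent k h v = ∀ a → content k h a ≡ mult v a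

hasContent? : ∀ {ℓ q} (k : Fin q → ℕ) (h : Fin q → Fin ℓ) v → Dec (HasContent k h v)
hasContent? k h v = FinP.all? (λ a → content k h a ℕ.≟ mult v a)

signProd : ∀ {ℓ q} → (Fin q → Sign) → (Fin q → Fin ℓ) → Vec (ℕ × Sign) ℓ → ℤ
signProd {q = q} t h v = ∏ (allFin q) (λ j → sg (t j) (signAt v (h j)))

wordTerm : ∀ {ℓ q} → (Fin q → ℕ) → (Fin q → Sign) → Vec (ℕ × Sign) ℓ → (Fin q → Fin ℓ) → ℤ
wordTerm k t v h = 𝟙 (hasContent? k h v) * signProd t h v

wordTerm-cong : ∀ {ℓ q} k t (v : Vec (ℕ × Sign) ℓ) {h h′ : Fin q → Fin ℓ} → h ≗ h′ → wordTerm k t v h ≡ wordTerm k t v h′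
wordTerm-cong {q = q} k t v {h} {h′} eq = cong₂ _*_
  (𝟙-cong (hasContent? k h v) (hasContent? k h′ v) (λ p a → trans (sym (content-cong k eq a)) (p a)) (λ p a → trans (content-cong k eq a) (p a)))
  (∏-cong (allFin q) (λ j → cong (λ b → sg (t j) (signAt v b)) (eq j)))

hasContent-cons : ∀ {ℓ q} (k : Fin (suc q) → ℕ) a (h : Fin q → Fin ℓ) v →
  𝟙 (hasContent? k (cons a h) v) ≡ ⟦ k Fin.zero ≤ᵇ mult v a ⟧ * 𝟙 (hasContent? (k ∘ Fin.suc) h (lowerAt a (k Fin.zero) v))
hasContent-cons {ℓ} {q} k a h v = trans
  (𝟙-cong (hasContent? k (cons a h) v) (T? (k₀ ≤ᵇ mult v a) ×-dec hasContent? k′ h (lowerAt a k₀ v)) to from)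
  (𝟙-× (T? (k₀ ≤ᵇ mult v a)) (hasContent? k′ h (lowerAt a k₀ v)))
  where
  k₀ = k Fin.zero
  k′ = k ∘ Fin.suc
  split : ∀ b → content k (cons a h) b ≡ at a b k₀ ℕ.+ content k′ h b
  split b = ∑ℕ-allFin-suc q (λ j → at (cons a h j) b (k j))
  to : HasContent k (cons a h) v → T (k₀ ≤ᵇ mult v a) × HasContent k′ h (lowerAt a k₀ v)
  to p = ℕP.≤⇒≤ᵇ (subst (k₀ ≤_) eqa (ℕP.m≤m+n k₀ (content k′ h a))) , rest
    where
    eqa : k₀ ℕ.+ content k′ h a ≡ mult v a
    eqa = trans (cong (ℕ._+ content k′ h a) (sym (at-self a k₀))) (trans (sym (split a)) (p a))
    rest : HasContent k′ h (lowerAt a k₀ v)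
    rest b with b Fin.≟ a
    ... | yes refl = trans (sym (ℕP.m+n∸m≡n k₀ (content k′ h a))) (trans (cong (_∸ k₀) eqa) (sym (mult-lowerAt a k₀ v)))
    ... | no b≢a   = trans (cong (ℕ._+ content k′ h b) (sym (at-≢ k₀ b≢a))) (trans (sym (split b)) (trans (p b) (sym (mult-lowerAt-≢ a b k₀ v b≢a))))
  from : T (k₀ ≤ᵇ mult v a) × HasContent k′ h (lowerAt a k₀ v) → HasContent k (cons a h) v
  from (le , p) b with b Fin.≟ a
  ... | yes refl = trans (split a) (trans (cong₂ ℕ._+_ (at-self a k₀) (trans (p a) (mult-lowerAt a k₀ v))) (ℕP.m+[n∸m]≡n (ℕP.≤ᵇ⇒≤ k₀ _ le)))
  ... | no b≢a   = trans (split b) (trans (cong (ℕ._+ content k′ h b) (at-≢ k₀ b≢a)) (trans (p b) (mult-lowerAt-≢ a b k₀ v b≢a)))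

allZero-mult⁻ : ∀ {ℓ} (v : Vec (ℕ × Sign) ℓ) → T (allZero (toList v)) → ∀ a → 0 ≡ mult v a
allZero-mult⁻ ((zero , e) ∷ v) h Fin.zero    = refl
allZero-mult⁻ ((zero , e) ∷ v) h (Fin.suc a) = allZero-mult⁻ v h a

allZero-mult⁺ : ∀ {ℓ} (v : Vec (ℕ × Sign) ℓ) → (∀ a → 0 ≡ mult v a) → T (allZero (toList v))
allZero-mult⁺ []                  h = tt
allZero-mult⁺ ((zero , e) ∷ v)    h = allZero-mult⁺ v (h ∘ Fin.suc)
allZero-mult⁺ ((suc d , e) ∷ v)   h with () ← h Fin.zero

-- When the product is expanded, each power sum chooses one variable, that is, one entry of `v` as
-- its colour; exponents add up to the content and signs multiply.
P-words : ∀ {ℓ} q (ty : Fin q → ℕ × Sign) (v : Vec (ℕ × Sign) ℓ) →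
  P (List.tabulate ty) (toList v) ≡ ∑ (Words ℓ q) (wordTerm (proj₁ ∘ ty) (proj₂ ∘ ty) v)
P-words zero ty v = trans (𝟙-cong (T? (allZero (toList v))) (hasContent? (proj₁ ∘ ty) (λ ()) v) (allZero-mult⁻ v) (allZero-mult⁺ v))
  (sym (trans (ℤP.+-identityʳ _) (ℤP.*-identityʳ _)))
P-words {ℓ} (suc q) ty v = begin
  D k₀ t₀ (P (List.tabulate (ty ∘ Fin.suc))) (toList v)
    ≡⟨ D-toList k₀ t₀ (P (List.tabulate (ty ∘ Fin.suc))) v ⟩
  ∑ (allFin ℓ) (λ a → ⟦ k₀ ≤ᵇ mult v a ⟧ * sg t₀ (signAt v a) * P (List.tabulate (ty ∘ Fin.suc)) (toList (lowerAt a k₀ v)))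
    ≡⟨ ∑-cong (allFin ℓ) (λ a → cong (_*_ (⟦ k₀ ≤ᵇ mult v a ⟧ * sg t₀ (signAt v a))) (P-words q (ty ∘ Fin.suc) (lowerAt a k₀ v))) ⟩
  ∑ (allFin ℓ) (λ a → ⟦ k₀ ≤ᵇ mult v a ⟧ * sg t₀ (signAt v a) * ∑ (Words ℓ q) (wordTerm k′ t′ (lowerAt a k₀ v)))
    ≡⟨ ∑-cong (allFin ℓ) (λ a → sym (∑-*ˡ (⟦ k₀ ≤ᵇ mult v a ⟧ * sg t₀ (signAt v a)) (Words ℓ q) (wordTerm k′ t′ (lowerAt a k₀ v)))) ⟩
  ∑ (allFin ℓ) (λ a → ∑ (Words ℓ q) (λ h → ⟦ k₀ ≤ᵇ mult v a ⟧ * sg t₀ (signAt v a) * wordTerm k′ t′ (lowerAt a k₀ v) h))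
    ≡⟨ ∑-cong (allFin ℓ) (λ a → ∑-cong (Words ℓ q) (term a)) ⟩
  ∑ (allFin ℓ) (λ a → ∑ (Words ℓ q) (λ h → wordTerm (proj₁ ∘ ty) (proj₂ ∘ ty) v (cons a h)))
    ≡⟨ ∑-swap (allFin ℓ) (Words ℓ q) (λ a h → wordTerm (proj₁ ∘ ty) (proj₂ ∘ ty) v (cons a h)) ⟩
  ∑ (Words ℓ q) (λ h → ∑ (allFin ℓ) (λ a → wordTerm (proj₁ ∘ ty) (proj₂ ∘ ty) v (cons a h)))
    ≡⟨ sym (∑-allFuns-suc (allFin ℓ) q (wordTerm (proj₁ ∘ ty) (proj₂ ∘ ty) v) (wordTerm-cong (proj₁ ∘ ty) (proj₂ ∘ ty) v)) ⟩
  ∑ (Words ℓ (suc q)) (wordTerm (proj₁ ∘ ty) (proj₂ ∘ ty) v) ∎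
  where
  open ≡-Reasoning
  k₀ = proj₁ (ty Fin.zero)
  t₀ = proj₂ (ty Fin.zero)
  k′ = λ j → proj₁ (ty (Fin.suc j))
  t′ = λ j → proj₂ (ty (Fin.suc j))
  alg : ∀ a b c d → a * b * (c * d) ≡ (a * c) * (b * d)
  alg = solve-∀
  term : ∀ a h → ⟦ k₀ ≤ᵇ mult v a ⟧ * sg t₀ (signAt v a) * wordTerm k′ t′ (lowerAt a k₀ v) h ≡ wordTerm (proj₁ ∘ ty) (proj₂ ∘ ty) v (cons a h)
  term a h = trans (alg ⟦ k₀ ≤ᵇ mult v a ⟧ (sg t₀ (signAt v a)) (𝟙 (hasContent? k′ h (lowerAt a k₀ v))) (signProd t′ h (lowerAt a k₀ v)))
    (cong₂ _*_ (sym (hasContent-cons (proj₁ ∘ ty) a h v))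
      (trans (cong (_*_ (sg t₀ (signAt v a))) (∏-cong (allFin q) (λ j → cong (sg (t′ j)) (signAt-lowerAt a (h j) k₀ v))))
             (sym (∏-allFin-suc q (λ j → sg (proj₂ (ty j)) (signAt v (cons a h j)))))))

_≗?_ : ∀ {m ℓ} (f g : Fin m → Fin ℓ) → Dec (f ≗ g)
f ≗? g = FinP.all? (λ i → f i Fin.≟ g i)

𝟙-≗-cons : ∀ {m ℓ} (f : Fin (suc m) → Fin ℓ) a g → 𝟙 (f ≗? cons a g) ≡ 𝟙 (f Fin.zero Fin.≟ a) * 𝟙 ((f ∘ Fin.suc) ≗? g)
𝟙-≗-cons f a g = trans (𝟙-cong (f ≗? cons a g) ((f Fin.zero Fin.≟ a) ×-dec ((f ∘ Fin.suc) ≗? g))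
    (λ p → p Fin.zero , p ∘ Fin.suc) (λ { (p , q) Fin.zero → p ; (p , q) (Fin.suc i) → q i }))
  (𝟙-× (f Fin.zero Fin.≟ a) ((f ∘ Fin.suc) ≗? g))

∑-allFuns-𝟙 : ∀ {ℓ} m (f : Fin m → Fin ℓ) (Φ : (Fin m → Fin ℓ) → ℤ) → (∀ {g g′} → g ≗ g′ → Φ g ≡ Φ g′) →
  ∑ (Words ℓ m) (λ g → 𝟙 (f ≗? g) * Φ g) ≡ Φ f
∑-allFuns-𝟙 zero f Φ Φ-cong = trans (ℤP.+-identityʳ _) (trans (ℤP.*-identityˡ _) (Φ-cong (λ ())))
∑-allFuns-𝟙 {ℓ} (suc m) f Φ Φ-cong = begin
  ∑ (Words ℓ (suc m)) (λ g → 𝟙 (f ≗? g) * Φ g)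
    ≡⟨ ∑-allFuns-suc (allFin ℓ) m (λ g → 𝟙 (f ≗? g) * Φ g) (λ {g} {g′} eq → cong₂ _*_
         (𝟙-cong (f ≗? g) (f ≗? g′) (λ p i → trans (p i) (eq i)) (λ p i → trans (p i) (sym (eq i)))) (Φ-cong eq)) ⟩
  ∑ (Words ℓ m) (λ g → ∑ (allFin ℓ) (λ a → 𝟙 (f ≗? cons a g) * Φ (cons a g)))
    ≡⟨ ∑-cong (Words ℓ m) inner ⟩
  ∑ (Words ℓ m) (λ g → 𝟙 ((f ∘ Fin.suc) ≗? g) * Φ (cons (f Fin.zero) g))
    ≡⟨ ∑-allFuns-𝟙 m (f ∘ Fin.suc) (λ g → Φ (cons (f Fin.zero) g)) (λ eq → Φ-cong (λ { Fin.zero → refl ; (Fin.suc i) → eq i })) ⟩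
  Φ (cons (f Fin.zero) (f ∘ Fin.suc))
    ≡⟨ Φ-cong (λ { Fin.zero → refl ; (Fin.suc i) → refl }) ⟩
  Φ f ∎
  where
  open ≡-Reasoning
  alg : ∀ a b c → a * b * c ≡ a * (b * c)
  alg = solve-∀
  inner : ∀ g → ∑ (allFin ℓ) (λ a → 𝟙 (f ≗? cons a g) * Φ (cons a g)) ≡ 𝟙 ((f ∘ Fin.suc) ≗? g) * Φ (cons (f Fin.zero) g)
  inner g = trans (∑-cong (allFin ℓ) (λ a → trans (cong (_* Φ (cons a g)) (𝟙-≗-cons f a g))
                      (alg (𝟙 (f Fin.zero Fin.≟ a)) (𝟙 ((f ∘ Fin.suc) ≗? g)) (Φ (cons a g)))))
                  (∑-allFin-𝟙 ℓ (f Fin.zero) (λ a → 𝟙 ((f ∘ Fin.suc) ≗? g) * Φ (cons a g)))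

sg-·ˢ : ∀ s t e → sg (s ·ˢ t) e ≡ sg s e * sg t e
sg-·ˢ ⊕ t e = sym (ℤP.*-identityˡ _)
sg-·ˢ ⊖ ⊕ e = sym (ℤP.*-identityʳ _)
sg-·ˢ ⊖ ⊖ ⊕ = refl
sg-·ˢ ⊖ ⊖ ⊖ = refl

∏-sg : {A : Set} (f : A → Sign) (xs : List A) (e : Sign) → ∏ xs (λ x → sg (f x) e) ≡ sg (foldr _·ˢ_ ⊕ (map f xs)) e
∏-sg f []       e = refl
∏-sg f (x ∷ xs) e = trans (cong (_*_ (sg (f x) e)) (∏-sg f xs e)) (sym (sg-·ˢ (f x) _ e))

∑ℕ-at-1 : ∀ {ℓ} {A : Set} (b a : Fin ℓ) (xs : List A) → ∑ℕ xs (λ _ → at b a 1) ≡ at b a (length xs)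
∑ℕ-at-1 b a xs with does (b Fin.≟ a)
... | true  = go xs
  where
  go : {A : Set} (xs : List A) → ∑ℕ xs (λ _ → 1) ≡ length xs
  go []       = refl
  go (x ∷ xs) = cong suc (go xs)
... | false = ∑ℕ-0 xs (λ _ → refl)

one : ∀ {q} → Fin q → ℕ
one _ = 1

invariant? : ∀ {n ℓ} (π : Fin n → Fin n) (f : Fin n → Fin ℓ) → Dec ((f ∘ π) ≗ f)
invariant? π f = (f ∘ π) ≗? f

module _ {n : ℕ} (w : SPerm n) {q : ℕ} {root : Fin q → Fin n} (c : Cycles w q root) where
  open Cycles c

  private
    π = perm w

  content-index : ∀ {ℓ} (h : Fin q → Fin ℓ) a → content one (h ∘ index) a ≡ content (λ j → orbitLen π (root j)) h a
  content-index h a = begin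
    ∑ℕ (allFin n) φ                                 ≡⟨ ∑ℕ-↭ φ (Perm.↭-sym (cycles-↭ w c)) ⟩
    ∑ℕ (concatMap (cycle w c) (allFin q)) φ         ≡⟨ ∑ℕ-concatMap (cycle w c) (allFin q) φ ⟩
    ∑ℕ (allFin q) (λ j → ∑ℕ (cycle w c j) φ)        ≡⟨ ∑ℕ-cong (allFin q) inner ⟩
    ∑ℕ (allFin q) (λ j → at (h j) a (orbitLen π (root j))) ∎
    where
    open ≡-Reasoning
    φ : Fin n → ℕ
    φ i = at (h (index i)) a 1
    inner : ∀ j → ∑ℕ (cycle w c j) φ ≡ at (h j) a (orbitLen π (root j))
    inner j = trans (∑ℕ-map (λ t → iter t π (root j)) (upTo (orbitLen π (root j))) φ)
      (trans (∑ℕ-cong-∈ (upTo (orbitLen π (root j))) (λ {t} t∈ → cong (λ k → at (h k) a 1) (proj₁ (unique j t (∈P.∈-upTo⁻ t∈)))))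
      (trans (∑ℕ-at-1 (h j) a (upTo (orbitLen π (root j)))) (cong (at (h j) a) (ListP.length-upTo (orbitLen π (root j))))))

  signProd-index : ∀ {ℓ} (h : Fin q → Fin ℓ) v → signProd (sign w) (h ∘ index) v ≡ signProd (λ j → orbitSign w (root j)) h v
  signProd-index h v = begin
    ∏ (allFin n) φ                                 ≡⟨ ∏-↭ φ (Perm.↭-sym (cycles-↭ w c)) ⟩
    ∏ (concatMap (cycle w c) (allFin q)) φ         ≡⟨ ∏-concatMap (cycle w c) (allFin q) φ ⟩
    ∏ (allFin q) (λ j → ∏ (cycle w c j) φ)         ≡⟨ ∏-cong (allFin q) inner ⟩
    ∏ (allFin q) (λ j → sg (orbitSign w (root j)) (signAt v (h j))) ∎
    where
    open ≡-Reasoning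
    φ : Fin n → ℤ
    φ i = sg (sign w i) (signAt v (h (index i)))
    inner : ∀ j → ∏ (cycle w c j) φ ≡ sg (orbitSign w (root j)) (signAt v (h j))
    inner j = trans (∏-map (λ t → iter t π (root j)) (upTo (orbitLen π (root j))) φ)
      (trans (∏-cong-∈ (upTo (orbitLen π (root j))) (λ {t} t∈ → cong (λ k → sg (sign w (iter t π (root j))) (signAt v (h k))) (proj₁ (unique j t (∈P.∈-upTo⁻ t∈)))))
             (∏-sg (λ t → sign w (iter t π (root j))) (upTo (orbitLen π (root j))) (signAt v (h j))))

  -- An invariant colouring is constant on cycles, hence equal to `h ∘ index` for the unique
  -- `h = f ∘ root`. The bijection is carried out by inserting the indicator of `f ∘ root ≗ h` and
  -- exchanging the sums.
  ∑-invariant : ∀ {ℓ} (Φ : (Fin n → Fin ℓ) → ℤ) → (∀ {g g′} → g ≗ g′ → Φ g ≡ Φ g′) →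
    ∑ (Words ℓ n) (λ f → 𝟙 (invariant? π f) * Φ f) ≡ ∑ (Words ℓ q) (λ h → Φ (h ∘ index))
  ∑-invariant {ℓ} Φ Φ-cong = begin
    ∑ fs (λ f → 𝟙 (invariant? π f) * Φ f)
      ≡⟨ ∑-cong fs (λ f → sym (∑-allFuns-𝟙 q (f ∘ root) (λ _ → 𝟙 (invariant? π f) * Φ f) (λ _ → refl))) ⟩
    ∑ fs (λ f → ∑ hs (λ h → 𝟙 ((f ∘ root) ≗? h) * (𝟙 (invariant? π f) * Φ f)))
      ≡⟨ ∑-swap fs hs (λ f h → 𝟙 ((f ∘ root) ≗? h) * (𝟙 (invariant? π f) * Φ f)) ⟩
    ∑ hs (λ h → ∑ fs (λ f → 𝟙 ((f ∘ root) ≗? h) * (𝟙 (invariant? π f) * Φ f)))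
      ≡⟨ ∑-cong hs (λ h → ∑-cong fs (λ f → trans (sym (ℤP.*-assoc (𝟙 ((f ∘ root) ≗? h)) (𝟙 (invariant? π f)) (Φ f)))
           (cong (_* Φ f) (trans (sym (𝟙-× ((f ∘ root) ≗? h) (invariant? π f)))
             (𝟙-cong (((f ∘ root) ≗? h) ×-dec invariant? π f) ((h ∘ index) ≗? f) (to f h) (from f h)))))) ⟩
    ∑ hs (λ h → ∑ fs (λ f → 𝟙 ((h ∘ index) ≗? f) * Φ f))
      ≡⟨ ∑-cong hs (λ h → ∑-allFuns-𝟙 n (h ∘ index) Φ Φ-cong) ⟩
    ∑ hs (λ h → Φ (h ∘ index)) ∎
    where
    open ≡-Reasoning
    fs = Words ℓ n
    hs = Words ℓ q
    along : ∀ {f : Fin n → Fin ℓ} → (f ∘ π) ≗ f → ∀ t r → f (iter t π r) ≡ f r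
    along p zero    r = refl
    along p (suc t) r = trans (p _) (along p t r)
    to : ∀ f h → ((f ∘ root) ≗ h) × ((f ∘ π) ≗ f) → (h ∘ index) ≗ f
    to f h (p , s) i = trans (sym (p (index i))) (trans (sym (along s (time i) (root (index i)))) (cong f (locate i)))
    from : ∀ f h → (h ∘ index) ≗ f → ((f ∘ root) ≗ h) × ((f ∘ π) ≗ f)
    from f h p = (λ j → trans (sym (p (root j))) (cong h (proj₁ (unique j 0 (Orbits.len-pos π (isInjective⁻ π (inj w)) (root j)))))) ,
                 (λ i → trans (sym (p (π i))) (trans (cong h (index-perm w c i)) (p i)))

standardCycles : ∀ {n} (w : SPerm n) → Cycles w (length (reps w)) (List.lookup (reps w))
standardCycles w = listCycles w id (reps w) (Perm.↭-reflexive (ListP.map-id (reps w)))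

signedCycles-tabulate : ∀ {n} (w : SPerm n) → signedCycles w ≡ List.tabulate (λ j → cycleType w (List.lookup (reps w) j))
signedCycles-tabulate w = trans (signedCycles-reps w) (trans (cong (map (cycleType w)) (sym (ListP.tabulate-lookup (reps w)))) (ListP.map-tabulate (List.lookup (reps w)) (cycleType w)))

-- The coefficients of the power sum of w count the w-invariant colourings of [n], with signs.
P-invariant : ∀ {n ℓ} (w : SPerm n) (v : Vec (ℕ × Sign) ℓ) →
  P (signedCycles w) (toList v) ≡ ∑ (Words ℓ n) (λ f → 𝟙 (invariant? (perm w) f) * wordTerm one (sign w) v f)
P-invariant {n} {ℓ} w v = begin
  P (signedCycles w) (toList v)
    ≡⟨ cong (λ C → P C (toList v)) (signedCycles-tabulate w) ⟩
  P (List.tabulate ty) (toList v)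
    ≡⟨ P-words q ty v ⟩
  ∑ (Words ℓ q) (wordTerm (proj₁ ∘ ty) (proj₂ ∘ ty) v)
    ≡⟨ ∑-cong (Words ℓ q) (λ h → cong₂ _*_
         (𝟙-cong (hasContent? (proj₁ ∘ ty) h v) (hasContent? one (h ∘ index) v)
           (λ p a → trans (content-index w c h a) (p a)) (λ p a → trans (sym (content-index w c h a)) (p a)))
         (sym (signProd-index w c h v))) ⟩
  ∑ (Words ℓ q) (λ h → wordTerm one (sign w) v (h ∘ index))
    ≡⟨ sym (∑-invariant w c (wordTerm one (sign w) v) (wordTerm-cong one (sign w) v)) ⟩
  ∑ (Words ℓ n) (λ f → 𝟙 (invariant? (perm w) f) * wordTerm one (sign w) v f) ∎
  where
  open ≡-Reasoning
  c = standardCycles w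
  open Cycles c
  q = length (reps w)
  ty : Fin q → ℕ × Sign
  ty j = cycleType w (List.lookup (reps w) j)

-- With a single colour the content is the total size, so the claim is an instance of
-- `content-index`.
signedCycles-size : ∀ {n} (w : SPerm n) → size (signedCycles w) ≡ n
signedCycles-size {n} w = begin
  size (signedCycles w)                            ≡⟨ cong size (signedCycles-tabulate w) ⟩
  size (List.tabulate ty)                          ≡⟨ cong (λ l → foldr ℕ._+_ 0 l) (trans (ListP.map-tabulate ty proj₁) (sym (ListP.map-tabulate id (proj₁ ∘ ty)))) ⟩
  ∑ℕ (allFin q) (proj₁ ∘ ty)                       ≡⟨ ∑ℕ-cong (allFin q) (λ j → sym (at-self (Fin.zero {0}) (proj₁ (ty j)))) ⟩
  content (proj₁ ∘ ty) (λ _ → Fin.zero {0}) Fin.zero ≡⟨ sym (content-index w (standardCycles w) (λ _ → Fin.zero {0}) Fin.zero) ⟩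
  content {1} {n} one (λ _ → Fin.zero) Fin.zero    ≡⟨ ∑ℕ-at-1 (Fin.zero {0}) Fin.zero (allFin n) ⟩
  length (allFin n)                                ≡⟨ ListP.length-tabulate id ⟩
  n                                                ∎
  where
  open ≡-Reasoning
  q = length (reps w)
  ty : Fin q → ℕ × Sign
  ty j = cycleType w (List.lookup (reps w) j)

-- Summation over B_n

withSign : ∀ n (π : Fin n → Fin n) → Dec (T (isInjective π)) → List (SPerm n)
withSign n π (yes p) = map (λ ε → sperm π ε p) (allFunsTo (⊕ ∷ ⊖ ∷ []) n)
withSign n π (no _)  = []

-- The placeholder stands for the local function of allSPerm.
mutual
  allSPerm-withSign : ∀ n → allSPerm n ≡ concatMap (λ π → withSign n π (T? (isInjective π))) (Words n n)
  allSPerm-withSign n = ListP.concatMap-cong (build-withSign n) (Words n n)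

  build-withSign : ∀ n (π : Fin n → Fin n) → _ ≡ withSign n π (T? (isInjective π))
  build-withSign n π with T? (isInjective π)
  ... | yes _ = refl
  ... | no _  = refl

∑-allSPerm : ∀ n (Y : (Fin n → Fin n) → (Fin n → Sign) → ℤ) →
  ∑ (allSPerm n) (λ w → Y (perm w) (sign w)) ≡
  ∑ (Words n n) (λ π → ⟦ isInjective π ⟧ * ∑ (allFunsTo (⊕ ∷ ⊖ ∷ []) n) (Y π))
∑-allSPerm n Y = trans (cong (λ l → ∑ l (λ w → Y (perm w) (sign w))) (allSPerm-withSign n))
  (trans (∑-concatMap (λ π → withSign n π (T? (isInjective π))) (Words n n) (λ w → Y (perm w) (sign w)))
         (∑-cong (Words n n) (λ π → signs π (T? (isInjective π)))))
  where
  signs : ∀ π (d : Dec (T (isInjective π))) → ∑ (withSign n π d) (λ w → Y (perm w) (sign w)) ≡ 𝟙 d * ∑ (allFunsTo (⊕ ∷ ⊖ ∷ []) n) (Y π)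
  signs π (yes p) = trans (∑-map (λ ε → sperm π ε p) (allFunsTo (⊕ ∷ ⊖ ∷ []) n) (λ w → Y (perm w) (sign w))) (sym (ℤP.*-identityˡ _))
  signs π (no _)  = refl

-- Distributivity over the positions. A position with a y colour gets the factor 1 - 1, which is why
-- only monomials in x survive the sum over B_n.
∑-signs : ∀ n (x : Fin n → Sign) → ∑ (allFunsTo (⊕ ∷ ⊖ ∷ []) n) (λ ε → ∏ (allFin n) (λ i → sg (ε i) (x i))) ≡ ∏ (allFin n) (λ i → + 1 + sgnℤ (x i))
∑-signs zero    x = refl
∑-signs (suc n) x = begin
  ∑ (allFunsTo S (suc n)) (λ ε → ∏ (allFin (suc n)) (λ i → sg (ε i) (x i)))
    ≡⟨ ∑-allFuns-suc S n (λ ε → ∏ (allFin (suc n)) (λ i → sg (ε i) (x i))) (λ eq → ∏-cong (allFin (suc n)) (λ i → cong (λ s → sg s (x i)) (eq i))) ⟩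
  ∑ (allFunsTo S n) (λ ε → ∑ S (λ s → ∏ (allFin (suc n)) (λ i → sg (cons s ε i) (x i))))
    ≡⟨ ∑-cong (allFunsTo S n) (λ ε → ∑-cong S (λ s → ∏-allFin-suc n (λ i → sg (cons s ε i) (x i)))) ⟩
  ∑ (allFunsTo S n) (λ ε → ∑ S (λ s → sg s (x Fin.zero) * rest ε))
    ≡⟨ ∑-cong (allFunsTo S n) (λ ε → alg (sgnℤ (x Fin.zero)) (rest ε)) ⟩
  ∑ (allFunsTo S n) (λ ε → (+ 1 + sgnℤ (x Fin.zero)) * rest ε)
    ≡⟨ ∑-*ˡ (+ 1 + sgnℤ (x Fin.zero)) (allFunsTo S n) rest ⟩
  (+ 1 + sgnℤ (x Fin.zero)) * ∑ (allFunsTo S n) rest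
    ≡⟨ cong (_*_ (+ 1 + sgnℤ (x Fin.zero))) (∑-signs n (x ∘ Fin.suc)) ⟩
  (+ 1 + sgnℤ (x Fin.zero)) * ∏ (allFin n) (λ i → + 1 + sgnℤ (x (Fin.suc i)))
    ≡⟨ sym (∏-allFin-suc n (λ i → + 1 + sgnℤ (x i))) ⟩
  ∏ (allFin (suc n)) (λ i → + 1 + sgnℤ (x i)) ∎
  where
  open ≡-Reasoning
  S = ⊕ ∷ ⊖ ∷ []
  rest : (Fin n → Sign) → ℤ
  rest ε = ∏ (allFin n) (λ i → sg (ε i) (x (Fin.suc i)))
  alg : ∀ a b → + 1 * b + (a * b + + 0) ≡ (+ 1 + a) * b
  alg = solve-∀

allPlus⁻ : ∀ {ℓ} (v : Vec (ℕ × Sign) ℓ) → T (allPlus (toList v)) → ∀ a → 1 ≤ mult v a → signAt v a ≡ ⊕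
allPlus⁻ ((k , ⊕) ∷ v)    h Fin.zero    p = refl
allPlus⁻ ((zero , ⊖) ∷ v) h Fin.zero    ()
allPlus⁻ ((k , ⊕) ∷ v)    h (Fin.suc a) p = allPlus⁻ v h a p
allPlus⁻ ((zero , ⊖) ∷ v) h (Fin.suc a) p = allPlus⁻ v h a p

not-allPlus : ∀ {ℓ} (v : Vec (ℕ × Sign) ℓ) → allPlus (toList v) ≡ false → ∃ λ a → (1 ≤ mult v a) × (signAt v a ≡ ⊖)
not-allPlus ((k , ⊕) ∷ v)     h = let (a , p , q) = not-allPlus v h in Fin.suc a , p , q
not-allPlus ((zero , ⊖) ∷ v)  h = let (a , p , q) = not-allPlus v h in Fin.suc a , p , q
not-allPlus ((suc k , ⊖) ∷ v) h = Fin.zero , s≤s z≤n , refl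

∏-zero : ∀ n (x : Fin n → ℤ) i → x i ≡ + 0 → ∏ (allFin n) x ≡ + 0
∏-zero (suc n) x Fin.zero    eq = trans (∏-allFin-suc n x) (cong (_* ∏ (allFin n) (x ∘ Fin.suc)) eq)
∏-zero (suc n) x (Fin.suc i) eq = trans (∏-allFin-suc n x) (trans (cong (_*_ (x Fin.zero)) (∏-zero n (x ∘ Fin.suc) i eq)) (ℤP.*-zeroʳ (x Fin.zero)))

∏-two : ∀ n (x : Fin n → ℤ) → (∀ i → x i ≡ + 2) → ∏ (allFin n) x ≡ + (2 ℕ.^ n)
∏-two zero    x h = refl
∏-two (suc n) x h = trans (∏-allFin-suc n x) (trans (cong₂ _*_ (h Fin.zero) (∏-two n (x ∘ Fin.suc) (h ∘ Fin.suc))) (sym (ℤP.pos-* 2 (2 ℕ.^ n))))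

occurs : ∀ {ℓ} n (f : Fin n → Fin ℓ) a → 1 ≤ content one f a → ∃ λ i → f i ≡ a
occurs zero f a ()
occurs (suc n) f a h = search-from (f Fin.zero Fin.≟ a)
  where
  search-from : Dec (f Fin.zero ≡ a) → ∃ λ i → f i ≡ a
  search-from (yes p) = Fin.zero , p
  search-from (no ¬p) = let (i , eq) = occurs n (f ∘ Fin.suc) a (subst (1 ≤_) (trans (∑ℕ-allFin-suc n (λ j → at (f j) a 1))
                              (cong (ℕ._+ content one (f ∘ Fin.suc) a) (at-≢ 1 (¬p ∘ sym)))) h)
                        in Fin.suc i , eq

content-at : ∀ {ℓ} n (f : Fin n → Fin ℓ) i → 1 ≤ content one f (f i)
content-at (suc n) f Fin.zero    = subst (1 ≤_) (sym (trans (∑ℕ-allFin-suc n (λ j → at (f j) (f Fin.zero) 1)) (cong (ℕ._+ content one (f ∘ Fin.suc) (f Fin.zero)) (at-self (f Fin.zero) 1)))) (s≤s z≤n)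
content-at (suc n) f (Fin.suc i) = subst (1 ≤_) (sym (∑ℕ-allFin-suc n (λ j → at (f j) (f (Fin.suc i)) 1))) (ℕP.≤-trans (content-at n (f ∘ Fin.suc) i) (ℕP.m≤n+m _ _))

signs-allPlus : ∀ {ℓ} n (f : Fin n → Fin ℓ) (v : Vec (ℕ × Sign) ℓ) → HasContent one f v →
  ∏ (allFin n) (λ i → + 1 + sgnℤ (signAt v (f i))) ≡ + (2 ℕ.^ n) * ⟦ allPlus (toList v) ⟧
signs-allPlus n f v p with allPlus (toList v) in eq
... | true  = trans (∏-two n _ (λ i → cong (λ s → + 1 + sgnℤ s) (allPlus⁻ v (subst T (sym eq) tt) (f i) (subst (1 ≤_) (p (f i)) (content-at n f i)))))
                    (sym (ℤP.*-identityʳ _))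
... | false with a , pos , neg ← not-allPlus v eq with i , refl ← occurs n f a (subst (1 ≤_) (sym (p a)) pos) =
  trans (∏-zero n _ i (cong (λ s → + 1 + sgnℤ s) neg)) (sym (ℤP.*-zeroʳ (+ (2 ℕ.^ n))))

-- Counting injections with prescribed colours

occ : ∀ {ℓ m} → (Fin m → Fin ℓ) → Fin ℓ → ℤ
occ {m = m} f a = ∑ (allFin m) (λ i → 𝟙 (f i Fin.≟ a))

occ-content : ∀ {ℓ m} (f : Fin m → Fin ℓ) a → occ f a ≡ + content one f a
occ-content {m = m} f a = trans (∑-cong (allFin m) (λ i → single (f i))) (∑-pos (allFin m) (λ i → at (f i) a 1))
  where
  single : ∀ b → 𝟙 (b Fin.≟ a) ≡ + at b a 1
  single b with does (b Fin.≟ a)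
  ... | true  = refl
  ... | false = refl

inj? : ∀ {m n} (π : Fin m → Fin n) → Dec (Injective′ π)
inj? π = FinP.all? (λ i → FinP.all? (λ j → (π i Fin.≟ π j) →-dec (i Fin.≟ j)))

occ-absent : ∀ {ℓ m} (f : Fin m → Fin ℓ) a → (∀ i → f i ≢ a) → occ f a ≡ + 0
occ-absent {m = m} f a h = ∑-ε (allFin m) (λ i → 𝟙-no (f i Fin.≟ a) (h i))

occ-inj : ∀ {ℓ m} (f : Fin m → Fin ℓ) → Injective′ f → ∀ i → occ f (f i) ≡ + 1
occ-inj {m = m} f f-inj i = trans (∑-cong (allFin m) (λ j → trans (𝟙-cong (f j Fin.≟ f i) (i Fin.≟ j) (λ e → sym (f-inj j i e)) (λ { refl → refl })) (sym (ℤP.*-identityʳ _))))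
  (∑-allFin-𝟙 m i (λ _ → + 1))

𝟙-inj-cons : ∀ {m n} a (π : Fin m → Fin n) → 𝟙 (inj? (cons a π)) ≡ 𝟙 (inj? π) * (+ 1 - occ π a)
𝟙-inj-cons {m} {n} a π = go (inj? π) (FinP.any? (λ i → π i Fin.≟ a))
  where
  tail-inj : Injective′ (cons a π) → Injective′ π
  tail-inj h i j eq = FinP.suc-injective (h (Fin.suc i) (Fin.suc j) eq)
  go : (d : Dec (Injective′ π)) → Dec (∃ λ i → π i ≡ a) → 𝟙 (inj? (cons a π)) ≡ 𝟙 d * (+ 1 - occ π a)
  go (no ¬p) _ = 𝟙-no (inj? (cons a π)) (¬p ∘ tail-inj)
  go (yes p) (yes (i , refl)) = trans (𝟙-no (inj? (cons (π i) π)) (λ h → case (h Fin.zero (Fin.suc i) refl)))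
                                      (sym (cong (λ z → + 1 * (+ 1 - z)) (occ-inj π p i)))
    where
    case : Fin.zero ≢ Fin.suc i
    case ()
  go (yes p) (no ¬q) = trans (𝟙-yes (inj? (cons a π)) all-inj) (sym (cong (λ z → + 1 * (+ 1 - z)) (occ-absent π a (λ i eq → ¬q (i , eq)))))
    where
    all-inj : Injective′ (cons a π)
    all-inj Fin.zero    Fin.zero    eq = refl
    all-inj Fin.zero    (Fin.suc j) eq = ⊥-elim (¬q (j , sym eq))
    all-inj (Fin.suc i) Fin.zero    eq = ⊥-elim (¬q (i , eq))
    all-inj (Fin.suc i) (Fin.suc j) eq = cong Fin.suc (p i j eq)

-- The number of injections π with f ∘ π = f′, as a product over the positions of f′.
placements : ∀ {ℓ} m → (Fin ℓ → ℤ) → (Fin m → Fin ℓ) → ℤ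
placements zero    u f′ = + 1
placements (suc m) u f′ = (u (f′ Fin.zero) - occ (f′ ∘ Fin.suc) (f′ Fin.zero)) * placements m u (f′ ∘ Fin.suc)

placements-cong : ∀ {ℓ} m {u u′ : Fin ℓ → ℤ} f → u ≗ u′ → placements m u f ≡ placements m u′ f
placements-cong zero    f eq = refl
placements-cong (suc m) f eq = cong₂ (λ a b → (a - occ (f ∘ Fin.suc) (f Fin.zero)) * b) (eq _) (placements-cong m (f ∘ Fin.suc) eq)

placements-congᶠ : ∀ {ℓ} m (u : Fin ℓ → ℤ) {f f′} → f ≗ f′ → placements m u f ≡ placements m u f′
placements-congᶠ zero    u eq = refl
placements-congᶠ (suc m) u {f} {f′} eq = cong₂ (λ a b → a * b)
  (cong₂ _-_ (cong u (eq Fin.zero)) (∑-cong (allFin m) (λ i → cong₂ (λ a b → 𝟙 (a Fin.≟ b)) (eq (Fin.suc i)) (eq Fin.zero))))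
  (placements-congᶠ m u (eq ∘ Fin.suc))

-- The first value must be a point of colour `f′ 0` not taken by the later ones. The number of taken
-- points of that colour can be read off from `f′` and is the same for all admissible `π`, so the
-- count is a product.
injections : ∀ {ℓ n} m (f : Fin n → Fin ℓ) (f′ : Fin m → Fin ℓ) →
  ∑ (Words n m) (λ π → 𝟙 (inj? π) * 𝟙 ((f ∘ π) ≗? f′)) ≡ placements m (occ f) f′
injections zero    f f′ = refl
injections {ℓ} {n} (suc m) f f′ = begin
  ∑ (Words n (suc m)) (λ π → 𝟙 (inj? π) * 𝟙 ((f ∘ π) ≗? f′))
    ≡⟨ ∑-allFuns-suc (allFin n) m (λ π → 𝟙 (inj? π) * 𝟙 ((f ∘ π) ≗? f′)) (λ {π} {π′} eq → cong₂ _*_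
         (𝟙-cong (inj? π) (inj? π′) (λ h i j e → h i j (trans (eq i) (trans e (sym (eq j))))) (λ h i j e → h i j (trans (sym (eq i)) (trans e (eq j)))))
         (𝟙-cong ((f ∘ π) ≗? f′) ((f ∘ π′) ≗? f′) (λ h i → trans (cong f (sym (eq i))) (h i)) (λ h i → trans (cong f (eq i)) (h i)))) ⟩
  ∑ πs (λ π → ∑ (allFin n) (λ a → 𝟙 (inj? (cons a π)) * 𝟙 ((f ∘ cons a π) ≗? f′)))
    ≡⟨ ∑-cong πs inner ⟩
  ∑ πs (λ π → c * (𝟙 (inj? π) * 𝟙 ((f ∘ π) ≗? f″)))
    ≡⟨ ∑-*ˡ c πs (λ π → 𝟙 (inj? π) * 𝟙 ((f ∘ π) ≗? f″)) ⟩
  c * ∑ πs (λ π → 𝟙 (inj? π) * 𝟙 ((f ∘ π) ≗? f″))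
    ≡⟨ cong (_*_ c) (injections m f f″) ⟩
  c * placements m (occ f) f″ ∎
  where
  open ≡-Reasoning
  πs = Words n m
  f″ = f′ ∘ Fin.suc
  x = f′ Fin.zero
  c = occ f x - occ f″ x
  alg : ∀ p o y r → p * (+ 1 - o) * (y * r) ≡ (p * r) * (y - o * y)
  alg = solve-∀
  alg₂ : ∀ p r a b → (p * r) * (a - b) ≡ p * (r * (a - b))
  alg₂ = solve-∀
  alg₃ : ∀ p r c → p * (r * c) ≡ c * (p * r)
  alg₃ = solve-∀
  split : ∀ a π → 𝟙 ((f ∘ cons a π) ≗? f′) ≡ 𝟙 (f a Fin.≟ x) * 𝟙 ((f ∘ π) ≗? f″)
  split a π = trans (𝟙-cong ((f ∘ cons a π) ≗? f′) ((f a Fin.≟ x) ×-dec ((f ∘ π) ≗? f″)) (λ p → p Fin.zero , p ∘ Fin.suc)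
                       (λ { (p , q) Fin.zero → p ; (p , q) (Fin.suc i) → q i }))
                    (𝟙-× (f a Fin.≟ x) ((f ∘ π) ≗? f″))
  fibre : ∀ π → ∑ (allFin n) (λ a → occ π a * 𝟙 (f a Fin.≟ x)) ≡ occ (f ∘ π) x
  fibre π = begin
    ∑ (allFin n) (λ a → occ π a * 𝟙 (f a Fin.≟ x))
      ≡⟨ ∑-cong (allFin n) (λ a → sym (∑-*ʳ (𝟙 (f a Fin.≟ x)) (allFin m) (λ i → 𝟙 (π i Fin.≟ a)))) ⟩
    ∑ (allFin n) (λ a → ∑ (allFin m) (λ i → 𝟙 (π i Fin.≟ a) * 𝟙 (f a Fin.≟ x)))
      ≡⟨ ∑-swap (allFin n) (allFin m) (λ a i → 𝟙 (π i Fin.≟ a) * 𝟙 (f a Fin.≟ x)) ⟩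
    ∑ (allFin m) (λ i → ∑ (allFin n) (λ a → 𝟙 (π i Fin.≟ a) * 𝟙 (f a Fin.≟ x)))
      ≡⟨ ∑-cong (allFin m) (λ i → ∑-allFin-𝟙 n (π i) (λ a → 𝟙 (f a Fin.≟ x))) ⟩
    occ (f ∘ π) x ∎
  ∑-minus : ∀ {A : Set} (xs : List A) (g h : A → ℤ) → ∑ xs (λ y → g y - h y) ≡ ∑ xs g - ∑ xs h
  ∑-minus []       g h = refl
  ∑-minus (y ∷ ys) g h = trans (cong (_+_ (g y - h y)) (∑-minus ys g h)) (alg₄ (g y) (h y) (∑ ys g) (∑ ys h))
    where
    alg₄ : ∀ a b c d → (a - b) + (c - d) ≡ (a + c) - (b + d)
    alg₄ = solve-∀
  inner : ∀ π → ∑ (allFin n) (λ a → 𝟙 (inj? (cons a π)) * 𝟙 ((f ∘ cons a π) ≗? f′)) ≡ c * (𝟙 (inj? π) * 𝟙 ((f ∘ π) ≗? f″))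
  inner π = begin
    ∑ (allFin n) (λ a → 𝟙 (inj? (cons a π)) * 𝟙 ((f ∘ cons a π) ≗? f′))
      ≡⟨ ∑-cong (allFin n) (λ a → trans (cong₂ _*_ (𝟙-inj-cons a π) (split a π)) (alg (𝟙 (inj? π)) (occ π a) (𝟙 (f a Fin.≟ x)) (𝟙 ((f ∘ π) ≗? f″)))) ⟩
    ∑ (allFin n) (λ a → (𝟙 (inj? π) * 𝟙 ((f ∘ π) ≗? f″)) * (𝟙 (f a Fin.≟ x) - occ π a * 𝟙 (f a Fin.≟ x)))
      ≡⟨ ∑-*ˡ (𝟙 (inj? π) * 𝟙 ((f ∘ π) ≗? f″)) (allFin n) (λ a → 𝟙 (f a Fin.≟ x) - occ π a * 𝟙 (f a Fin.≟ x)) ⟩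
    (𝟙 (inj? π) * 𝟙 ((f ∘ π) ≗? f″)) * ∑ (allFin n) (λ a → 𝟙 (f a Fin.≟ x) - occ π a * 𝟙 (f a Fin.≟ x))
      ≡⟨ cong (_*_ (𝟙 (inj? π) * 𝟙 ((f ∘ π) ≗? f″))) (trans (∑-minus (allFin n) (λ a → 𝟙 (f a Fin.≟ x)) (λ a → occ π a * 𝟙 (f a Fin.≟ x))) (cong (λ z → occ f x - z) (fibre π))) ⟩
    (𝟙 (inj? π) * 𝟙 ((f ∘ π) ≗? f″)) * (occ f x - occ (f ∘ π) x)
      ≡⟨ alg₂ (𝟙 (inj? π)) (𝟙 ((f ∘ π) ≗? f″)) (occ f x) (occ (f ∘ π) x) ⟩
    𝟙 (inj? π) * (𝟙 ((f ∘ π) ≗? f″) * (occ f x - occ (f ∘ π) x))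
      ≡⟨ cong (_*_ (𝟙 (inj? π))) (𝟙-*-cong ((f ∘ π) ≗? f″) (λ eq → cong (λ z → occ f x - z) (∑-cong (allFin m) (λ i → cong (λ b → 𝟙 (b Fin.≟ x)) (eq i))))) ⟩
    𝟙 (inj? π) * (𝟙 ((f ∘ π) ≗? f″) * c)
      ≡⟨ alg₃ (𝟙 (inj? π)) (𝟙 ((f ∘ π) ≗? f″)) c ⟩
    c * (𝟙 (inj? π) * 𝟙 ((f ∘ π) ≗? f″)) ∎

falling : ℤ → ℕ → ℤ
falling U zero    = + 1
falling U (suc m) = (U - + m) * falling U m

∑-occ : ∀ {ℓ} m (f : Fin m → Fin ℓ) → ∑ (allFin ℓ) (occ f) ≡ + m
∑-occ {ℓ} m f = begin
  ∑ (allFin ℓ) (λ a → ∑ (allFin m) (λ i → 𝟙 (f i Fin.≟ a)))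
    ≡⟨ ∑-swap (allFin ℓ) (allFin m) (λ a i → 𝟙 (f i Fin.≟ a)) ⟩
  ∑ (allFin m) (λ i → ∑ (allFin ℓ) (λ a → 𝟙 (f i Fin.≟ a)))
    ≡⟨ ∑-cong (allFin m) (λ i → trans (∑-cong (allFin ℓ) (λ a → sym (ℤP.*-identityʳ (𝟙 (f i Fin.≟ a))))) (∑-allFin-𝟙 ℓ (f i) (λ _ → + 1))) ⟩
  ∑ (allFin m) (λ _ → + 1)
    ≡⟨ ones m ⟩
  + m ∎
  where
  open ≡-Reasoning
  ones : ∀ m → ∑ (allFin m) (λ _ → + 1) ≡ + m
  ones zero    = refl
  ones (suc m) = trans (∑-allFin-suc m (λ _ → + 1)) (trans (cong (_+_ (+ 1)) (ones m)) (sym (ℤP.pos-+ 1 m)))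

-- The sum of `u a - occ f a` over all colours depends on the length of `f` only, so the sum over
-- words factors step by step.
∑-placements : ∀ {ℓ} m (u : Fin ℓ → ℤ) → ∑ (Words ℓ m) (placements m u) ≡ falling (∑ (allFin ℓ) u) m
∑-placements zero u = refl
∑-placements {ℓ} (suc m) u = begin
  ∑ (Words ℓ (suc m)) (placements (suc m) u)
    ≡⟨ ∑-allFuns-suc (allFin ℓ) m (placements (suc m) u) (placements-congᶠ (suc m) u) ⟩
  ∑ fs (λ f → ∑ (allFin ℓ) (λ a → (u a - occ f a) * placements m u f))
    ≡⟨ ∑-cong fs (λ f → trans (∑-*ʳ (placements m u f) (allFin ℓ) (λ a → u a - occ f a)) (cong (_* placements m u f) (total f))) ⟩
  ∑ fs (λ f → (∑ (allFin ℓ) u - + m) * placements m u f)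
    ≡⟨ ∑-*ˡ (∑ (allFin ℓ) u - + m) fs (placements m u) ⟩
  (∑ (allFin ℓ) u - + m) * ∑ fs (placements m u)
    ≡⟨ cong (_*_ (∑ (allFin ℓ) u - + m)) (∑-placements m u) ⟩
  falling (∑ (allFin ℓ) u) (suc m) ∎
  where
  open ≡-Reasoning
  fs = Words ℓ m
  total : ∀ f → ∑ (allFin ℓ) (λ a → u a - occ f a) ≡ ∑ (allFin ℓ) u - + m
  total f = trans (trans (∑-∙ (allFin ℓ) u (λ a → - occ f a))
      (cong (_+_ (∑ (allFin ℓ) u)) (trans (∑-cong (allFin ℓ) (λ a → sym (ℤP.-1*i≡-i (occ f a)))) (trans (∑-*ˡ -[1+ 0 ] (allFin ℓ) (occ f)) (ℤP.-1*i≡-i _)))))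
    (cong (λ z → ∑ (allFin ℓ) u - z) (∑-occ m f))

falling-! : ∀ n m → falling (+ (n ℕ.+ m)) m * + (n ℕ.!) ≡ + ((n ℕ.+ m) ℕ.!)
falling-! n zero    = trans (ℤP.*-identityˡ _) (cong (λ z → + (z ℕ.!)) (sym (ℕP.+-identityʳ n)))
falling-! n (suc m) rewrite ℕP.+-suc n m = begin
  (+ suc (n ℕ.+ m) - + m) * falling (+ suc (n ℕ.+ m)) m * + (n ℕ.!)
    ≡⟨ cong (λ z → z * falling (+ suc (n ℕ.+ m)) m * + (n ℕ.!)) diff ⟩
  + suc n * falling (+ suc (n ℕ.+ m)) m * + (n ℕ.!)
    ≡⟨ alg (+ suc n) (falling (+ suc (n ℕ.+ m)) m) (+ (n ℕ.!)) ⟩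
  falling (+ suc (n ℕ.+ m)) m * (+ suc n * + (n ℕ.!))
    ≡⟨ cong (_*_ (falling (+ suc (n ℕ.+ m)) m)) (sym (ℤP.pos-* (suc n) (n ℕ.!))) ⟩
  falling (+ (suc n ℕ.+ m)) m * + (suc n ℕ.!)
    ≡⟨ falling-! (suc n) m ⟩
  + (suc (n ℕ.+ m) ℕ.!) ∎
  where
  open ≡-Reasoning
  alg : ∀ a b c → a * b * c ≡ b * (a * c)
  alg = solve-∀
  alg₂ : ∀ a b → (a + b) - b ≡ a
  alg₂ = solve-∀
  diff : + suc (n ℕ.+ m) - + m ≡ + suc n
  diff = trans (cong (_- + m) (ℤP.pos-+ (suc n) m)) (alg₂ (+ suc n) (+ m))

-- A colour used more than `k a` times meets the factor `k a - k a` on the way.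
placements-bound : ∀ {ℓ} m (k : Fin ℓ → ℕ) (f : Fin m → Fin ℓ) → placements m (λ a → + k a) f ≢ + 0 → ∀ a → content one f a ≤ k a
placements-bound zero    k f nz a = z≤n
placements-bound (suc m) k f nz a = subst (_≤ k a) (sym (∑ℕ-allFin-suc m (λ j → at (f j) a 1))) (bound (f Fin.zero Fin.≟ a))
  where
  f′ = f ∘ Fin.suc
  x  = f Fin.zero
  ih : ∀ b → content one f′ b ≤ k b
  ih = placements-bound m k f′ (λ e → nz (trans (cong (_*_ (+ k x - occ f′ x)) e) (ℤP.*-zeroʳ (+ k x - occ f′ x))))
  bound : Dec (x ≡ a) → at x a 1 ℕ.+ content one f′ a ≤ k a
  bound (no x≢a)   = subst (λ z → z ℕ.+ content one f′ a ≤ k a) (sym (at-≢ 1 (x≢a ∘ sym))) (ih a)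
  bound (yes refl) = subst (λ z → z ℕ.+ content one f′ x ≤ k x) (sym (at-self x 1))
    (ℕP.≤∧≢⇒< (ih x) (λ e → nz (cong (_* placements m (λ b → + k b) f′)
      (trans (cong (λ z → + k x - z) (trans (occ-content f′ x) (cong +_ e))) (ℤP.+-inverseʳ (+ k x))))))

≤-sum-eq : ∀ ℓ (f g : Fin ℓ → ℕ) → (∀ a → f a ≤ g a) → ∑ℕ (allFin ℓ) f ≡ ∑ℕ (allFin ℓ) g → ∀ a → f a ≡ g a
≤-sum-eq (suc ℓ) f g le eq = split (trans (sym (∑ℕ-allFin-suc ℓ f)) (trans eq (∑ℕ-allFin-suc ℓ g)))
  where
  ∑ℕ-mono : ∀ ℓ (f g : Fin ℓ → ℕ) → (∀ a → f a ≤ g a) → ∑ℕ (allFin ℓ) f ≤ ∑ℕ (allFin ℓ) g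
  ∑ℕ-mono zero    f g h = z≤n
  ∑ℕ-mono (suc ℓ) f g h = subst₂ _≤_ (sym (∑ℕ-allFin-suc ℓ f)) (sym (∑ℕ-allFin-suc ℓ g)) (ℕP.+-mono-≤ (h Fin.zero) (∑ℕ-mono ℓ (f ∘ Fin.suc) (g ∘ Fin.suc) (h ∘ Fin.suc)))
  ΣF ΣG : ℕ
  ΣF = ∑ℕ (allFin ℓ) (f ∘ Fin.suc)
  ΣG = ∑ℕ (allFin ℓ) (g ∘ Fin.suc)
  F≤G : ΣF ≤ ΣG
  F≤G = ∑ℕ-mono ℓ (f ∘ Fin.suc) (g ∘ Fin.suc) (le ∘ Fin.suc)
  split : f Fin.zero ℕ.+ ΣF ≡ g Fin.zero ℕ.+ ΣG → ∀ a → f a ≡ g a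
  split e = λ { Fin.zero → head ; (Fin.suc a) → ≤-sum-eq ℓ (f ∘ Fin.suc) (g ∘ Fin.suc) (le ∘ Fin.suc) (ℕP.+-cancelˡ-≡ (f Fin.zero) ΣF ΣG (trans e (cong (ℕ._+ ΣG) (sym head)))) a }
    where
    head : f Fin.zero ≡ g Fin.zero
    head = ℕP.≤-antisym (le Fin.zero) (ℕP.+-cancelʳ-≤ ΣG (g Fin.zero) (f Fin.zero) (subst (_≤ f Fin.zero ℕ.+ ΣG) e (ℕP.+-monoʳ-≤ (f Fin.zero) F≤G)))

∑-mult : ∀ {ℓ} (v : Vec (ℕ × Sign) ℓ) → ∑ℕ (allFin ℓ) (mult v) ≡ size (toList v)
∑-mult []                = refl
∑-mult {suc ℓ} ((k , e) ∷ v) = trans (∑ℕ-allFin-suc ℓ (mult ((k , e) ∷ v))) (cong (k ℕ.+_) (∑-mult v))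

-- A word of length `n` that overuses no colour must use each one exactly, since the multiplicities
-- add up to `n`. On all other words the product is already zero, so the indicator may be dropped.
placements-content : ∀ {ℓ} n (v : Vec (ℕ × Sign) ℓ) → size (toList v) ≡ n → (f : Fin n → Fin ℓ) →
  𝟙 (hasContent? one f v) * placements n (λ a → + mult v a) f ≡ placements n (λ a → + mult v a) f
placements-content {ℓ} n v sz f = absorb (hasContent? one f v) (Q ℤP.≟ + 0)
  where
  Q = placements n (λ a → + mult v a) f
  absorb : (d : Dec (HasContent one f v)) → Dec (Q ≡ + 0) → 𝟙 d * Q ≡ Q
  absorb (yes _) _       = ℤP.*-identityˡ Q
  absorb (no _)  (yes e) = sym e
  absorb (no ¬p) (no nz) = ⊥-elim (¬p (≤-sum-eq ℓ (content one f) (mult v) (placements-bound n (mult v) f nz)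
    (trans (ℤP.+-injective (trans (sym (∑-pos (allFin ℓ) (content one f))) (trans (∑-cong (allFin ℓ) (λ a → sym (occ-content f a))) (∑-occ n f))))
           (sym (trans (∑-mult v) sz)))))

-- As in Burnside's lemma, the sums over group elements and over colourings are exchanged. For a
-- colouring with the right content the signs give `A`, and its stabilizer is counted by
-- `placements` with `mult v` in place of `occ f`. In this form the sum extends to all words and
-- equals `n!`.
polya-Vec : ∀ {ℓ} n (v : Vec (ℕ × Sign) ℓ) → size (toList v) ≡ n →
  ∑ (allSPerm n) (λ w → P (signedCycles w) (toList v)) ≡ + (2 ℕ.^ n ℕ.* (n ℕ.!)) * ⟦ allPlus (toList v) ⟧
polya-Vec {ℓ} n v sz = begin
  ∑ (allSPerm n) (λ w → P (signedCycles w) (toList v))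
    ≡⟨ ∑-cong (allSPerm n) (λ w → P-invariant w v) ⟩
  ∑ (allSPerm n) (λ w → Y (perm w) (sign w))
    ≡⟨ ∑-allSPerm n Y ⟩
  ∑ πs (λ π → ⟦ isInjective π ⟧ * ∑ εs (Y π))
    ≡⟨ ∑-cong πs (λ π → cong₂ _*_ (𝟙-cong (T? (isInjective π)) (inj? π) (isInjective⁻ π) (isInjective⁺ π)) (inner π)) ⟩
  ∑ πs (λ π → 𝟙 (inj? π) * ∑ fs (λ f → 𝟙 (invariant? π f) * (𝟙 (hasContent? one f v) * A)))
    ≡⟨ ∑-cong πs (λ π → sym (∑-*ˡ (𝟙 (inj? π)) fs (λ f → 𝟙 (invariant? π f) * (𝟙 (hasContent? one f v) * A)))) ⟩
  ∑ πs (λ π → ∑ fs (λ f → 𝟙 (inj? π) * (𝟙 (invariant? π f) * (𝟙 (hasContent? one f v) * A))))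
    ≡⟨ ∑-swap πs fs (λ π f → 𝟙 (inj? π) * (𝟙 (invariant? π f) * (𝟙 (hasContent? one f v) * A))) ⟩
  ∑ fs (λ f → ∑ πs (λ π → 𝟙 (inj? π) * (𝟙 (invariant? π f) * (𝟙 (hasContent? one f v) * A))))
    ≡⟨ ∑-cong fs (λ f → trans (∑-cong πs (λ π → sym (ℤP.*-assoc (𝟙 (inj? π)) (𝟙 (invariant? π f)) (𝟙 (hasContent? one f v) * A))))
         (∑-*ʳ (𝟙 (hasContent? one f v) * A) πs (λ π → 𝟙 (inj? π) * 𝟙 (invariant? π f)))) ⟩
  ∑ fs (λ f → ∑ πs (λ π → 𝟙 (inj? π) * 𝟙 (invariant? π f)) * (𝟙 (hasContent? one f v) * A))
    ≡⟨ ∑-cong fs (λ f → trans (cong (_* (𝟙 (hasContent? one f v) * A)) (injections n f f)) (collect f)) ⟩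
  ∑ fs (λ f → A * placements n (λ a → + mult v a) f)
    ≡⟨ ∑-*ˡ A fs (placements n (λ a → + mult v a)) ⟩
  A * ∑ fs (placements n (λ a → + mult v a))
    ≡⟨ cong (_*_ A) (trans (∑-placements n (λ a → + mult v a)) factorial) ⟩
  A * + (n ℕ.!)
    ≡⟨ alg (+ (2 ℕ.^ n)) ⟦ allPlus (toList v) ⟧ (+ (n ℕ.!)) ⟩
  + (2 ℕ.^ n) * + (n ℕ.!) * ⟦ allPlus (toList v) ⟧
    ≡⟨ cong (_* ⟦ allPlus (toList v) ⟧) (sym (ℤP.pos-* (2 ℕ.^ n) (n ℕ.!))) ⟩
  + (2 ℕ.^ n ℕ.* (n ℕ.!)) * ⟦ allPlus (toList v) ⟧ ∎
  where
  open ≡-Reasoning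
  πs = Words n n
  εs = allFunsTo (⊕ ∷ ⊖ ∷ []) n
  fs = Words ℓ n
  A = + (2 ℕ.^ n) * ⟦ allPlus (toList v) ⟧
  Y : (Fin n → Fin n) → (Fin n → Sign) → ℤ
  Y π ε = ∑ fs (λ f → 𝟙 (invariant? π f) * wordTerm one ε v f)
  alg : ∀ a b c → a * b * c ≡ a * c * b
  alg = solve-∀
  alg₂ : ∀ p h a → p * (h * a) ≡ a * (h * p)
  alg₂ = solve-∀
  factorial : falling (∑ (allFin ℓ) (λ a → + mult v a)) n ≡ + (n ℕ.!)
  factorial = trans (cong (λ U → falling U n) (trans (∑-pos (allFin ℓ) (mult v)) (cong +_ (trans (∑-mult v) sz))))
    (trans (sym (ℤP.*-identityʳ _)) (falling-! 0 n))
  inner : ∀ π → ∑ εs (Y π) ≡ ∑ fs (λ f → 𝟙 (invariant? π f) * (𝟙 (hasContent? one f v) * A))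
  inner π = trans (∑-swap εs fs (λ ε f → 𝟙 (invariant? π f) * wordTerm one ε v f))
    (∑-cong fs (λ f → trans (∑-*ˡ (𝟙 (invariant? π f)) εs (λ ε → wordTerm one ε v f))
      (cong (_*_ (𝟙 (invariant? π f))) (trans (∑-*ˡ (𝟙 (hasContent? one f v)) εs (λ ε → signProd ε f v))
        (𝟙-*-cong (hasContent? one f v) (λ p → trans (∑-signs n (λ i → signAt v (f i))) (signs-allPlus n f v p)))))))
  collect : ∀ f → placements n (occ f) f * (𝟙 (hasContent? one f v) * A) ≡ A * placements n (λ a → + mult v a) f
  collect f = trans (alg₂ (placements n (occ f) f) (𝟙 (hasContent? one f v)) A)
    (cong (_*_ A) (trans (𝟙-*-cong (hasContent? one f v) (λ p → placements-cong n f (λ a → trans (occ-content f a) (cong +_ (p a)))))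
                         (placements-content n v sz f)))

-- Pólya enumeration: the Frobenius characteristic of the trivial character is h_n(x).
polya : ∀ n δ → size δ ≡ n → ∑ (allSPerm n) (λ w → P (signedCycles w) δ) ≡ + (2 ℕ.^ n ℕ.* (n ℕ.!)) * ⟦ allPlus δ ⟧
polya n δ sz = subst (λ d → size d ≡ n → ∑ (allSPerm n) (λ w → P (signedCycles w) d) ≡ + (2 ℕ.^ n ℕ.* (n ℕ.!)) * ⟦ allPlus d ⟧)
                     (VecP.toList∘fromList δ) (polya-Vec n (Vec.fromList δ)) sz

-- Fine sets and the Frobenius characteristic

D-size : ∀ k t (g : Comp → ℤ) δ → (∀ δ′ → k ℕ.+ size δ′ ≡ size δ → g δ′ ≡ + 0) → D k t g δ ≡ + 0
D-size k t g []            van = refl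
D-size k t g ((d , e) ∷ δ) van = cong₂ _+_ lead (D-size k t (λ β → g ((d , e) ∷ β)) δ
    (λ δ′ eq → van _ (trans (shuffle k d (size δ′)) (cong (d ℕ.+_) eq))))
  where
  shuffle : ∀ a b c → a ℕ.+ (b ℕ.+ c) ≡ b ℕ.+ (a ℕ.+ c)
  shuffle a b c = trans (sym (ℕP.+-assoc a b c)) (trans (cong (ℕ._+ c) (ℕP.+-comm a b)) (ℕP.+-assoc b a c))
  lead : ⟦ k ≤ᵇ d ⟧ * sg t e * g ((d ∸ k , e) ∷ δ) ≡ + 0
  lead with k ≤ᵇ d in eq
  ... | false = refl
  ... | true  = trans (cong (_*_ (+ 1 * sg t e)) (van _ (trans (sym (ℕP.+-assoc k (d ∸ k) (size δ))) (cong (ℕ._+ size δ) (ℕP.m+[n∸m]≡n (ℕP.≤ᵇ⇒≤ k d (subst T (sym eq) tt)))))))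
                      (ℤP.*-zeroʳ (+ 1 * sg t e))

P-size : ∀ C δ → size δ ≢ size C → P C δ ≡ + 0
P-size []            δ h = cong ⟦_⟧ (allZero-size δ (ℕP.n≢0⇒n>0 h))
P-size ((k , t) ∷ C) δ h = D-size k t (P C) δ (λ δ′ eq → P-size C δ′ (λ e → h (trans (sym eq) (cong (k ℕ.+_) e))))

F-size : ∀ zs δ → size δ ≢ length zs → F zs δ ≡ + 0
F-size zs δ h with Fc zs δ in eq
... | false = refl
... | true  = ⊥-elim (h (Fc-size zs δ (subst T (sym eq) tt)))

byParts : Comp → Comp
byParts C = map (_, ⊕) (partsWith ⊕ C) ++ map (_, ⊖) (partsWith ⊖ C)

↭-byParts : ∀ C → C ↭ byParts C
↭-byParts []            = Perm.refl
↭-byParts ((k , ⊕) ∷ C) = Perm.prep (k , ⊕) (↭-byParts C)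
↭-byParts ((k , ⊖) ∷ C) = Perm.trans (Perm.prep (k , ⊖) (↭-byParts C)) (Perm.↭-sym (PermP.shift (k , ⊖) (map (_, ⊕) (partsWith ⊕ C)) (map (_, ⊖) (partsWith ⊖ C))))

cycleType⇒↭ : ∀ {n} (w : SPerm n) γ → HasSignedCycleType w γ → signedCycles w ↭ γ
cycleType⇒↭ w γ (p , q) = Perm.trans (↭-byParts (signedCycles w)) (Perm.trans (PermP.++⁺ (PermP.map⁺ (_, ⊕) p) (PermP.map⁺ (_, ⊖) q)) (Perm.↭-sym (↭-byParts γ)))

↭⇒cycleType : ∀ {n} (w : SPerm n) γ → signedCycles w ↭ γ → HasSignedCycleType w γ
↭⇒cycleType w γ p = PermP.map⁺ proj₁ (PermP.filter-↭ (λ x → proj₂ x ≟ˢ ⊕) p) , PermP.map⁺ proj₁ (PermP.filter-↭ (λ x → proj₂ x ≟ˢ ⊖) p)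

∑-≢0 : {A : Set} (xs : List A) (f : A → ℤ) → ∑ xs f ≢ + 0 → ∃ λ x → f x ≢ + 0
∑-≢0 []       f h = ⊥-elim (h refl)
∑-≢0 (x ∷ xs) f h with f x ℤP.≟ + 0
... | no ne = x , ne
... | yes e = ∑-≢0 xs f (λ e′ → h (cong₂ _+_ e e′))

-- Every part receives an index of its own, so flattening adds only zero parts.
monomialOf : (δ : Comp) → Monomial (length δ)
monomialOf []            = [] , []
monomialOf ((k , ⊕) ∷ δ) = k ∷ proj₁ (monomialOf δ) , 0 ∷ proj₂ (monomialOf δ)
monomialOf ((k , ⊖) ∷ δ) = 0 ∷ proj₁ (monomialOf δ) , k ∷ proj₂ (monomialOf δ)

flat-monomialOf : ∀ {δ} → Pos δ → norm (flat (monomialOf δ)) ≡ δ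
flat-monomialOf []                                   = refl
flat-monomialOf {(suc k , ⊕) ∷ δ} (_ ∷ pos) = cong ((suc k , ⊕) ∷_) (flat-monomialOf pos)
flat-monomialOf {(suc k , ⊖) ∷ δ} (_ ∷ pos) = cong ((suc k , ⊖) ∷_) (flat-monomialOf pos)

∑-QuasiSym : {A : Set} (xs : List A) (c : A → ℤ) (G : A → Comp → ℤ) → (∀ x → QuasiSym (G x)) → QuasiSym (λ δ → ∑ xs (λ x → c x * G x δ))
∑-QuasiSym xs c G q δ = ∑-cong xs (λ x → cong (_*_ (c x)) (q x δ))

toList-inj : ∀ {A : Set} {n} (u v : Vec A n) → toList u ≡ toList v → u ≡ v
toList-inj []      []      eq = refl
toList-inj (x ∷ u) (y ∷ v) eq = cong₂ _∷_ (ListP.∷-injectiveˡ eq) (toList-inj u v (ListP.∷-injectiveʳ eq))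

order : ℕ → ℕ
order n = 2 ℕ.^ n ℕ.* (n ℕ.!)

order-cancel : ∀ n {x y} → + order n * x ≡ + order n * y → x ≡ y
order-cancel n {x} {y} eq = ℤP.*-cancelˡ-≡ (+ order n) x y ⦃ order-nonZero ⦄ eq
  where
  order-nonZero : ℤ.NonZero (+ order n)
  order-nonZero = ℕ.>-nonZero (ℕP.*-mono-≤ (ℕP.m^n>0 2 n) (n!>0 n))
    where
    n!>0 : ∀ n → 1 ≤ n ℕ.!
    n!>0 zero    = s≤s z≤n
    n!>0 (suc n) = ℕP.*-mono-≤ (s≤s {n = n} z≤n) (n!>0 n)

order≢0 : ∀ n → + order n ≢ + 0
order≢0 n e with () ← order-cancel n {+ 1} {+ 0} (trans (ℤP.*-identityʳ (+ order n)) (trans e (sym (ℤP.*-zeroʳ (+ order n)))))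

-- The coefficient functions of 2^n n! ch(χ) and of Σ_b F_{sDes b}.
chCoeff : ∀ {n} → (SPerm n → ℤ) → Comp → ℤ
chCoeff {n} χ δ = ∑ (allSPerm n) (λ w → χ w * P (signedCycles w) δ)

sumF : ∀ {n N} → (Fin N → Vec (Maybe Sign) n) → Comp → ℤ
sumF {n} {N} sDes δ = ∑ (allFin N) (λ b → F (withSigns (toList (sDes b))) δ)

chCoeff-QuasiSym : ∀ {n} (χ : SPerm n → ℤ) → QuasiSym (chCoeff χ)
chCoeff-QuasiSym {n} χ = ∑-QuasiSym (allSPerm n) χ (λ w → P (signedCycles w)) (λ w → P-QuasiSym (signedCycles-Pos w))

sumF-QuasiSym : ∀ {n N} (sDes : Fin N → Vec (Maybe Sign) n) → QuasiSym (sumF sDes)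
sumF-QuasiSym {N = N} sDes δ = ∑-cong (allFin N) (λ b → F-QuasiSym (withSigns (toList (sDes b))) δ)

L-chCoeff : ∀ {n} (χ : SPerm n → ℤ) γ → L γ (chCoeff χ) ≡ ∑ (allSPerm n) (λ w → χ w * L γ (P (signedCycles w)))
L-chCoeff {n} χ γ = trans (lin-∑ (L-linear γ) (allSPerm n) (λ w δ → χ w * P (signedCycles w) δ))
                          (∑-cong (allSPerm n) (λ w → L-linear γ .lin-* (χ w) (P (signedCycles w))))

L-polya : ∀ n γ → Pos γ → size γ ≡ n → ∑ (allSPerm n) (λ w → L γ (P (signedCycles w))) ≡ + order n
L-polya n γ pos sz = begin
  ∑ (allSPerm n) (λ w → L γ (P (signedCycles w)))
    ≡⟨ sym (lin-∑ (L-linear γ) (allSPerm n) (λ w → P (signedCycles w))) ⟩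
  L γ (λ δ → ∑ (allSPerm n) (λ w → P (signedCycles w) δ))
    ≡⟨ L-support γ (λ δ _ eq → polya n δ (trans eq sz)) ⟩
  L γ (λ δ → + order n * ⟦ allPlus δ ⟧)
    ≡⟨ L-linear γ .lin-* (+ order n) (λ δ → ⟦ allPlus δ ⟧) ⟩
  + order n * L γ (λ δ → ⟦ allPlus δ ⟧)
    ≡⟨ cong (_*_ (+ order n)) (L-allPlus γ pos) ⟩
  + order n * + 1
    ≡⟨ ℤP.*-identityʳ (+ order n) ⟩
  + order n ∎
  where open ≡-Reasoning

L-sumF : ∀ {n N} (sDes : Fin N → Vec (Maybe Sign) n) γ → size γ ≡ n → L γ (sumF sDes) ≡ sumFinℤ N (λ b → wt γ (sDes b))
L-sumF {n} {N} sDes γ sz = trans (lin-∑ (L-linear γ) (allFin N) (λ b → F (withSigns (toList (sDes b)))))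
                                 (∑-cong (allFin N) (λ b → sym (wt≡L-F γ (sDes b) sz)))

countFibre-Rib : ∀ {n N} (sDes : Fin N → Vec (Maybe Sign) n) → (∀ b → IsSignedSet (sDes b)) →
  (σ : Vec (Maybe Sign) n) → IsSignedSet σ → + countFibre sDes σ ≡ Rib 0 (toList σ) (sumF sDes)
countFibre-Rib {n} {N} sDes valid σ vσ = trans (length-filter (λ b → VecP.≡-dec (MaybeP.≡-dec _≟ˢ_) (sDes b) σ) (allFin N))
  (trans (∑-cong (allFin N) term) (sym (lin-∑ (Rib-linear 0 (toList σ)) (allFin N) (λ b → F (withSigns (toList (sDes b)))))))
  where
  term : ∀ b → 𝟙 (VecP.≡-dec (MaybeP.≡-dec _≟ˢ_) (sDes b) σ) ≡ Rib 0 (toList σ) (F (withSigns (toList (sDes b))))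
  term b = trans (𝟙-cong (VecP.≡-dec (MaybeP.≡-dec _≟ˢ_) (sDes b) σ) d (cong toList) (toList-inj (sDes b) σ))
                 (sym (Rib-F (toList σ) (toList (sDes b)) (trans (VecP.length-toList (sDes b)) (sym (VecP.length-toList σ))) vσ (valid b) d))
    where d = ListP.≡-dec (MaybeP.≡-dec _≟ˢ_) (toList (sDes b)) (toList σ)

module _ (n : ℕ) (χ : SPerm n → ℤ) (isχ : IsCharacter n χ) where

  open Character n χ isχ

  -- By orthogonality only elements of cycle type `γ` contribute, and there χ has the value `χ w₀`.
  -- The case distinction is on this value, an integer, and not on the cycle type.
  L-ch : ∀ γ → Pos γ → size γ ≡ n → ∀ w₀ → signedCycles w₀ ↭ γ → L γ (chCoeff χ) ≡ + order n * χ w₀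
  L-ch γ pos sz w₀ p₀ = begin
    L γ (chCoeff χ)
      ≡⟨ L-chCoeff χ γ ⟩
    ∑ (allSPerm n) (λ w → χ w * L γ (P (signedCycles w)))
      ≡⟨ ∑-cong (allSPerm n) term ⟩
    ∑ (allSPerm n) (λ w → χ w₀ * L γ (P (signedCycles w)))
      ≡⟨ ∑-*ˡ (χ w₀) (allSPerm n) (λ w → L γ (P (signedCycles w))) ⟩
    χ w₀ * ∑ (allSPerm n) (λ w → L γ (P (signedCycles w)))
      ≡⟨ cong (_*_ (χ w₀)) (L-polya n γ pos sz) ⟩
    χ w₀ * + order n
      ≡⟨ ℤP.*-comm (χ w₀) (+ order n) ⟩
    + order n * χ w₀ ∎
    where
    open ≡-Reasoning
    term : ∀ w → χ w * L γ (P (signedCycles w)) ≡ χ w₀ * L γ (P (signedCycles w))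
    term w with χ w ℤP.≟ χ w₀
    ... | yes e = cong (_* L γ (P (signedCycles w))) e
    ... | no ne = trans (trans (cong (_*_ (χ w)) vanish) (ℤP.*-zeroʳ (χ w))) (sym (trans (cong (_*_ (χ w₀)) vanish) (ℤP.*-zeroʳ (χ w₀))))
      where
      vanish : L γ (P (signedCycles w)) ≡ + 0
      vanish = L-P-orthogonal (signedCycles w) γ (signedCycles-Pos w) pos
        (λ p → ne (χ-cycleType w w₀ (Perm.trans p (Perm.↭-sym p₀))))

  -- By counting: the sum in L-polya is nonzero.
  cycleType-exists : ∀ γ → Pos γ → size γ ≡ n → ¬ ¬ (∃ λ w → signedCycles w ↭ γ)
  cycleType-exists γ pos sz none = proj₂ witness
      (L-P-orthogonal (signedCycles (proj₁ witness)) γ (signedCycles-Pos (proj₁ witness)) pos (λ p → none (proj₁ witness , p)))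
    where
    witness : ∃ λ w → L γ (P (signedCycles w)) ≢ + 0
    witness = ∑-≢0 (allSPerm n) (λ w → L γ (P (signedCycles w))) (λ e → order≢0 n (trans (sym (L-polya n γ pos sz)) e))

  fine⇒coeff : ∀ {N} (sDes : Fin N → Vec (Maybe Sign) n) → IsFineSet n χ N sDes →
    ∀ δ → Pos δ → size δ ≡ n → chCoeff χ δ ≡ + order n * sumF sDes δ
  fine⇒coeff {N} sDes fine δ pδ sδ = trans (unfold (chCoeff χ δ) (+ order n) (sumF sDes δ))
      (trans (cong (_+ + order n * sumF sDes δ) (L-injective n n g ℕP.≤-refl van δ pδ sδ)) (ℤP.+-identityˡ _))
    where
    g : Comp → ℤ
    g δ = chCoeff χ δ + (- + order n) * sumF sDes δ
    unfold : ∀ a k b → a ≡ (a + (- k) * b) + k * b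
    unfold = solve-∀
    alg : ∀ k x → k * x + (- k) * x ≡ + 0
    alg = solve-∀
    van : ∀ γ → Pos γ → size γ ≡ n → L γ g ≡ + 0
    -- An element of cycle type `γ` is available only up to double negation; equality of integers is
    -- decidable and hence stable.
    van γ pos sz = decidable-stable (L γ g ℤP.≟ + 0) (λ ne → cycleType-exists γ pos sz (λ { (w , p) → ne (begin
      L γ g
        ≡⟨ L-linear γ .lin-+ (chCoeff χ) (λ δ → (- + order n) * sumF sDes δ) ⟩
      L γ (chCoeff χ) + L γ (λ δ → (- + order n) * sumF sDes δ)
        ≡⟨ cong₂ _+_ (L-ch γ pos sz w p) (L-linear γ .lin-* (- + order n) (sumF sDes)) ⟩
      + order n * χ w + (- + order n) * L γ (sumF sDes)
        ≡⟨ cong (λ z → + order n * χ w + (- + order n) * z) (trans (L-sumF sDes γ sz) (sym (fine γ (pos , sz) w (↭⇒cycleType w γ p)))) ⟩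
      + order n * χ w + (- + order n) * χ w
        ≡⟨ alg (+ order n) (χ w) ⟩
      + 0 ∎) }))
      where open ≡-Reasoning

  ch-lhs : ∀ {M} (m : Monomial M) → sumListℤ (map (λ w → χ w * coeff m (powerSumOfType M w)) (allSPerm n)) ≡ chCoeff χ (flat m)
  ch-lhs m = ∑-cong (allSPerm n) (λ w → cong (_*_ (χ w)) (coeff-powerSums (signedCycles w) m))

  ch-rhs : ∀ {N} (sDes : Fin N → Vec (Maybe Sign) n) → (∀ b → IsSignedSet (sDes b)) → ∀ {M} (m : Monomial M) →
    sumFinℤ N (λ b → coeffF m (sDes b)) ≡ sumF sDes (flat m)
  ch-rhs {N} sDes valid m = ∑-cong (allFin N) (λ b → coeffF-F (sDes b) (valid b) m)

  fine⇒ch : ∀ N (sDes : Fin N → Vec (Maybe Sign) n) → (∀ b → IsSignedSet (sDes b)) → IsFineSet n χ N sDes → ChEquation n χ N sDes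
  fine⇒ch N sDes valid fine M m = trans (ch-lhs m) (trans (coeffs (size (flat m) ℕ.≟ n)) (cong (_*_ (+ order n)) (sym (ch-rhs sDes valid m))))
    where
    coeffs : Dec (size (flat m) ≡ n) → chCoeff χ (flat m) ≡ + order n * sumF sDes (flat m)
    coeffs (yes sz) = trans (sym (chCoeff-QuasiSym χ (flat m)))
      (trans (fine⇒coeff sDes fine (norm (flat m)) (norm-Pos (flat m)) (trans (norm-size (flat m)) sz))
             (cong (_*_ (+ order n)) (sumF-QuasiSym sDes (flat m))))
    -- Every term on either side is homogeneous of degree `n`, so both sides vanish in other
    -- degrees.
    coeffs (no nsz) = trans
      (∑-ε (allSPerm n) (λ w → trans (cong (_*_ (χ w)) (P-size (signedCycles w) (flat m) (λ e → nsz (trans e (signedCycles-size w))))) (ℤP.*-zeroʳ (χ w))))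
      (sym (trans (cong (_*_ (+ order n)) (∑-ε (allFin N) (λ b → F-size (withSigns (toList (sDes b))) (flat m)
             (λ e → nsz (trans e (trans (length-withSigns (toList (sDes b))) (VecP.length-toList (sDes b)))))))) (ℤP.*-zeroʳ (+ order n))))

  ch⇒fine : ∀ N (sDes : Fin N → Vec (Maybe Sign) n) → (∀ b → IsSignedSet (sDes b)) → ChEquation n χ N sDes → IsFineSet n χ N sDes
  ch⇒fine N sDes valid ch γ (pos , sz) w type = order-cancel n (begin
    + order n * χ w                           ≡⟨ sym (L-ch γ pos sz w (cycleType⇒↭ w γ type)) ⟩
    L γ (chCoeff χ)                           ≡⟨ L-support γ (λ δ p _ → coeffs δ p) ⟩
    L γ (λ δ → + order n * sumF sDes δ)       ≡⟨ L-linear γ .lin-* (+ order n) (sumF sDes) ⟩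
    + order n * L γ (sumF sDes)               ≡⟨ cong (_*_ (+ order n)) (L-sumF sDes γ sz) ⟩
    + order n * sumFinℤ N (λ b → wt γ (sDes b)) ∎)
    where
    open ≡-Reasoning
    coeffs : ∀ δ → Pos δ → chCoeff χ δ ≡ + order n * sumF sDes δ
    coeffs δ p = begin
      chCoeff χ δ                  ≡⟨ cong (chCoeff χ) (sym (flat-monomialOf p)) ⟩
      chCoeff χ (norm (flat m))    ≡⟨ chCoeff-QuasiSym χ (flat m) ⟩
      chCoeff χ (flat m)           ≡⟨ trans (sym (ch-lhs m)) (trans (ch (length δ) m) (cong (_*_ (+ order n)) (ch-rhs sDes valid m))) ⟩
      + order n * sumF sDes (flat m)         ≡⟨ cong (_*_ (+ order n)) (sym (sumF-QuasiSym sDes (flat m))) ⟩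
      + order n * sumF sDes (norm (flat m))  ≡⟨ cong (λ d → + order n * sumF sDes d) (flat-monomialOf p) ⟩
      + order n * sumF sDes δ      ∎
      where m = monomialOf δ

  fine-unique : ∀ N₁ (sDes₁ : Fin N₁ → Vec (Maybe Sign) n) N₂ (sDes₂ : Fin N₂ → Vec (Maybe Sign) n) →
    (∀ b → IsSignedSet (sDes₁ b)) → (∀ b → IsSignedSet (sDes₂ b)) →
    IsFineSet n χ N₁ sDes₁ → IsFineSet n χ N₂ sDes₂ →
    (σ : Vec (Maybe Sign) n) → IsSignedSet σ → countFibre sDes₁ σ ≡ countFibre sDes₂ σ
  fine-unique N₁ sDes₁ N₂ sDes₂ v₁ v₂ fine₁ fine₂ σ vσ = ℤP.+-injective (begin
    + countFibre sDes₁ σ               ≡⟨ countFibre-Rib sDes₁ v₁ σ vσ ⟩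
    Rib 0 (toList σ) (sumF sDes₁)      ≡⟨ Rib-support 0 (toList σ) (λ δ p sz → same δ p (trans sz (VecP.length-toList σ))) ⟩
    Rib 0 (toList σ) (sumF sDes₂)      ≡⟨ sym (countFibre-Rib sDes₂ v₂ σ vσ) ⟩
    + countFibre sDes₂ σ               ∎)
    where
    open ≡-Reasoning
    same : ∀ δ → Pos δ → size δ ≡ n → sumF sDes₁ δ ≡ sumF sDes₂ δ
    same δ p sz = order-cancel n (trans (sym (fine⇒coeff sDes₁ fine₁ δ p sz)) (fine⇒coeff sDes₂ fine₂ δ p sz))

theorem3p6 : (n : ℕ) (χ : SPerm n → ℤ) → IsCharacter n χ →
    ( (N : ℕ) (sDes : Fin N → Vec (Maybe Sign) n) → (∀ b → IsSignedSet (sDes b)) →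
        (IsFineSet n χ N sDes ⇔ ChEquation n χ N sDes) )
    × ( (N₁ : ℕ) (sDes₁ : Fin N₁ → Vec (Maybe Sign) n) (N₂ : ℕ) (sDes₂ : Fin N₂ → Vec (Maybe Sign) n) →
        (∀ b → IsSignedSet (sDes₁ b)) → (∀ b → IsSignedSet (sDes₂ b)) →
        IsFineSet n χ N₁ sDes₁ → IsFineSet n χ N₂ sDes₂ →
        (σ : Vec (Maybe Sign) n) → IsSignedSet σ → countFibre sDes₁ σ ≡ countFibre sDes₂ σ )
theorem3p6 n χ isχ =
  (λ N sDes valid → mk⇔ (fine⇒ch n χ isχ N sDes valid) (ch⇒fine n χ isχ N sDes valid)) , fine-unique n χ isχ
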